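{- For every positive integer $m$ such that the shell $(\mathbb{Z}^2)_m=\{x\in\mathbb{Z}^2 : (x,x)=m\}$ is nonempty, the shell $(\mathbb{Z}^2)_m$ is not a spherical $4$-design.
   Context: $(x,y)$ denotes the standard Euclidean inner product on $\mathbb{R}^2$. A finite nonempty set $X\subset S^{n-1}=\{x\in\mathbb{R}^n: x_1^2+\cdots+x_n^2=1\}$ is a spherical $t$-design if $\frac{1}{|X|}\sum_{x\in X}f(x)=\frac{1}{|S^{n-1}|}\int_{S^{n-1}}f(x)\,d\sigma(x)$ for all polynomials $f$ of degree at most $t$; a finite nonempty subset $X$ of the sphere $S^{n-1}(r)$ of radius $r$ is a spherical $t$-design if $\frac{1}{r}X$ is one. (For $n=2$, identifying $\mathbb{R}^2$ with $\mathbb{C}$, a finite set $\{\xi_1,\dots,\xi_N\}$ on the unit circle is a spherical $t$-design iff $\sum_i \xi_i^k=0$ for all $k=1,\dots,t$.) -}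

module Defs where

open import Data.Integer.Base as ℤ using (ℤ)
open import Data.List.Base using (List; map; foldr; upTo)
import Data.List.Base as List
open import Data.List.NonEmpty.Base using (List⁺; _∷_; toList)
import Data.List.NonEmpty.Base as List⁺
open import Data.List.Relation.Unary.All using (All)
import Data.List.Membership.Setoid as Membership
import Data.List.Relation.Unary.Unique.Setoid as Unique
open import Data.Nat.Base as ℕ using (ℕ; zero; suc)
import Data.Nat.Properties as ℕ
open import Data.Product.Base using (Σ-syntax; ∃-syntax; _×_; _,_)
open import Data.Product.Relation.Binary.Pointwise.NonDependent using (×-setoid)
open import Data.Rational.Base as ℚ using (ℚ; 0ℚ; 1ℚ; ½)
import Data.Rational.Properties as ℚ
open import Data.Rational.Solver using (module +-*-Solver)
open import Data.Sum.Base using (inj₁; inj₂)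
open import Function.Bundles using (_⇔_)
open import Level using (0ℓ)
open import Relation.Binary.Bundles using (Setoid)
open import Relation.Binary.PropositionalEquality using (_≡_; refl; sym; trans; cong; cong₂; subst; subst₂)
open import Relation.Nullary using (¬_; yes; no; contradiction)
open import Relation.Unary using (Pred)

------------------------------------------------------------------------
-- Estimates used to close ℝ under its operations

open +-*-Solver using (solve; _:=_; _:+_; _:*_; _:-_; :-_)

abstract

  ⊔ˡ : ∀ a b {n} → a ℕ.⊔ b ℕ.≤ n → a ℕ.≤ n
  ⊔ˡ a b = ℕ.≤-trans (ℕ.m≤m⊔n a b)

  ⊔ʳ : ∀ a b {n} → a ℕ.⊔ b ℕ.≤ n → b ℕ.≤ n
  ⊔ʳ a b = ℕ.≤-trans (ℕ.m≤n⊔m a b)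

  half+half : ∀ ε → ½ ℚ.* ε ℚ.+ ½ ℚ.* ε ≡ ε
  half+half ε = trans (sym (ℚ.*-distribʳ-+ ε ½ ½)) (ℚ.*-identityˡ ε)

  *-pos : ∀ {p q} → 0ℚ ℚ.< p → 0ℚ ℚ.< q → 0ℚ ℚ.< p ℚ.* q
  *-pos {p} {q} 0<p 0<q =
    ℚ.positive⁻¹ (p ℚ.* q) {{ℚ.pos*pos⇒pos p {{ℚ.positive 0<p}} q {{ℚ.positive 0<q}}}}

  half-pos : ∀ {ε} → 0ℚ ℚ.< ε → 0ℚ ℚ.< ½ ℚ.* ε
  half-pos = *-pos (ℚ.positive⁻¹ ½)

  ∣∣-sub-comm : ∀ p q → ℚ.∣ p ℚ.- q ∣ ≡ ℚ.∣ q ℚ.- p ∣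
  ∣∣-sub-comm p q = trans (cong ℚ.∣_∣ (solve 2 (λ a b → a :- b := :- (b :- a)) refl p q))
                          (ℚ.∣-p∣≡∣p∣ (q ℚ.- p))

  ∣∣-triangle : ∀ p q r → ℚ.∣ p ℚ.- r ∣ ℚ.≤ ℚ.∣ p ℚ.- q ∣ ℚ.+ ℚ.∣ q ℚ.- r ∣
  ∣∣-triangle p q r = subst (λ e → ℚ.∣ e ∣ ℚ.≤ ℚ.∣ p ℚ.- q ∣ ℚ.+ ℚ.∣ q ℚ.- r ∣)
    (solve 3 (λ a b c → (a :- b) :+ (b :- c) := a :- c) refl p q r)
    (ℚ.∣p+q∣≤∣p∣+∣q∣ (p ℚ.- q) (q ℚ.- r))

  ∣∣-diff≤ : ∀ p q → ℚ.∣ p ∣ ℚ.- ℚ.∣ q ∣ ℚ.≤ ℚ.∣ p ℚ.- q ∣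
  ∣∣-diff≤ p q = subst₂ ℚ._≤_ refl
    (solve 2 (λ a b → (a :+ b) :- b := a) refl ℚ.∣ p ℚ.- q ∣ ℚ.∣ q ∣)
    (ℚ.+-monoˡ-≤ (ℚ.- ℚ.∣ q ∣)
      (subst (λ e → ℚ.∣ e ∣ ℚ.≤ ℚ.∣ p ℚ.- q ∣ ℚ.+ ℚ.∣ q ∣)
        (solve 2 (λ a b → (a :- b) :+ b := a) refl p q)
        (ℚ.∣p+q∣≤∣p∣+∣q∣ (p ℚ.- q) q)))

  ∣∣-lipschitz : ∀ p q → ℚ.∣ ℚ.∣ p ∣ ℚ.- ℚ.∣ q ∣ ∣ ℚ.≤ ℚ.∣ p ℚ.- q ∣
  ∣∣-lipschitz p q with ℚ.∣p∣≡p∨∣p∣≡-p (ℚ.∣ p ∣ ℚ.- ℚ.∣ q ∣)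
  ... | inj₁ eq = subst (ℚ._≤ ℚ.∣ p ℚ.- q ∣) (sym eq) (∣∣-diff≤ p q)
  ... | inj₂ eq = subst₂ ℚ._≤_
    (trans (solve 2 (λ a b → b :- a := :- (a :- b)) refl ℚ.∣ p ∣ ℚ.∣ q ∣) (sym eq))
    (∣∣-sub-comm q p)
    (∣∣-diff≤ q p)

  ∣*∣-bound : ∀ {a b A B} → ℚ.∣ a ∣ ℚ.< A → ℚ.∣ b ∣ ℚ.< B → ℚ.∣ a ℚ.* b ∣ ℚ.≤ A ℚ.* B
  ∣*∣-bound {a} {b} {A} {B} a<A b<B = subst (ℚ._≤ A ℚ.* B) (sym (ℚ.∣p*q∣≡∣p∣*∣q∣ a b))
    (ℚ.≤-trans (ℚ.*-monoʳ-≤-nonNeg ℚ.∣ b ∣ {{ℚ.∣-∣-nonNeg b}} (ℚ.<⇒≤ a<A))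
               (ℚ.*-monoˡ-≤-nonNeg A {{ℚ.nonNegative (ℚ.≤-trans (ℚ.0≤∣p∣ a) (ℚ.<⇒≤ a<A))}}
                 (ℚ.<⇒≤ b<B)))

------------------------------------------------------------------------
-- The real numbers: Cauchy sequences of rationals (with explicit modulus),
-- compared through _≃_

IsCauchy : (ℕ → ℚ) → Set
IsCauchy s = ∀ ε → 0ℚ ℚ.< ε →
             ∃[ N ] (∀ m n → N ℕ.≤ m → N ℕ.≤ n → ℚ.∣ s m ℚ.- s n ∣ ℚ.< ε)

record ℝ : Set where
  constructor mkℝ
  field
    seq    : ℕ → ℚ
    cauchy : IsCauchy seq

open ℝ public

infix  4 _≃_ _<_ _≤_
infixl 6 _+_ _-_
infixl 7 _*_
infix  8 -_
infixr 9 _^_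

record _≃_ (x y : ℝ) : Set where
  constructor mk≃
  field
    close : ∀ ε → 0ℚ ℚ.< ε → ∃[ N ] (∀ n → N ℕ.≤ n → ℚ.∣ seq x n ℚ.- seq y n ∣ ℚ.< ε)

open _≃_ public

record _<_ (x y : ℝ) : Set where
  constructor mk<
  field
    gap          : ℚ
    gap-positive : 0ℚ ℚ.< gap
    from         : ℕ
    apart        : ∀ n → from ℕ.≤ n → seq x n ℚ.+ gap ℚ.< seq y n

_≤_ : ℝ → ℝ → Set
x ≤ y = ¬ (y < x)

abstract

  const-cauchy : ∀ q → IsCauchy (λ _ → q)
  const-cauchy q ε 0<ε = 0 , λ _ _ _ _ →
    subst (ℚ._< ε) (sym (cong ℚ.∣_∣ (ℚ.+-inverseʳ q))) 0<ε

  +-cauchy : ∀ x y → IsCauchy (λ n → seq x n ℚ.+ seq y n)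
  +-cauchy x y ε 0<ε =
    let (N₁ , h₁) = cauchy x (½ ℚ.* ε) (half-pos 0<ε)
        (N₂ , h₂) = cauchy y (½ ℚ.* ε) (half-pos 0<ε)
    in N₁ ℕ.⊔ N₂ , λ m n N≤m N≤n → ℚ.≤-<-trans
         (subst (λ e → ℚ.∣ e ∣ ℚ.≤ ℚ.∣ seq x m ℚ.- seq x n ∣ ℚ.+ ℚ.∣ seq y m ℚ.- seq y n ∣)
           (solve 4 (λ a b c d → (a :- b) :+ (c :- d) := (a :+ c) :- (b :+ d)) refl
             (seq x m) (seq x n) (seq y m) (seq y n))
           (ℚ.∣p+q∣≤∣p∣+∣q∣ (seq x m ℚ.- seq x n) (seq y m ℚ.- seq y n)))
         (subst (ℚ.∣ seq x m ℚ.- seq x n ∣ ℚ.+ ℚ.∣ seq y m ℚ.- seq y n ∣ ℚ.<_) (half+half ε)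
           (ℚ.+-mono-<
             (h₁ m n (⊔ˡ N₁ N₂ N≤m) (⊔ˡ N₁ N₂ N≤n))
             (h₂ m n (⊔ʳ N₁ N₂ N≤m) (⊔ʳ N₁ N₂ N≤n))))

  neg-cauchy : ∀ x → IsCauchy (λ n → ℚ.- seq x n)
  neg-cauchy x ε 0<ε =
    let (N , h) = cauchy x ε 0<ε
    in N , λ m n N≤m N≤n → subst (ℚ._< ε)
         (trans (sym (ℚ.∣-p∣≡∣p∣ (seq x m ℚ.- seq x n)))
           (cong ℚ.∣_∣ (solve 2 (λ a b → :- (a :- b) := :- a :- :- b) refl (seq x m) (seq x n))))
         (h m n N≤m N≤n)

  abs-cauchy : ∀ x → IsCauchy (λ n → ℚ.∣ seq x n ∣)
  abs-cauchy x ε 0<ε =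
    let (N , h) = cauchy x ε 0<ε
    in N , λ m n N≤m N≤n → ℚ.≤-<-trans (∣∣-lipschitz (seq x m) (seq x n)) (h m n N≤m N≤n)

  eventually-bounded : ∀ x → ∃[ B ] (0ℚ ℚ.< B × ∃[ N ] (∀ n → N ℕ.≤ n → ℚ.∣ seq x n ∣ ℚ.< B))
  eventually-bounded x =
    let (N , h) = cauchy x 1ℚ (ℚ.positive⁻¹ 1ℚ)
        B       = 1ℚ ℚ.+ ℚ.∣ seq x N ∣
    in B , ℚ.<-≤-trans (ℚ.positive⁻¹ 1ℚ) (ℚ.≤-trans (ℚ.≤-reflexive (sym (ℚ.+-identityʳ 1ℚ)))
             (ℚ.+-monoʳ-≤ 1ℚ (ℚ.0≤∣p∣ (seq x N)))) ,
       N , λ n N≤n → ℚ.≤-<-trans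
         (subst (λ e → ℚ.∣ e ∣ ℚ.≤ ℚ.∣ seq x n ℚ.- seq x N ∣ ℚ.+ ℚ.∣ seq x N ∣)
           (solve 2 (λ a b → (a :- b) :+ b := a) refl (seq x n) (seq x N))
           (ℚ.∣p+q∣≤∣p∣+∣q∣ (seq x n ℚ.- seq x N) (seq x N)))
         (ℚ.+-monoˡ-< ℚ.∣ seq x N ∣ (h n N N≤n ℕ.≤-refl))

  divide : ∀ B → 0ℚ ℚ.< B → ∀ η → 0ℚ ℚ.< η → ∃[ δ ] (0ℚ ℚ.< δ × B ℚ.* δ ≡ η)
  divide B 0<B η 0<η = 1/B ℚ.* η , *-pos 0<1/B 0<η ,
    trans (sym (ℚ.*-assoc B 1/B η))
      (trans (cong (ℚ._* η) (ℚ.*-inverseʳ B {{B≢0}})) (ℚ.*-identityˡ η))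
    where
    B≢0 : ℚ.NonZero B
    B≢0 = ℚ.pos⇒nonZero B {{ℚ.positive 0<B}}
    1/B : ℚ
    1/B = (ℚ.1/ B) {{B≢0}}
    0<1/B : 0ℚ ℚ.< 1/B
    0<1/B = ℚ.positive⁻¹ 1/B {{ℚ.1/pos⇒pos B {{ℚ.positive 0<B}}}}

  *-estimate : ∀ {ε A B δ₁ δ₂} xm xn ym yn → 0ℚ ℚ.< ε →
               A ℚ.* δ₁ ≡ ½ ℚ.* (½ ℚ.* ε) → B ℚ.* δ₂ ≡ ½ ℚ.* (½ ℚ.* ε) →
               ℚ.∣ xm ∣ ℚ.< A → ℚ.∣ ym ℚ.- yn ∣ ℚ.< δ₁ → ℚ.∣ yn ∣ ℚ.< B → ℚ.∣ xm ℚ.- xn ∣ ℚ.< δ₂ →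
               ℚ.∣ xm ℚ.* ym ℚ.- xn ℚ.* yn ∣ ℚ.< ε
  *-estimate {ε} xm xn ym yn 0<ε e₁ e₂ a h₁ b h₂ = ℚ.≤-<-trans
    (subst₂ ℚ._≤_
      (cong ℚ.∣_∣ (solve 4 (λ p q r s → p :* (r :- s) :+ s :* (p :- q) := p :* r :- q :* s)
        refl xm xn ym yn))
      (trans (cong₂ ℚ._+_ e₁ e₂) (half+half (½ ℚ.* ε)))
      (ℚ.≤-trans (ℚ.∣p+q∣≤∣p∣+∣q∣ (xm ℚ.* (ym ℚ.- yn)) (yn ℚ.* (xm ℚ.- xn)))
                 (ℚ.+-mono-≤ (∣*∣-bound {xm} {ym ℚ.- yn} a h₁) (∣*∣-bound {yn} {xm ℚ.- xn} b h₂))))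
    (subst₂ ℚ._<_ (ℚ.+-identityʳ (½ ℚ.* ε)) (half+half ε) (ℚ.+-monoʳ-< (½ ℚ.* ε) (half-pos 0<ε)))

  *-cauchy : ∀ x y → IsCauchy (λ n → seq x n ℚ.* seq y n)
  *-cauchy x y ε 0<ε =
    let (A , 0<A , N₁ , a) = eventually-bounded x
        (B , 0<B , N₂ , b) = eventually-bounded y
        (δ₁ , 0<δ₁ , e₁)   = divide A 0<A (½ ℚ.* (½ ℚ.* ε)) (half-pos (half-pos 0<ε))
        (δ₂ , 0<δ₂ , e₂)   = divide B 0<B (½ ℚ.* (½ ℚ.* ε)) (half-pos (half-pos 0<ε))
        (N₃ , h₃)          = cauchy y δ₁ 0<δ₁
        (N₄ , h₄)          = cauchy x δ₂ 0<δ₂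
        N₁₂ = N₁ ℕ.⊔ N₂
        N₃₄ = N₃ ℕ.⊔ N₄
    in N₁₂ ℕ.⊔ N₃₄ , λ m n N≤m N≤n →
       *-estimate {ε} {A} {B} {δ₁} {δ₂} (seq x m) (seq x n) (seq y m) (seq y n) 0<ε e₁ e₂
         (a m (⊔ˡ N₁ N₂ (⊔ˡ N₁₂ N₃₄ N≤m)))
         (h₃ m n (⊔ˡ N₃ N₄ (⊔ʳ N₁₂ N₃₄ N≤m)) (⊔ˡ N₃ N₄ (⊔ʳ N₁₂ N₃₄ N≤n)))
         (b n (⊔ʳ N₁ N₂ (⊔ˡ N₁₂ N₃₄ N≤n)))
         (h₄ m n (⊔ʳ N₃ N₄ (⊔ʳ N₁₂ N₃₄ N≤m)) (⊔ʳ N₃ N₄ (⊔ʳ N₁₂ N₃₄ N≤n)))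

fromℚ : ℚ → ℝ
fromℚ q = mkℝ (λ _ → q) (const-cauchy q)

fromℤ : ℤ → ℝ
fromℤ k = fromℚ (k ℚ./ 1)

fromℕ : ℕ → ℝ
fromℕ n = fromℤ (ℤ.+ n)

0ℝ 1ℝ : ℝ
0ℝ = fromℚ 0ℚ
1ℝ = fromℚ 1ℚ

recipℚ : ℚ → ℚ
recipℚ p with p ℚ.≟ 0ℚ
... | yes _  = 0ℚ
... | no p≢0 = (ℚ.1/ p) {{ℚ.≢-nonZero p≢0}}

abstract

  recipℚ-inverse : ∀ p → 0ℚ ℚ.< p → p ℚ.* recipℚ p ≡ 1ℚ
  recipℚ-inverse p 0<p with p ℚ.≟ 0ℚ
  ... | yes p≡0 = contradiction 0<p (ℚ.<-irrefl (sym p≡0))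
  ... | no p≢0  = ℚ.*-inverseʳ p {{ℚ.≢-nonZero p≢0}}

  recipℚ-lipschitz : ∀ {a b c ε} → 0ℚ ℚ.< c → c ℚ.< a → c ℚ.< b →
                     ℚ.∣ b ℚ.- a ∣ ℚ.< c ℚ.* c ℚ.* ε → ℚ.∣ recipℚ a ℚ.- recipℚ b ∣ ℚ.< ε
  recipℚ-lipschitz {a} {b} {c} {ε} 0<c c<a c<b h =
    ℚ.*-cancelˡ-<-nonNeg (c ℚ.* c) {{ℚ.nonNegative (ℚ.<⇒≤ (*-pos 0<c 0<c))}}
      (ℚ.≤-<-trans c²d≤ h)
    where
    0<a : 0ℚ ℚ.< a
    0<a = ℚ.<-trans 0<c c<a
    0<b : 0ℚ ℚ.< b
    0<b = ℚ.<-trans 0<c c<b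
    d : ℚ
    d = recipℚ a ℚ.- recipℚ b
    c²≤ab : c ℚ.* c ℚ.≤ a ℚ.* b
    c²≤ab = ℚ.≤-trans (ℚ.*-monoʳ-≤-nonNeg c {{ℚ.nonNegative (ℚ.<⇒≤ 0<c)}} (ℚ.<⇒≤ c<a))
                      (ℚ.*-monoˡ-≤-nonNeg a {{ℚ.nonNegative (ℚ.<⇒≤ 0<a)}} (ℚ.<⇒≤ c<b))
    abd : a ℚ.* b ℚ.* d ≡ b ℚ.- a
    abd = trans
      (solve 4 (λ a b r s → a :* b :* (r :- s) := b :* (a :* r) :- a :* (b :* s)) refl
        a b (recipℚ a) (recipℚ b))
      (cong₂ ℚ._-_ (trans (cong (b ℚ.*_) (recipℚ-inverse a 0<a)) (ℚ.*-identityʳ b))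
                   (trans (cong (a ℚ.*_) (recipℚ-inverse b 0<b)) (ℚ.*-identityʳ a)))
    c²d≤ : c ℚ.* c ℚ.* ℚ.∣ d ∣ ℚ.≤ ℚ.∣ b ℚ.- a ∣
    c²d≤ = ℚ.≤-trans (ℚ.*-monoʳ-≤-nonNeg ℚ.∣ d ∣ {{ℚ.∣-∣-nonNeg d}} c²≤ab)
      (ℚ.≤-reflexive (trans
        (cong (ℚ._* ℚ.∣ d ∣) (sym (ℚ.0≤p⇒∣p∣≡p (ℚ.<⇒≤ (*-pos 0<a 0<b)))))
        (trans (sym (ℚ.∣p*q∣≡∣p∣*∣q∣ (a ℚ.* b) d)) (cong ℚ.∣_∣ abd))))

  recip-cauchy : ∀ x → 0ℝ < x → IsCauchy (λ n → recipℚ (seq x n))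
  recip-cauchy x (mk< c 0<c N₁ h₁) ε 0<ε =
    let (N₂ , h₂) = cauchy x (c ℚ.* c ℚ.* ε) (*-pos (*-pos 0<c 0<c) 0<ε)
        c<  = λ n N₁≤n → subst (ℚ._< seq x n) (ℚ.+-identityˡ c) (h₁ n N₁≤n)
    in N₁ ℕ.⊔ N₂ , λ m n N≤m N≤n → recipℚ-lipschitz 0<c
         (c< m (⊔ˡ N₁ N₂ N≤m)) (c< n (⊔ˡ N₁ N₂ N≤n))
         (h₂ n m (⊔ʳ N₁ N₂ N≤n) (⊔ʳ N₁ N₂ N≤m))

-- The operations are opaque only to keep rational arithmetic from being
-- normalised during type checking.
opaque

  _+_ : ℝ → ℝ → ℝ
  x + y = mkℝ (λ n → seq x n ℚ.+ seq y n) (+-cauchy x y)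

  _*_ : ℝ → ℝ → ℝ
  x * y = mkℝ (λ n → seq x n ℚ.* seq y n) (*-cauchy x y)

  -_ : ℝ → ℝ
  - x = mkℝ (λ n → ℚ.- seq x n) (neg-cauchy x)

  ∣_∣ : ℝ → ℝ
  ∣ x ∣ = mkℝ (λ n → ℚ.∣ seq x n ∣) (abs-cauchy x)

  -- Termwise reciprocal; the finitely many vanishing terms are sent to 0.
  recip : (x : ℝ) → 0ℝ < x → ℝ
  recip x 0<x = mkℝ (λ n → recipℚ (seq x n)) (recip-cauchy x 0<x)

_-_ : ℝ → ℝ → ℝ
x - y = x + - y

_^_ : ℝ → ℕ → ℝ
x ^ zero  = 1ℝ
x ^ suc n = x * x ^ n

sum : List ℝ → ℝ
sum = foldr _+_ 0ℝ

abstract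

  ≃-refl : ∀ {x} → x ≃ x
  ≃-refl {x} = mk≃ λ ε 0<ε →
    0 , λ n _ → subst (ℚ._< ε) (sym (cong ℚ.∣_∣ (ℚ.+-inverseʳ (seq x n)))) 0<ε

  ≃-sym : ∀ {x y} → x ≃ y → y ≃ x
  ≃-sym {x} {y} x≃y = mk≃ λ ε 0<ε → let (N , h) = close x≃y ε 0<ε in
    N , λ n N≤n → subst (ℚ._< ε) (∣∣-sub-comm (seq x n) (seq y n)) (h n N≤n)

  ≃-trans : ∀ {x y z} → x ≃ y → y ≃ z → x ≃ z
  ≃-trans {x} {y} {z} x≃y y≃z = mk≃ λ ε 0<ε →
    let (N₁ , h₁) = close x≃y (½ ℚ.* ε) (half-pos 0<ε)
        (N₂ , h₂) = close y≃z (½ ℚ.* ε) (half-pos 0<ε)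
    in N₁ ℕ.⊔ N₂ , λ n N≤n → ℚ.≤-<-trans (∣∣-triangle (seq x n) (seq y n) (seq z n))
         (subst (ℚ.∣ seq x n ℚ.- seq y n ∣ ℚ.+ ℚ.∣ seq y n ℚ.- seq z n ∣ ℚ.<_) (half+half ε)
           (ℚ.+-mono-< (h₁ n (⊔ˡ N₁ N₂ N≤n)) (h₂ n (⊔ʳ N₁ N₂ N≤n))))

ℝ-setoid : Setoid 0ℓ 0ℓ
ℝ-setoid = record
  { Carrier       = ℝ
  ; _≈_           = _≃_
  ; isEquivalence = record { refl = ≃-refl ; sym = ≃-sym ; trans = ≃-trans }
  }

------------------------------------------------------------------------
-- The Euclidean plane

ℝ² : Set
ℝ² = ℝ × ℝ

ℝ²-setoid : Setoid 0ℓ 0ℓ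
ℝ²-setoid = ×-setoid ℝ-setoid ℝ-setoid

open Setoid ℝ²-setoid public using () renaming (_≈_ to _≈²_)

⟨_,_⟩ : ℝ² → ℝ² → ℝ
⟨ (x₁ , x₂) , (y₁ , y₂) ⟩ = x₁ * y₁ + x₂ * y₂

_-²_ : ℝ² → ℝ² → ℝ²
(x₁ , x₂) -² (y₁ , y₂) = (x₁ - y₁) , (x₂ - y₂)

_·_ : ℝ → ℝ² → ℝ²
c · (x₁ , x₂) = (c * x₁) , (c * x₂)

det : ℝ² → ℝ² → ℝ
det (x₁ , x₂) (y₁ , y₂) = x₁ * y₂ - x₂ * y₁

UnitCircle : Pred ℝ² 0ℓ
UnitCircle p = ⟨ p , p ⟩ ≃ 1ℝ

------------------------------------------------------------------------
-- Polynomials in two variables, as lists of terms c xᵃ yᵇ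

Term : Set
Term = ℝ × ℕ × ℕ

Polynomial : Set
Polynomial = List Term

DegreeAtMost : ℕ → Polynomial → Set
DegreeAtMost t = All λ (_ , a , b) → a ℕ.+ b ℕ.≤ t

evalTerm : Term → ℝ² → ℝ
evalTerm (c , a , b) (x , y) = c * (x ^ a * y ^ b)

eval : Polynomial → ℝ² → ℝ
eval f p = sum (map (λ term → evalTerm term p) f)

------------------------------------------------------------------------
-- Integration over the unit circle with respect to arc length

-- A partition of the circle into arcs: the vertices, listed counterclockwise,
-- of an inscribed polygon.  `counterclockwise` says that they go round exactly
-- once, `minor-arcs` that each arc is shorter than a half circle.  Lengths of
-- sides are recorded as nonnegative square roots of squared distances.
record Polygon : Set where
  field
    size             : ℕ
    size-positive    : 0 ℕ.< size
    vertex           : ℕ → ℝ²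
    closed           : vertex size ≈² vertex 0
    on-circle        : ∀ i → i ℕ.< size → UnitCircle (vertex i)
    counterclockwise : ∀ i j k → i ℕ.< j → j ℕ.< k → k ℕ.< size →
                       0ℝ < det (vertex j -² vertex i) (vertex k -² vertex i)
    minor-arcs       : ∀ i → i ℕ.< size → 0ℝ < det (vertex i) (vertex (suc i))
    side             : ℕ → ℝ
    side-nonneg      : ∀ i → i ℕ.< size → 0ℝ ≤ side i
    side-length      : ∀ i → i ℕ.< size →
                       let e = vertex (suc i) -² vertex i in side i * side i ≃ ⟨ e , e ⟩

riemannSum : (ℝ² → ℝ) → Polygon → ℝ
riemannSum f P = sum (map (λ i → f (vertex i) * side i) (upTo size))
  where open Polygon P

-- ∫ f dσ = I over the unit circle: the Riemann sums tend to I as the mesh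
-- tends to 0.
HasCircleIntegral : (ℝ² → ℝ) → ℝ → Set
HasCircleIntegral f I =
  ∀ ε → 0ℝ < ε → Σ[ δ ∈ ℝ ] 0ℝ < δ ×
    ((P : Polygon) → (∀ i → i ℕ.< Polygon.size P → Polygon.side P i < δ) →
     ∣ riemannSum f P - I ∣ < ε)

------------------------------------------------------------------------
-- Spherical designs in the plane

mean : List⁺ ℝ → ℝ
mean (x ∷ xs) = fromℚ (ℤ.1ℤ ℚ./ suc (List.length xs)) * sum (x List.∷ xs)

open Membership ℝ²-setoid using (_∈_)
open Unique ℝ²-setoid using (Unique)

record IsSphericalDesign (t : ℕ) (X : Pred ℝ² 0ℓ) : Set where
  field
    on-circle              : ∀ p → X p → UnitCircle p
    points                 : List⁺ ℝ²
    distinct               : Unique (toList points)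
    enumerates             : ∀ p → X p ⇔ p ∈ toList points
    circumference          : ℝ
    circumference-integral : HasCircleIntegral (λ _ → 1ℝ) circumference
    circumference-positive : 0ℝ < circumference
    averages               : ∀ f → DegreeAtMost t f → Σ[ I ∈ ℝ ]
      HasCircleIntegral (eval f) I ×
      mean (List⁺.map (eval f) points) ≃ recip circumference circumference-positive * I

_·ˢ_ : ℝ → Pred ℝ² 0ℓ → Pred ℝ² 0ℓ
(c ·ˢ X) p = Σ[ q ∈ ℝ² ] X q × p ≈² (c · q)

IsSphericalDesignOfRadius : (r : ℝ) → 0ℝ < r → ℕ → Pred ℝ² 0ℓ → Set
IsSphericalDesignOfRadius r 0<r t X = IsSphericalDesign t (recip r 0<r ·ˢ X)

------------------------------------------------------------------------
-- The square lattice

ℤ² : Pred ℝ² 0ℓ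
ℤ² p = Σ[ a ∈ ℤ ] Σ[ b ∈ ℤ ] p ≈² (fromℤ a , fromℤ b)

shell : Pred ℝ² 0ℓ → ℕ → Pred ℝ² 0ℓ
shell Λ m p = Λ p × ⟨ p , p ⟩ ≃ fromℕ m

{-# OPTIONS --safe #-}

-- The polynomial Re (x + i y)⁴ integrates to 0 over the circle: by Re (u v)⁴ + Re (ū v)⁴ = 2 Re u⁴ Re v⁴, rotating
-- by the rational points u and ū of the circle shows that the integral equals Re u⁴ times itself, and
-- Re u⁴ ≠ 1 for u = (3 + 4 i) / 5. Hence a shell that is a 4-design satisfies S(m) = Σ z⁴ = 0, the sum being over
-- the Gaussian integers z of norm m (it is real because the shell is closed under conjugation).
-- On the other hand S(m) ≠ 0 for every nonempty shell, by induction on m. Take a Gaussian prime π dividing some z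
-- of norm m > 1 and let P be its norm. If π divides its conjugate π̄, then every z of norm m is a multiple of π and
-- S(m) = π⁴ S(m / P). Otherwise write m = Pᵏ n with P ∤ n. A z of norm Pᵏ n is either a multiple of π or π̄ᵏ times
-- an element of norm n, so S(Pᵏ n) = cₖ S(n) with cₖ = π̄⁴ᵏ + π⁴ cₖ₋₁ ≢ 0 mod π.
module Submission where

open import Defs
open import Algebra.Bundles using (CommutativeRing)
import Algebra.Solver.Ring.AlmostCommutativeRing as ACR
import Algebra.Solver.Ring.Simple as RingSolver
open import Data.Empty using (⊥)
open import Data.Integer.Base as ℤ using (+_; -[1+_]; ℤ)
open import Data.Integer.DivMod using (_%ℕ_; _/ℕ_; a≡a%ℕn+[a/ℕn]*n; n%ℕd<d)
import Data.Integer.Properties as ℤ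
import Data.Integer.Solver as ℤSolver
open import Data.List.Base as List using (List; []; _++_; _∷_; cartesianProductWith; filter; upTo)
open import Data.List.Membership.Propositional using (_∈_)
open import Data.List.Membership.Propositional.Properties using (∈-++⁺ʳ; ∈-++⁺ˡ; ∈-++⁻; ∈-cartesianProductWith⁺; ∈-filter⁺; ∈-filter⁻; ∈-map⁺; ∈-map⁻; ∈-upTo⁺)
open import Data.List.Membership.Propositional.Properties.WithK using (unique∧set⇒bag)
import Data.List.Membership.Setoid as Membership
open import Data.List.NonEmpty.Base as List⁺ using (toList) renaming (_∷_ to _∷⁺_)
open import Data.List.Relation.Binary.BagAndSetEquality using (∼bag⇒↭)
open import Data.List.Relation.Binary.Disjoint.Propositional using (Disjoint)
open import Data.List.Relation.Binary.Permutation.Propositional as Perm using (_↭_)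
open import Data.List.Relation.Binary.Pointwise using (Pointwise; []; _∷_)
open import Data.List.Relation.Unary.All using (All; []; _∷_)
open import Data.List.Relation.Unary.AllPairs using ([]; _∷_)
open import Data.List.Relation.Unary.Any using (here; there)
open import Data.List.Relation.Unary.Unique.Propositional using (Unique)
import Data.List.Relation.Unary.Unique.Propositional.Properties as Unique
import Data.List.Relation.Unary.Unique.Setoid as UniqueSetoid
open import Data.Nat.Base as ℕ using (suc; zero; ℕ)
import Data.Nat.Divisibility as ℕ
open import Data.Nat.Induction using (<-rec)
import Data.Nat.Properties as ℕ
import Data.Nat.Solver as ℕSolver
open import Data.Product.Base using (_,_; _×_; proj₁; proj₂; Σ-syntax; ∃; ∃-syntax)
open import Data.Rational.Base as ℚ using (0ℚ; 1ℚ; mkℚ; toℚᵘ; ½; ℚ)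
import Data.Rational.Properties as ℚ
import Data.Rational.Solver as ℚSolver
import Data.Rational.Unnormalised.Base as ℚᵘ
import Data.Rational.Unnormalised.Properties as ℚᵘ
open import Data.Sum.Base as Sum using (_⊎_; inj₁; inj₂)
open import Function.Bundles using (Equivalence; mk⇔)
open import Relation.Binary.Bundles using (Setoid)
open import Relation.Binary.Definitions using (DecidableEquality)
open import Relation.Binary.PropositionalEquality using (_≡_; _≢_; cong; cong₂; isEquivalence; module ≡-Reasoning; refl; subst; subst₂; sym; trans)
open import Relation.Nullary using (Dec; contradiction; no; yes; ¬_)
open import Relation.Nullary.Decidable using (toWitness)

open Membership ℝ²-setoid using () renaming (_∈_ to _∈²_)
open UniqueSetoid ℝ²-setoid using () renaming (Unique to Unique²)

-- No trigonometry is at hand: an integral over the circle is constrained only through Riemann sums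
-- over inscribed polygons, so evaluating one requires polygons of arbitrarily small mesh with their
-- exact side lengths. They are built over ℚ, where every condition becomes an inequality of
-- rationals and every real number involved a constant sequence. Chords become rational because each
-- vertex is, up to the rotation, the square of a rational point of the circle, so that a side is
-- twice the sine of a rational half-angle. Rotations preserve the sides, so the identity for Re (u
-- v)⁴ holds exactly between the Riemann sums, and the only errors come from comparing these sums
-- with the integral. The radius may be irrational. Since Re z⁴ is homogeneous, rescaling
-- contributes only a fourth power of `recip r 0<r`, and what remains is exact arithmetic in ℤ[i].
-- There, one prime at a time is split off the norm; no factorization into primes is ever formed,
-- and the induction ends at norm 1, where every fourth power is 1.

-- Arithmetic of the Gaussian integers

module Gaussian where

  -- Without η, sums and products of variables do not unfold, which keeps the ring solver fast.
  record ℤ[i] : Set where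
    no-eta-equality
    pattern
    constructor gauss
    field
      re im : ℤ

  open ℤ[i] public

  infixl 6 _⊕_
  infixl 7 _⊗_
  infix  8 ⊖_

  _⊕_ _⊗_ : ℤ[i] → ℤ[i] → ℤ[i]
  gauss a b ⊕ gauss c d = gauss (a ℤ.+ c) (b ℤ.+ d)
  gauss a b ⊗ gauss c d = gauss (a ℤ.* c ℤ.- b ℤ.* d) (a ℤ.* d ℤ.+ b ℤ.* c)

  ⊖_ conj : ℤ[i] → ℤ[i]
  ⊖ gauss a b = gauss (ℤ.- a) (ℤ.- b)
  conj (gauss a b) = gauss a (ℤ.- b)

  𝟎 𝟏 : ℤ[i]
  𝟎 = gauss ℤ.0ℤ ℤ.0ℤ
  𝟏 = gauss ℤ.1ℤ ℤ.0ℤ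

  _≟ᵍ_ : DecidableEquality ℤ[i]
  gauss a b ≟ᵍ gauss c d with a ℤ.≟ c | b ℤ.≟ d
  ... | yes refl | yes refl = yes refl
  ... | no a≢c   | _        = no λ { refl → a≢c refl }
  ... | yes _    | no b≢d   = no λ { refl → b≢d refl }

  module _ where
    open ℤSolver.+-*-Solver using (solve; _:=_; _:+_; _:*_; _:-_; :-_; con)

    ⊗-assoc : ∀ x y z → (x ⊗ y) ⊗ z ≡ x ⊗ (y ⊗ z)
    ⊗-assoc (gauss a b) (gauss c d) (gauss e f) = cong₂ gauss
      (solve 6 (λ a b c d e f → (a :* c :- b :* d) :* e :- (a :* d :+ b :* c) :* f
                             := a :* (c :* e :- d :* f) :- b :* (c :* f :+ d :* e)) refl a b c d e f)
      (solve 6 (λ a b c d e f → (a :* c :- b :* d) :* f :+ (a :* d :+ b :* c) :* e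
                             := a :* (c :* f :+ d :* e) :+ b :* (c :* e :- d :* f)) refl a b c d e f)

    ⊗-comm : ∀ x y → x ⊗ y ≡ y ⊗ x
    ⊗-comm (gauss a b) (gauss c d) = cong₂ gauss
      (solve 4 (λ a b c d → a :* c :- b :* d := c :* a :- d :* b) refl a b c d)
      (solve 4 (λ a b c d → a :* d :+ b :* c := c :* b :+ d :* a) refl a b c d)

    ⊗-identityˡ : ∀ x → 𝟏 ⊗ x ≡ x
    ⊗-identityˡ (gauss a b) = cong₂ gauss
      (solve 2 (λ a b → con ℤ.1ℤ :* a :- con ℤ.0ℤ :* b := a) refl a b)
      (solve 2 (λ a b → con ℤ.1ℤ :* b :+ con ℤ.0ℤ :* a := b) refl a b)

    ⊗-distribˡ-⊕ : ∀ x y z → x ⊗ (y ⊕ z) ≡ x ⊗ y ⊕ x ⊗ z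
    ⊗-distribˡ-⊕ (gauss a b) (gauss c d) (gauss e f) = cong₂ gauss
      (solve 6 (λ a b c d e f → a :* (c :+ e) :- b :* (d :+ f)
                             := (a :* c :- b :* d) :+ (a :* e :- b :* f)) refl a b c d e f)
      (solve 6 (λ a b c d e f → a :* (d :+ f) :+ b :* (c :+ e)
                             := (a :* d :+ b :* c) :+ (a :* f :+ b :* e)) refl a b c d e f)

    conj-⊗ : ∀ x y → conj (x ⊗ y) ≡ conj x ⊗ conj y
    conj-⊗ (gauss a b) (gauss c d) = cong₂ gauss
      (solve 4 (λ a b c d → a :* c :- b :* d := a :* c :- (:- b) :* (:- d)) refl a b c d)
      (solve 4 (λ a b c d → :- (a :* d :+ b :* c) := a :* (:- d) :+ (:- b) :* c) refl a b c d)

  conj-⊕ : ∀ x y → conj (x ⊕ y) ≡ conj x ⊕ conj y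
  conj-⊕ (gauss a b) (gauss c d) = cong (gauss _) (ℤ.neg-distrib-+ b d)

  conj-involutive : ∀ x → conj (conj x) ≡ x
  conj-involutive (gauss a b) = cong (gauss a) (ℤ.neg-involutive b)

  ⊗-identityʳ : ∀ x → x ⊗ 𝟏 ≡ x
  ⊗-identityʳ x = trans (⊗-comm x 𝟏) (⊗-identityˡ x)

  ⊗-distribʳ-⊕ : ∀ x y z → (y ⊕ z) ⊗ x ≡ y ⊗ x ⊕ z ⊗ x
  ⊗-distribʳ-⊕ x y z = trans (⊗-comm (y ⊕ z) x)
    (trans (⊗-distribˡ-⊕ x y z) (cong₂ _⊕_ (⊗-comm x y) (⊗-comm x z)))

  ℤ[i]-commutativeRing : CommutativeRing _ _
  ℤ[i]-commutativeRing = record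
    { Carrier = ℤ[i] ; _≈_ = _≡_ ; _+_ = _⊕_ ; _*_ = _⊗_ ; -_ = ⊖_ ; 0# = 𝟎 ; 1# = 𝟏
    ; isCommutativeRing = record
      { isRing = record
        { +-isAbelianGroup = record
          { isGroup = record
            { isMonoid = record
              { isSemigroup = record
                { isMagma = record { isEquivalence = isEquivalence ; ∙-cong = cong₂ _⊕_ }
                ; assoc = λ { (gauss a b) (gauss c d) (gauss e f) → cong₂ gauss (ℤ.+-assoc a c e) (ℤ.+-assoc b d f) }
                }
              ; identity = (λ { (gauss a b) → cong₂ gauss (ℤ.+-identityˡ a) (ℤ.+-identityˡ b) })
                         , (λ { (gauss a b) → cong₂ gauss (ℤ.+-identityʳ a) (ℤ.+-identityʳ b) })
              }
            ; inverse = (λ { (gauss a b) → cong₂ gauss (ℤ.+-inverseˡ a) (ℤ.+-inverseˡ b) })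
                      , (λ { (gauss a b) → cong₂ gauss (ℤ.+-inverseʳ a) (ℤ.+-inverseʳ b) })
            ; ⁻¹-cong = cong ⊖_
            }
          ; comm = λ { (gauss a b) (gauss c d) → cong₂ gauss (ℤ.+-comm a c) (ℤ.+-comm b d) }
          }
        ; *-cong = cong₂ _⊗_
        ; *-assoc = ⊗-assoc
        ; *-identity = ⊗-identityˡ , ⊗-identityʳ
        ; distrib = ⊗-distribˡ-⊕ , ⊗-distribʳ-⊕
        }
      ; *-comm = ⊗-comm
      }
    }

  open CommutativeRing ℤ[i]-commutativeRing using (zeroˡ; zeroʳ)
  module ℤ[i]-Solver = RingSolver (ACR.fromCommutativeRing ℤ[i]-commutativeRing) _≟ᵍ_

  ι : ℕ → ℤ[i]
  ι n = gauss (+ n) ℤ.0ℤ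

  ι-injective : ∀ {m n} → ι m ≡ ι n → m ≡ n
  ι-injective eq = ℤ.+-injective (cong re eq)

  ι-* : ∀ m n → ι (m ℕ.* n) ≡ ι m ⊗ ι n
  ι-* m n = cong₂ gauss
    (trans (ℤ.pos-* m n) (solve 2 (λ a b → a :* b := a :* b :- con ℤ.0ℤ :* con ℤ.0ℤ) refl (+ m) (+ n)))
    (solve 2 (λ a b → con ℤ.0ℤ := a :* con ℤ.0ℤ :+ con ℤ.0ℤ :* b) refl (+ m) (+ n))
    where
    open ℤSolver.+-*-Solver using (solve; _:=_; _:+_; _:*_; _:-_; :-_; con)

  norm : ℤ[i] → ℕ
  norm (gauss a b) = ℤ.∣ a ∣ ℕ.* ℤ.∣ a ∣ ℕ.+ ℤ.∣ b ∣ ℕ.* ℤ.∣ b ∣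

  +∣i∣*∣i∣≡i*i : ∀ i → + (ℤ.∣ i ∣ ℕ.* ℤ.∣ i ∣) ≡ i ℤ.* i
  +∣i∣*∣i∣≡i*i (+ n)    = ℤ.pos-* n n
  +∣i∣*∣i∣≡i*i -[1+ n ] = refl

  +norm : ∀ a b → + norm (gauss a b) ≡ a ℤ.* a ℤ.+ b ℤ.* b
  +norm a b = trans (ℤ.pos-+ (ℤ.∣ a ∣ ℕ.* ℤ.∣ a ∣) (ℤ.∣ b ∣ ℕ.* ℤ.∣ b ∣))
    (cong₂ ℤ._+_ (+∣i∣*∣i∣≡i*i a) (+∣i∣*∣i∣≡i*i b))

  ⊗-conj : ∀ z → z ⊗ conj z ≡ ι (norm z)
  ⊗-conj (gauss a b) = cong₂ gauss
    (trans (solve 2 (λ a b → a :* a :- b :* (:- b) := a :* a :+ b :* b) refl a b) (sym (+norm a b)))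
    (solve 2 (λ a b → a :* (:- b) :+ b :* a := con ℤ.0ℤ) refl a b)
    where
    open ℤSolver.+-*-Solver using (solve; _:=_; _:+_; _:*_; _:-_; :-_; con)

  -- Since `ι (norm z)` is `z ⊗ conj z` and `conj` is multiplicative, this is a rearrangement of
  -- four factors in ℤ[i], with no absolute values involved.
  norm-⊗ : ∀ x y → norm (x ⊗ y) ≡ norm x ℕ.* norm y
  norm-⊗ x y = ι-injective (begin
    ι (norm (x ⊗ y))            ≡⟨ ⊗-conj (x ⊗ y) ⟨
    x ⊗ y ⊗ conj (x ⊗ y)        ≡⟨ cong (x ⊗ y ⊗_) (conj-⊗ x y) ⟩
    x ⊗ y ⊗ (conj x ⊗ conj y)   ≡⟨ solve 4 (λ a b c d → a :* b :* (c :* d) := a :* c :* (b :* d)) refl x y (conj x) (conj y) ⟩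
    x ⊗ conj x ⊗ (y ⊗ conj y)   ≡⟨ cong₂ _⊗_ (⊗-conj x) (⊗-conj y) ⟩
    ι (norm x) ⊗ ι (norm y)     ≡⟨ ι-* (norm x) (norm y) ⟨
    ι (norm x ℕ.* norm y)       ∎)
    where
    open ≡-Reasoning
    open ℤ[i]-Solver using (solve; _:=_; _:+_; _:*_; _:-_; :-_; con)

  norm-conj : ∀ z → norm (conj z) ≡ norm z
  norm-conj (gauss a b) = cong (λ n → ℤ.∣ a ∣ ℕ.* ℤ.∣ a ∣ ℕ.+ n ℕ.* n) (ℤ.∣-i∣≡∣i∣ b)

  norm≡0⇒≡𝟎 : ∀ z → norm z ≡ 0 → z ≡ 𝟎
  norm≡0⇒≡𝟎 (gauss a b) eq = cong₂ gauss
    (∣i∣²≡0 a (ℕ.m+n≡0⇒m≡0 _ eq)) (∣i∣²≡0 b (ℕ.m+n≡0⇒n≡0 (ℤ.∣ a ∣ ℕ.* ℤ.∣ a ∣) eq))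
    where
    ∣i∣²≡0 : ∀ i → ℤ.∣ i ∣ ℕ.* ℤ.∣ i ∣ ≡ 0 → i ≡ ℤ.0ℤ
    ∣i∣²≡0 i e with ℕ.m*n≡0⇒m≡0∨n≡0 ℤ.∣ i ∣ e
    ... | inj₁ p = ℤ.∣i∣≡0⇒i≡0 p
    ... | inj₂ p = ℤ.∣i∣≡0⇒i≡0 p

  ⊗≡𝟎⇒ : ∀ x y → x ⊗ y ≡ 𝟎 → x ≡ 𝟎 ⊎ y ≡ 𝟎
  ⊗≡𝟎⇒ x y eq = Sum.map (norm≡0⇒≡𝟎 x) (norm≡0⇒≡𝟎 y) (ℕ.m*n≡0⇒m≡0∨n≡0 (norm x) norm≡0)
    where
    norm≡0 : norm x ℕ.* norm y ≡ 0
    norm≡0 = trans (sym (norm-⊗ x y)) (subst (λ z → norm z ≡ 0) (sym eq) refl)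

  ⊗-≢𝟎 : ∀ {x y} → x ≢ 𝟎 → y ≢ 𝟎 → x ⊗ y ≢ 𝟎
  ⊗-≢𝟎 {x} {y} x≢0 y≢0 eq = Sum.[ x≢0 , y≢0 ] (⊗≡𝟎⇒ x y eq)

  ⊗-cancelˡ : ∀ {x} y z → x ≢ 𝟎 → x ⊗ y ≡ x ⊗ z → y ≡ z
  ⊗-cancelˡ {x} y z x≢0 eq = Sum.[ (λ p → contradiction p x≢0) , from-difference ] (⊗≡𝟎⇒ x (y ⊕ ⊖ z) product)
    where
    open ≡-Reasoning
    open ℤ[i]-Solver using (solve; _:=_; _:+_; _:*_; _:-_; :-_; con)
    product : x ⊗ (y ⊕ ⊖ z) ≡ 𝟎
    product = begin
      x ⊗ (y ⊕ ⊖ z)      ≡⟨ solve 3 (λ a b c → a :* (b :+ :- c) := a :* b :+ :- (a :* c)) refl x y z ⟩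
      x ⊗ y ⊕ ⊖ (x ⊗ z)  ≡⟨ cong (λ e → e ⊕ ⊖ (x ⊗ z)) eq ⟩
      x ⊗ z ⊕ ⊖ (x ⊗ z)  ≡⟨ solve 1 (λ a → a :+ :- a := con 𝟎) refl (x ⊗ z) ⟩
      𝟎                  ∎
    from-difference : y ⊕ ⊖ z ≡ 𝟎 → y ≡ z
    from-difference p = begin
      y              ≡⟨ solve 2 (λ a b → a := (a :+ :- b) :+ b) refl y z ⟩
      (y ⊕ ⊖ z) ⊕ z  ≡⟨ cong (_⊕ z) p ⟩
      𝟎 ⊕ z          ≡⟨ solve 1 (λ a → con 𝟎 :+ a := a) refl z ⟩
      z              ∎

  conj-unit : ∀ u → norm u ≡ 1 → conj u ⊗ u ≡ 𝟏
  conj-unit u eq = trans (⊗-comm (conj u) u) (trans (⊗-conj u) (cong ι eq))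

  -- Division with remainder and primes

  -- Rounding to a nearest integer: when the remainder `r` exceeds `n / 2`, the quotient is raised
  -- by 1 and the new remainder is `r - n`. The factor 2 avoids fractions.
  round : ∀ a n .{{_ : ℕ.NonZero n}} → ∃[ q ] 2 ℕ.* ℤ.∣ a ℤ.- q ℤ.* + n ∣ ℕ.≤ n
  round a n with 2 ℕ.* (a %ℕ n) ℕ.≤? n
  ... | yes 2r≤n = a /ℕ n , subst (λ e → 2 ℕ.* ℤ.∣ e ∣ ℕ.≤ n) (sym rem) 2r≤n
    where
    open ℤSolver.+-*-Solver using (solve; _:=_; _:+_; _:*_; _:-_; :-_; con)
    rem : a ℤ.- a /ℕ n ℤ.* + n ≡ + (a %ℕ n)
    rem = trans (cong (ℤ._- a /ℕ n ℤ.* + n) (a≡a%ℕn+[a/ℕn]*n a n))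
      (solve 2 (λ r q → r :+ q :- q := r) refl (+ (a %ℕ n)) (a /ℕ n ℤ.* + n))
  ... | no 2r≰n = a /ℕ n ℤ.+ ℤ.1ℤ , ℕ.+-cancelʳ-≤ (2 ℕ.* r) (2 ℕ.* ℤ.∣ e ∣) n (begin
      2 ℕ.* ℤ.∣ e ∣ ℕ.+ 2 ℕ.* r  ≡⟨ ℕ.*-distribˡ-+ 2 ℤ.∣ e ∣ r ⟨
      2 ℕ.* (ℤ.∣ e ∣ ℕ.+ r)      ≡⟨ cong (λ k → 2 ℕ.* (k ℕ.+ r)) ∣e∣ ⟩
      2 ℕ.* (n ℕ.∸ r ℕ.+ r)      ≡⟨ cong (2 ℕ.*_) (ℕ.m∸n+n≡m r≤n) ⟩
      2 ℕ.* n                    ≡⟨ cong (n ℕ.+_) (ℕ.+-identityʳ n) ⟩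
      n ℕ.+ n                    ≤⟨ ℕ.+-monoʳ-≤ n (ℕ.<⇒≤ (ℕ.≰⇒> 2r≰n)) ⟩
      n ℕ.+ 2 ℕ.* r              ∎)
    where
    open ℕ.≤-Reasoning
    open ℤSolver.+-*-Solver using (solve; _:=_; _:+_; _:*_; _:-_; :-_; con)
    r : ℕ
    r = a %ℕ n
    e : ℤ
    e = a ℤ.- (a /ℕ n ℤ.+ ℤ.1ℤ) ℤ.* + n
    r≤n : r ℕ.≤ n
    r≤n = ℕ.<⇒≤ (n%ℕd<d a n)
    e≡ : e ≡ + r ℤ.- + n
    e≡ = trans (cong (ℤ._- (a /ℕ n ℤ.+ ℤ.1ℤ) ℤ.* + n) (a≡a%ℕn+[a/ℕn]*n a n))
      (solve 3 (λ r q n → r :+ q :* n :- (q :+ con ℤ.1ℤ) :* n := r :- n) refl (+ r) (a /ℕ n) (+ n))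
    ∣e∣ : ℤ.∣ e ∣ ≡ n ℕ.∸ r
    ∣e∣ = trans (cong ℤ.∣_∣ (trans e≡ (ℤ.m-n≡m⊖n r n)))
      (ℤ.∣⊖∣-≤ r≤n)

  squares< : ∀ n e f .{{_ : ℕ.NonZero n}} → 2 ℕ.* e ℕ.≤ n → 2 ℕ.* f ℕ.≤ n → e ℕ.* e ℕ.+ f ℕ.* f ℕ.< n ℕ.* n
  squares< n e f 2e≤n 2f≤n = ℕ.*-cancelˡ-< 4 _ _ (begin-strict
    4 ℕ.* (e ℕ.* e ℕ.+ f ℕ.* f)
      ≡⟨ solve 2 (λ e f → con 4 :* (e :* e :+ f :* f) := (con 2 :* e) :* (con 2 :* e) :+ (con 2 :* f) :* (con 2 :* f)) refl e f ⟩
    (2 ℕ.* e) ℕ.* (2 ℕ.* e) ℕ.+ (2 ℕ.* f) ℕ.* (2 ℕ.* f)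
      ≤⟨ ℕ.+-mono-≤ (ℕ.*-mono-≤ 2e≤n 2e≤n) (ℕ.*-mono-≤ 2f≤n 2f≤n) ⟩
    n ℕ.* n ℕ.+ n ℕ.* n
      <⟨ ℕ.m<m+n (n ℕ.* n ℕ.+ n ℕ.* n) (ℕ.<-≤-trans 0<n² (ℕ.m≤m+n (n ℕ.* n) (n ℕ.* n))) ⟩
    n ℕ.* n ℕ.+ n ℕ.* n ℕ.+ (n ℕ.* n ℕ.+ n ℕ.* n)
      ≡⟨ solve 1 (λ n → n :* n :+ n :* n :+ (n :* n :+ n :* n) := con 4 :* (n :* n)) refl n ⟩
    4 ℕ.* (n ℕ.* n) ∎)
    where
    open ℕ.≤-Reasoning
    open ℕSolver.+-*-Solver using (solve; _:=_; _:+_; _:*_; con)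
    0<n² : 0 ℕ.< n ℕ.* n
    0<n² = ℕ.>-nonZero⁻¹ _ {{ℕ.m*n≢0 n n}}

  ⊖-gauss : ∀ z {k l} → z ⊕ ⊖ gauss k l ≡ gauss (re z ℤ.- k) (im z ℤ.- l)
  ⊖-gauss (gauss _ _) = refl

  gauss-⊗-ι : ∀ a b n → gauss a b ⊗ ι n ≡ gauss (a ℤ.* + n) (b ℤ.* + n)
  gauss-⊗-ι a b n = cong₂ gauss
    (solve 3 (λ a b n → a :* n :- b :* con ℤ.0ℤ := a :* n) refl a b (+ n))
    (solve 3 (λ a b n → a :* con ℤ.0ℤ :+ b :* n := b :* n) refl a b (+ n))
    where
    open ℤSolver.+-*-Solver using (solve; _:=_; _:+_; _:*_; _:-_; con)

  -- The quotient `x / y` is `x ȳ / norm y`, and `q` rounds both of its coordinates. The remainder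
  -- `ρ` satisfies `ρ ȳ = e + f i` with `e` and `f` at most half of `norm y` in absolute value, so
  -- `norm ρ * norm y = e² + f² < (norm y)²`, and `norm y` cancels.
  divMod : ∀ x y → y ≢ 𝟎 → ∃[ q ] norm (x ⊕ ⊖ (q ⊗ y)) ℕ.< norm y
  divMod x y y≢0 = q , ℕ.*-cancelʳ-< (norm y) (norm ρ) (norm y)
    (subst (ℕ._< norm y ℕ.* norm y) (sym norm-ρ) (squares< (norm y) ℤ.∣ e ∣ ℤ.∣ f ∣ {{n≢0}} (proj₂ c) (proj₂ d)))
    where
    n≢0 : ℕ.NonZero (norm y)
    n≢0 = ℕ.≢-nonZero λ eq → y≢0 (norm≡0⇒≡𝟎 y eq)
    X : ℤ[i]
    X = x ⊗ conj y
    c : ∃[ k ] 2 ℕ.* ℤ.∣ re X ℤ.- k ℤ.* + norm y ∣ ℕ.≤ norm y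
    c = round (re X) (norm y) {{n≢0}}
    d : ∃[ k ] 2 ℕ.* ℤ.∣ im X ℤ.- k ℤ.* + norm y ∣ ℕ.≤ norm y
    d = round (im X) (norm y) {{n≢0}}
    q ρ : ℤ[i]
    q = gauss (proj₁ c) (proj₁ d)
    ρ = x ⊕ ⊖ (q ⊗ y)
    e f : ℤ
    e = re X ℤ.- proj₁ c ℤ.* + norm y
    f = im X ℤ.- proj₁ d ℤ.* + norm y
    ρȳ : ρ ⊗ conj y ≡ gauss e f
    ρȳ = begin
      (x ⊕ ⊖ (q ⊗ y)) ⊗ conj y       ≡⟨ solve 4 (λ x q y y' → (x :+ :- (q :* y)) :* y' := x :* y' :+ :- (q :* (y :* y'))) refl x q y (conj y) ⟩
      X ⊕ ⊖ (q ⊗ (y ⊗ conj y))       ≡⟨ cong (λ z → X ⊕ ⊖ (q ⊗ z)) (⊗-conj y) ⟩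
      X ⊕ ⊖ (q ⊗ ι (norm y))         ≡⟨ cong (λ z → X ⊕ ⊖ z) (gauss-⊗-ι (proj₁ c) (proj₁ d) (norm y)) ⟩
      X ⊕ ⊖ gauss (proj₁ c ℤ.* + norm y) (proj₁ d ℤ.* + norm y) ≡⟨ ⊖-gauss X ⟩
      gauss e f                      ∎
      where
      open ≡-Reasoning
      open ℤ[i]-Solver using (solve; _:=_; _:+_; _:*_; :-_)
    norm-ρ : norm ρ ℕ.* norm y ≡ ℤ.∣ e ∣ ℕ.* ℤ.∣ e ∣ ℕ.+ ℤ.∣ f ∣ ℕ.* ℤ.∣ f ∣
    norm-ρ = trans (cong (norm ρ ℕ.*_) (sym (norm-conj y)))
      (trans (sym (norm-⊗ ρ (conj y))) (cong norm ρȳ))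

  infix 4 _∣ᵍ_

  _∣ᵍ_ : ℤ[i] → ℤ[i] → Set
  d ∣ᵍ z = ∃[ q ] z ≡ q ⊗ d

  ∣ᵍ-refl : ∀ z → z ∣ᵍ z
  ∣ᵍ-refl z = 𝟏 , sym (⊗-identityˡ z)

  ∣ᵍ-trans : ∀ {x y z} → x ∣ᵍ y → y ∣ᵍ z → x ∣ᵍ z
  ∣ᵍ-trans {x} (p , refl) (q , refl) = q ⊗ p , sym (⊗-assoc q p x)

  ∣ᵍ-conj : ∀ {d z} → d ∣ᵍ z → conj d ∣ᵍ conj z
  ∣ᵍ-conj {d} (q , refl) = conj q , conj-⊗ q d

  record Bézout (x y : ℤ[i]) : Set where
    constructor bézout
    field
      gcd s t       : ℤ[i]
      combination   : gcd ≡ s ⊗ x ⊕ t ⊗ y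
      gcd∣x         : gcd ∣ᵍ x
      gcd∣y         : gcd ∣ᵍ y

  open ℤ[i]-Solver using (solve; _:=_; _:+_; _:*_; :-_; con)

  bézout-step : ∀ {x y} q → Bézout y (x ⊕ ⊖ (q ⊗ y)) → Bézout x y
  bézout-step {x} {y} q (bézout g s t eq (u , y≡) (v , r≡)) = record
    { gcd         = g
    ; s           = t
    ; t           = s ⊕ ⊖ (t ⊗ q)
    ; combination = trans eq (solve 5 (λ s t x y q → s :* y :+ t :* (x :+ :- (q :* y)) := t :* x :+ (s :+ :- (t :* q)) :* y) refl s t x y q)
    ; gcd∣x       = v ⊕ q ⊗ u , (begin
        x                          ≡⟨ solve 3 (λ x y q → x := (x :+ :- (q :* y)) :+ q :* y) refl x y q ⟩
        (x ⊕ ⊖ (q ⊗ y)) ⊕ q ⊗ y    ≡⟨ cong₂ (λ a b → a ⊕ q ⊗ b) r≡ y≡ ⟩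
        v ⊗ g ⊕ q ⊗ (u ⊗ g)        ≡⟨ solve 4 (λ v g q u → v :* g :+ q :* (u :* g) := (v :+ q :* u) :* g) refl v g q u ⟩
        (v ⊕ q ⊗ u) ⊗ g            ∎)
    ; gcd∣y       = u , y≡
    }
    where
    open ≡-Reasoning

  -- The Euclidean algorithm; the norm of the second argument decreases.
  bézout-identity : ∀ x y → Bézout x y
  bézout-identity x y = <-rec (λ n → ∀ x y → norm y ≡ n → Bézout x y) step (norm y) x y refl
    where
    step : ∀ n → (∀ {k} → k ℕ.< n → ∀ x y → norm y ≡ k → Bézout x y) → ∀ x y → norm y ≡ n → Bézout x y
    step _ rec x y refl = go (y ≟ᵍ 𝟎)
      where
      go : Dec (y ≡ 𝟎) → Bézout x y
      go (yes refl) = bézout x 𝟏 𝟎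
        (solve 1 (λ x → x := con 𝟏 :* x :+ con 𝟎 :* con 𝟎) refl x)
        (∣ᵍ-refl x) (𝟎 , sym (zeroˡ x))
      go (no y≢0) = let (q , r<y) = divMod x y y≢0 in bézout-step q (rec r<y y (x ⊕ ⊖ (q ⊗ y)) refl)

  -- The bound on the norm excludes 0 and the units together. Primality, not irreducibility, is
  -- recorded because all later arguments split a product.
  record Prime (π : ℤ[i]) : Set where
    field
      1<norm : 1 ℕ.< norm π
      split  : ∀ x y → π ∣ᵍ x ⊗ y → π ∣ᵍ x ⊎ π ∣ᵍ y

    nonZero : π ≢ 𝟎
    nonZero refl = contradiction 1<norm λ ()

    norm-nonZero : ℕ.NonZero (norm π)
    norm-nonZero = ℕ.>-nonZero (ℕ.<-trans (ℕ.s≤s ℕ.z≤n) 1<norm)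

  -- Let `g` be a gcd of `π` and `x`. If `g` is a unit, multiplying its Bézout combination by `y`
  -- exhibits `y` as a multiple of `π`. Otherwise `g` has the norm of `π`, so the cofactor `u` in
  -- `π = u g` is a unit, with inverse `conj u`, and `π` divides `x` along with `g`.
  irreducible⇒prime : ∀ π → 1 ℕ.< norm π → (∀ d → d ∣ᵍ π → norm d ≢ 1 → norm d ≡ norm π) → Prime π
  irreducible⇒prime π 1<π irr = record { 1<norm = 1<π ; split = split }
    where
    split : ∀ x y → π ∣ᵍ x ⊗ y → π ∣ᵍ x ⊎ π ∣ᵍ y
    split x y (q , xy≡qπ) = go (bézout-identity π x)
      where
      open ≡-Reasoning
      go : Bézout π x → π ∣ᵍ x ⊎ π ∣ᵍ y
      go (bézout g s t eq (u , π≡) (v , x≡)) = by-norm (norm g ℕ.≟ 1)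
        where
        by-norm : Dec (norm g ≡ 1) → π ∣ᵍ x ⊎ π ∣ᵍ y
        by-norm (yes g-unit) = inj₂ (conj g ⊗ (s ⊗ y ⊕ t ⊗ q) , (begin
          y                                    ≡⟨ ⊗-identityˡ y ⟨
          𝟏 ⊗ y                                ≡⟨ cong (_⊗ y) (conj-unit g g-unit) ⟨
          conj g ⊗ g ⊗ y                       ≡⟨ cong (λ e → conj g ⊗ e ⊗ y) eq ⟩
          conj g ⊗ (s ⊗ π ⊕ t ⊗ x) ⊗ y         ≡⟨ solve 6 (λ g s p t x y → g :* (s :* p :+ t :* x) :* y := g :* (s :* y :* p :+ t :* (x :* y))) refl (conj g) s π t x y ⟩
          conj g ⊗ (s ⊗ y ⊗ π ⊕ t ⊗ (x ⊗ y))   ≡⟨ cong (λ e → conj g ⊗ (s ⊗ y ⊗ π ⊕ t ⊗ e)) xy≡qπ ⟩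
          conj g ⊗ (s ⊗ y ⊗ π ⊕ t ⊗ (q ⊗ π))   ≡⟨ solve 6 (λ g s y p t q → g :* (s :* y :* p :+ t :* (q :* p)) := g :* (s :* y :+ t :* q) :* p) refl (conj g) s y π t q ⟩
          conj g ⊗ (s ⊗ y ⊕ t ⊗ q) ⊗ π         ∎))
        by-norm (no g-nonunit) = inj₁ (v ⊗ conj u , (begin
          x                    ≡⟨ x≡ ⟩
          v ⊗ g                ≡⟨ cong (v ⊗_) (⊗-identityˡ g) ⟨
          v ⊗ (𝟏 ⊗ g)          ≡⟨ cong (λ e → v ⊗ (e ⊗ g)) (conj-unit u u-unit) ⟨
          v ⊗ (conj u ⊗ u ⊗ g) ≡⟨ solve 4 (λ v c u g → v :* (c :* u :* g) := v :* c :* (u :* g)) refl v (conj u) u g ⟩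
          v ⊗ conj u ⊗ (u ⊗ g) ≡⟨ cong (v ⊗ conj u ⊗_) π≡ ⟨
          v ⊗ conj u ⊗ π       ∎))
          where
          u-unit : norm u ≡ 1
          u-unit = ℕ.*-cancelʳ-≡ (norm u) 1 (norm π) {{ℕ.>-nonZero (ℕ.<-trans (ℕ.s≤s ℕ.z≤n) 1<π)}} (begin
            norm u ℕ.* norm π  ≡⟨ cong (norm u ℕ.*_) (irr g (u , π≡) g-nonunit) ⟨
            norm u ℕ.* norm g  ≡⟨ norm-⊗ u g ⟨
            norm (u ⊗ g)       ≡⟨ cong norm π≡ ⟨
            norm π             ≡⟨ ℕ.*-identityˡ (norm π) ⟨
            1 ℕ.* norm π       ∎)

  norm-∣ : ∀ {d z} → d ∣ᵍ z → norm d ℕ.∣ norm z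
  norm-∣ {d} (q , refl) = ℕ.divides (norm q) (norm-⊗ q d)

  -- Double negation saves the search for a divisor; it is harmless because the theorem is negative.
  prime-divisor : ∀ z → 1 ℕ.< norm z → ¬ ¬ (∃[ π ] Prime π × π ∣ᵍ z)
  prime-divisor z 1<z = <-rec (λ n → ∀ z → norm z ≡ n → 1 ℕ.< n → ¬ ¬ (∃[ π ] Prime π × π ∣ᵍ z)) step (norm z) z refl 1<z
    where
    step : ∀ n → (∀ {k} → k ℕ.< n → ∀ z → norm z ≡ k → 1 ℕ.< k → ¬ ¬ (∃[ π ] Prime π × π ∣ᵍ z)) →
           ∀ z → norm z ≡ n → 1 ℕ.< n → ¬ ¬ (∃[ π ] Prime π × π ∣ᵍ z)
    step _ rec z refl 1<z none = none (z , irreducible⇒prime z 1<z irr , ∣ᵍ-refl z)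
      where
      z≢0 : ℕ.NonZero (norm z)
      z≢0 = ℕ.>-nonZero (ℕ.<-trans (ℕ.s≤s ℕ.z≤n) 1<z)
      irr : ∀ d → d ∣ᵍ z → norm d ≢ 1 → norm d ≡ norm z
      irr d d∣z d≢1 = go (norm d ℕ.≟ norm z)
        where
        d≢0 : norm d ≢ 0
        d≢0 eq = ℕ.≢-nonZero⁻¹ (norm z) {{z≢0}} (ℕ.0∣⇒≡0 (subst (ℕ._∣ norm z) eq (norm-∣ d∣z)))
        go : Dec (norm d ≡ norm z) → norm d ≡ norm z
        go (yes eq) = eq
        go (no neq) = contradiction
          (λ { (π , p , π∣d) → none (π , p , ∣ᵍ-trans π∣d d∣z) })
          (rec (ℕ.≤∧≢⇒< (ℕ.∣⇒≤ {{z≢0}} (norm-∣ d∣z)) neq) d refl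
            (ℕ.≤∧≢⇒< (ℕ.n≢0⇒n>0 d≢0) (λ eq → d≢1 (sym eq))))

  norm-quotient : ∀ {d} w {m} → .{{ℕ.NonZero (norm d)}} → norm (w ⊗ d) ≡ norm d ℕ.* m → norm w ≡ m
  norm-quotient {d} w {m} eq = ℕ.*-cancelˡ-≡ (norm w) m (norm d)
    (trans (ℕ.*-comm (norm d) (norm w)) (trans (sym (norm-⊗ w d)) eq))

  -- Divisibility by a Gaussian prime and by its conjugate

  infixr 9 _^ᵍ_
  _^ᵍ_ : ℤ[i] → ℕ → ℤ[i]
  z ^ᵍ zero  = 𝟏
  z ^ᵍ suc k = z ⊗ z ^ᵍ k

  norm-^ᵍ : ∀ z k → norm (z ^ᵍ k) ≡ norm z ℕ.^ k
  norm-^ᵍ z zero    = refl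
  norm-^ᵍ z (suc k) = trans (norm-⊗ z (z ^ᵍ k)) (cong (norm z ℕ.*_) (norm-^ᵍ z k))

  module _ {π : ℤ[i]} (π-prime : Prime π) where

    open Prime π-prime

    prime∤𝟏 : ¬ π ∣ᵍ 𝟏
    prime∤𝟏 π∣1 = ℕ.<⇒≱ 1<norm (ℕ.∣⇒≤ (norm-∣ π∣1))

    prime∣^ : ∀ a k → π ∣ᵍ a ^ᵍ k → π ∣ᵍ a
    prime∣^ a zero    p = contradiction p prime∤𝟏
    prime∣^ a (suc k) p = Sum.[ (λ q → q) , prime∣^ a k ] (split a (a ^ᵍ k) p)

    -- `π` divides `π π̄ m = norm z = z z̄`, hence `z` or `z̄`; the second case is conjugated.
    prime-or-conj : ∀ z {m} → norm z ≡ norm π ℕ.* m → π ∣ᵍ z ⊎ conj π ∣ᵍ z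
    prime-or-conj z {m} eq = Sum.map₂ (λ d → subst (conj π ∣ᵍ_) (conj-involutive z) (∣ᵍ-conj d))
      (split z (conj z) (conj π ⊗ ι m , (begin
        z ⊗ conj z              ≡⟨ ⊗-conj z ⟩
        ι (norm z)              ≡⟨ cong ι eq ⟩
        ι (norm π ℕ.* m)        ≡⟨ ι-* (norm π) m ⟩
        ι (norm π) ⊗ ι m        ≡⟨ cong (_⊗ ι m) (⊗-conj π) ⟨
        π ⊗ conj π ⊗ ι m        ≡⟨ solve 3 (λ a b c → a :* b :* c := b :* c :* a) refl π (conj π) (ι m) ⟩
        conj π ⊗ ι m ⊗ π        ∎)))
      where
      open ≡-Reasoning

    norm-quotient-π : ∀ w {m} → norm (w ⊗ π) ≡ norm π ℕ.* m → norm w ≡ m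
    norm-quotient-π w = norm-quotient w {{norm-nonZero}}

    norm-quotient-π̄ : ∀ w {m} → norm (w ⊗ conj π) ≡ norm π ℕ.* m → norm w ≡ m
    norm-quotient-π̄ w {m} eq = norm-quotient {conj π} w {{subst ℕ.NonZero (sym (norm-conj π)) norm-nonZero}}
      (trans eq (cong (ℕ._* m) (sym (norm-conj π))))

    -- Supplies the point of the smaller shell that the induction needs: whichever of `π` and `π̄`
    -- divides is removed, `k` times.
    peel : ∀ k n z → norm z ≡ norm π ℕ.^ k ℕ.* n → ∃[ w ] norm w ≡ n
    peel zero    n z eq = z , trans eq (ℕ.*-identityˡ n)
    peel (suc k) n z eq = go (prime-or-conj z eq′)
      where
      eq′ : norm z ≡ norm π ℕ.* (norm π ℕ.^ k ℕ.* n)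
      eq′ = trans eq (ℕ.*-assoc (norm π) (norm π ℕ.^ k) n)
      go : π ∣ᵍ z ⊎ conj π ∣ᵍ z → ∃[ w ] norm w ≡ n
      go (inj₁ (q , refl)) = peel k n q (norm-quotient-π q eq′)
      go (inj₂ (q , refl)) = peel k n q (norm-quotient-π̄ q eq′)

    -- Factors `π̄` are removed until, at some stage, `π` divides what is left. It then divides `z`;
    -- if this never happens, all `k` factors removed are `π̄`.
    π∣⊎conj-power : ∀ k n z → norm z ≡ norm π ℕ.^ k ℕ.* n → π ∣ᵍ z ⊎ (∃[ w ] norm w ≡ n × z ≡ conj π ^ᵍ k ⊗ w)
    π∣⊎conj-power zero    n z eq = inj₂ (z , trans eq (ℕ.*-identityˡ n) , sym (⊗-identityˡ z))
    π∣⊎conj-power (suc k) n z eq = go (prime-or-conj z eq′)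
      where
      eq′ : norm z ≡ norm π ℕ.* (norm π ℕ.^ k ℕ.* n)
      eq′ = trans eq (ℕ.*-assoc (norm π) (norm π ℕ.^ k) n)
      go : π ∣ᵍ z ⊎ conj π ∣ᵍ z → π ∣ᵍ z ⊎ (∃[ w ] norm w ≡ n × z ≡ conj π ⊗ conj π ^ᵍ k ⊗ w)
      go (inj₁ p) = inj₁ p
      go (inj₂ (q , refl)) = Sum.map
        (λ { (t , refl) → conj π ⊗ t , solve 3 (λ t p c → t :* p :* c := c :* t :* p) refl t π (conj π) })
        (λ { (w , nw , refl) → w , nw , solve 3 (λ c a w → a :* w :* c := c :* a :* w) refl (conj π) (conj π ^ᵍ k) w })
        (π∣⊎conj-power k n q (norm-quotient-π̄ q eq′))

  -- Fourth-power sums over shells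

  infix 9 _⁴
  _⁴ : ℤ[i] → ℤ[i]
  z ⁴ = z ⊗ z ⊗ (z ⊗ z)

  Σ⁴ : List ℤ[i] → ℤ[i]
  Σ⁴ []       = 𝟎
  Σ⁴ (z ∷ zs) = z ⁴ ⊕ Σ⁴ zs

  Σ⁴-↭ : ∀ {xs ys} → xs ↭ ys → Σ⁴ xs ≡ Σ⁴ ys
  Σ⁴-↭ Perm.refl           = refl
  Σ⁴-↭ (Perm.prep x p)     = cong (x ⁴ ⊕_) (Σ⁴-↭ p)
  Σ⁴-↭ (Perm.swap {xs} {ys} x y p) = trans (cong (λ s → x ⁴ ⊕ (y ⁴ ⊕ s)) (Σ⁴-↭ p))
    (solve 3 (λ a b c → a :+ (b :+ c) := b :+ (a :+ c)) refl (x ⁴) (y ⁴) (Σ⁴ ys))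
  Σ⁴-↭ (Perm.trans p q)    = trans (Σ⁴-↭ p) (Σ⁴-↭ q)

  Σ⁴-++ : ∀ xs ys → Σ⁴ (xs ++ ys) ≡ Σ⁴ xs ⊕ Σ⁴ ys
  Σ⁴-++ []       ys = solve 1 (λ a → a := con 𝟎 :+ a) refl (Σ⁴ ys)
  Σ⁴-++ (x ∷ xs) ys = trans (cong (x ⁴ ⊕_) (Σ⁴-++ xs ys))
    (solve 3 (λ a b c → a :+ (b :+ c) := a :+ b :+ c) refl (x ⁴) (Σ⁴ xs) (Σ⁴ ys))

  Σ⁴-map-⊗ : ∀ a xs → Σ⁴ (List.map (a ⊗_) xs) ≡ a ⁴ ⊗ Σ⁴ xs
  Σ⁴-map-⊗ a []       = sym (zeroʳ (a ⁴))
  Σ⁴-map-⊗ a (x ∷ xs) = trans (cong ((a ⊗ x) ⁴ ⊕_) (Σ⁴-map-⊗ a xs))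
    (solve 3 (λ a x s → (a :* x :* (a :* x)) :* (a :* x :* (a :* x)) :+ (a :* a :* (a :* a)) :* s
                     := (a :* a :* (a :* a)) :* (x :* x :* (x :* x) :+ s)) refl a x (Σ⁴ xs))

  Σ⁴-map-conj : ∀ xs → Σ⁴ (List.map conj xs) ≡ conj (Σ⁴ xs)
  Σ⁴-map-conj []       = refl
  Σ⁴-map-conj (x ∷ xs) = begin
    conj x ⁴ ⊕ Σ⁴ (List.map conj xs)  ≡⟨ cong (conj x ⁴ ⊕_) (Σ⁴-map-conj xs) ⟩
    conj x ⁴ ⊕ conj (Σ⁴ xs)           ≡⟨ cong (_⊕ conj (Σ⁴ xs)) (trans (conj-⊗ (x ⊗ x) (x ⊗ x)) (cong₂ _⊗_ (conj-⊗ x x) (conj-⊗ x x))) ⟨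
    conj (x ⁴) ⊕ conj (Σ⁴ xs)         ≡⟨ conj-⊕ (x ⁴) (Σ⁴ xs) ⟨
    conj (x ⁴ ⊕ Σ⁴ xs)                ∎
    where
    open ≡-Reasoning

  -- A predicate on lists rather than one fixed list: the Gaussian integers extracted from a design
  -- come in their own order, and two lists satisfying it are permutations of each other.
  record IsShell (m : ℕ) (xs : List ℤ[i]) : Set where
    field
      unique   : Unique xs
      sound    : ∀ {z} → z ∈ xs → norm z ≡ m
      complete : ∀ {z} → norm z ≡ m → z ∈ xs

  open IsShell

  unique-↭ : ∀ {xs ys : List ℤ[i]} → Unique xs → Unique ys →
             (∀ {z} → z ∈ xs → z ∈ ys) → (∀ {z} → z ∈ ys → z ∈ xs) → xs ↭ ys
  unique-↭ xs! ys! to from = ∼bag⇒↭ (unique∧set⇒bag xs! ys! (mk⇔ to from))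

  ⊗-map-unique : ∀ {a xs} → a ≢ 𝟎 → Unique xs → Unique (List.map (a ⊗_) xs)
  ⊗-map-unique a≢0 = Unique.map⁺ (λ {x} {y} → ⊗-cancelˡ x y a≢0)

  interval : ℕ → List ℤ
  interval m = List.map +_ (upTo (suc m)) ++ List.map -[1+_] (upTo m)

  interval-unique : ∀ m → Unique (interval m)
  interval-unique m = Unique.++⁺ (Unique.map⁺ ℤ.+-injective (Unique.upTo⁺ (suc m)))
    (Unique.map⁺ ℤ.-[1+-injective (Unique.upTo⁺ m)) disjoint
    where
    disjoint : Disjoint (List.map +_ (upTo (suc m))) (List.map -[1+_] (upTo m))
    disjoint (p , q) with ∈-map⁻ +_ p | ∈-map⁻ -[1+_] q
    ... | _ , _ , refl | _ , _ , ()

  ∈-interval : ∀ {m} a → ℤ.∣ a ∣ ℕ.≤ m → a ∈ interval m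
  ∈-interval (+ n)    n≤m = ∈-++⁺ˡ (∈-map⁺ +_ (∈-upTo⁺ (ℕ.s≤s n≤m)))
  ∈-interval {m} -[1+ n ] n<m = ∈-++⁺ʳ (List.map +_ (upTo (suc m))) (∈-map⁺ -[1+_] (∈-upTo⁺ n<m))

  n≤n*n : ∀ n → n ℕ.≤ n ℕ.* n
  n≤n*n zero    = ℕ.z≤n
  n≤n*n (suc n) = ℕ.m≤m*n (suc n) (suc n)

  -- The box suffices because the absolute value of a coordinate is at most its square, hence at
  -- most the norm.
  shell-list : ℕ → List ℤ[i]
  shell-list m = filter (λ z → norm z ℕ.≟ m) (cartesianProductWith gauss (interval m) (interval m))

  shell-list-isShell : ∀ m → IsShell m (shell-list m)
  shell-list-isShell m = record
    { unique   = Unique.filter⁺ norm≟m (Unique.cartesianProductWith⁺ gauss (λ { refl → refl , refl })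
                   (interval-unique m) (interval-unique m))
    ; sound    = λ z∈ → proj₂ (∈-filter⁻ norm≟m {xs = cartesianProductWith gauss (interval m) (interval m)} z∈)
    ; complete = complete′
    }
    where
    norm≟m : ∀ z → Dec (norm z ≡ m)
    norm≟m z = norm z ℕ.≟ m
    complete′ : ∀ {z} → norm z ≡ m → z ∈ shell-list m
    complete′ {gauss a b} refl = ∈-filter⁺ norm≟m (∈-cartesianProductWith⁺ gauss
      (∈-interval a (ℕ.≤-trans (n≤n*n ℤ.∣ a ∣) (ℕ.m≤m+n _ _)))
      (∈-interval b (ℕ.≤-trans (n≤n*n ℤ.∣ b ∣) (ℕ.m≤n+m _ (ℤ.∣ a ∣ ℕ.* ℤ.∣ a ∣))))) refl

  ⁴-≢𝟎 : ∀ {z} → z ≢ 𝟎 → z ⁴ ≢ 𝟎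
  ⁴-≢𝟎 z≢0 = ⊗-≢𝟎 (⊗-≢𝟎 z≢0 z≢0) (⊗-≢𝟎 z≢0 z≢0)

  ^ᵍ-≢𝟎 : ∀ {z} k → z ≢ 𝟎 → z ^ᵍ k ≢ 𝟎
  ^ᵍ-≢𝟎 zero    z≢0 = λ ()
  ^ᵍ-≢𝟎 (suc k) z≢0 = ⊗-≢𝟎 z≢0 (^ᵍ-≢𝟎 k z≢0)

  -- Here `π` and `π̄` are associates: up to units, `π` is 1 + i or a rational prime that stays
  -- prime in ℤ[i]. Either outcome of `prime-or-conj` gives `π ∣ z`, so multiplication by `π` is a
  -- bijection of the shells.
  shell-sum-selfconjugate : ∀ {π} → Prime π → π ∣ᵍ conj π → ∀ {m xs ys} →
    IsShell (norm π ℕ.* m) xs → IsShell m ys → Σ⁴ xs ≡ π ⁴ ⊗ Σ⁴ ys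
  shell-sum-selfconjugate {π} π-prime π∣π̄ {m} {xs} {ys} X Y = trans
    (Σ⁴-↭ (unique-↭ (unique X) (⊗-map-unique nonZero (unique Y)) to from)) (Σ⁴-map-⊗ π ys)
    where
    open Prime π-prime
    to : ∀ {z} → z ∈ xs → z ∈ List.map (π ⊗_) ys
    to {z} z∈ = go (Sum.[ (λ p → p) , ∣ᵍ-trans π∣π̄ ] (prime-or-conj π-prime z (sound X z∈)))
      where
      go : π ∣ᵍ z → z ∈ List.map (π ⊗_) ys
      go (q , refl) = subst (_∈ List.map (π ⊗_) ys) (⊗-comm π q)
        (∈-map⁺ (π ⊗_) (complete Y (norm-quotient-π π-prime q (sound X z∈))))
    from : ∀ {z} → z ∈ List.map (π ⊗_) ys → z ∈ xs
    from z∈ with ∈-map⁻ (π ⊗_) z∈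
    ... | w , w∈ , refl = complete X (trans (norm-⊗ π w) (cong (norm π ℕ.*_) (sound Y w∈)))

  -- = Σ_{i + j = k} π⁴ⁱ π̄⁴ʲ
  coefficient : ℤ[i] → ℕ → ℤ[i]
  coefficient π zero    = 𝟏
  coefficient π (suc k) = (conj π ^ᵍ suc k) ⁴ ⊕ π ⁴ ⊗ coefficient π k

  module _ {π : ℤ[i]} (π-prime : Prime π) (π∤π̄ : ¬ π ∣ᵍ conj π) where

    open Prime π-prime

    π̄-power-∤ : ∀ k → ¬ π ∣ᵍ conj π ^ᵍ k
    π̄-power-∤ k p = π∤π̄ (prime∣^ π-prime (conj π) k p)

    coefficient≢𝟎 : ∀ k → coefficient π k ≢ 𝟎
    coefficient≢𝟎 zero    ()
    coefficient≢𝟎 (suc k) eq = Sum.[ square , square ] (split (a ⊗ a) (a ⊗ a) (q , (begin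
      a ⁴                           ≡⟨ solve 2 (λ x y → x := (x :+ y) :+ :- y) refl (a ⁴) (π ⁴ ⊗ c) ⟩
      (a ⁴ ⊕ π ⁴ ⊗ c) ⊕ ⊖ (π ⁴ ⊗ c) ≡⟨ cong (_⊕ ⊖ (π ⁴ ⊗ c)) eq ⟩
      𝟎 ⊕ ⊖ (π ⁴ ⊗ c)               ≡⟨ solve 2 (λ p c → con 𝟎 :+ :- (p :* p :* (p :* p) :* c) := :- (p :* p :* p :* c) :* p) refl π c ⟩
      q ⊗ π                         ∎)))
      where
      open ≡-Reasoning
      a c q : ℤ[i]
      a = conj π ^ᵍ suc k
      c = coefficient π k
      q = ⊖ (π ⊗ π ⊗ π ⊗ c)
      square : ¬ π ∣ᵍ a ⊗ a
      square p = Sum.[ π̄-power-∤ (suc k) , π̄-power-∤ (suc k) ] (split a a p)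

    conj≢𝟎 : conj π ≢ 𝟎
    conj≢𝟎 eq = π∤π̄ (𝟎 , trans eq (sym (zeroˡ π)))

    -- The multiples of `π` form `π` times the shell of norm `P ^ k * n`, to which the recursion
    -- applies; the others are `π̄ ^ (k + 1)` times the shell of norm `n`. The two classes are
    -- disjoint because `π ∣ π̄ ^ (k + 1) w` would force `π ∣ w`, hence `P ∣ n`.
    shell-sum-split : ∀ {n ys} → ¬ norm π ℕ.∣ n → IsShell n ys →
                      ∀ k {xs} → IsShell (norm π ℕ.^ k ℕ.* n) xs → Σ⁴ xs ≡ coefficient π k ⊗ Σ⁴ ys
    shell-sum-split {n} {ys} P∤n Y zero {xs} X = trans
      (Σ⁴-↭ (unique-↭ (unique X) (unique Y)
        (λ z∈ → complete Y (trans (sound X z∈) (ℕ.*-identityˡ n)))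
        (λ z∈ → complete X (trans (sound Y z∈) (sym (ℕ.*-identityˡ n))))))
      (sym (⊗-identityˡ (Σ⁴ ys)))
    shell-sum-split {n} {ys} P∤n Y (suc k) {xs} X = begin
      Σ⁴ xs                                             ≡⟨ Σ⁴-↭ (unique-↭ (unique X) unique′ to from) ⟩
      Σ⁴ (List.map (a ⊗_) ys ++ List.map (π ⊗_) zs)     ≡⟨ Σ⁴-++ (List.map (a ⊗_) ys) (List.map (π ⊗_) zs) ⟩
      Σ⁴ (List.map (a ⊗_) ys) ⊕ Σ⁴ (List.map (π ⊗_) zs) ≡⟨ cong₂ _⊕_ (Σ⁴-map-⊗ a ys) (Σ⁴-map-⊗ π zs) ⟩
      a ⁴ ⊗ Σ⁴ ys ⊕ π ⁴ ⊗ Σ⁴ zs                         ≡⟨ cong (λ s → a ⁴ ⊗ Σ⁴ ys ⊕ π ⁴ ⊗ s) (shell-sum-split P∤n Y k Z) ⟩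
      a ⁴ ⊗ Σ⁴ ys ⊕ π ⁴ ⊗ (coefficient π k ⊗ Σ⁴ ys)     ≡⟨ solve 4 (λ a s p c → a :* s :+ p :* (c :* s) := (a :+ p :* c) :* s) refl (a ⁴) (Σ⁴ ys) (π ⁴) (coefficient π k) ⟩
      (a ⁴ ⊕ π ⁴ ⊗ coefficient π k) ⊗ Σ⁴ ys             ∎
      where
      open ≡-Reasoning
      P m : ℕ
      P = norm π
      m = P ℕ.^ k ℕ.* n
      a : ℤ[i]
      a = conj π ^ᵍ suc k
      zs : List ℤ[i]
      zs = shell-list m
      Z : IsShell m zs
      Z = shell-list-isShell m
      P*m≡ : P ℕ.* m ≡ P ℕ.^ suc k ℕ.* n
      P*m≡ = sym (ℕ.*-assoc P (P ℕ.^ k) n)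
      disjoint : Disjoint (List.map (a ⊗_) ys) (List.map (π ⊗_) zs)
      disjoint (p , q) with ∈-map⁻ (a ⊗_) p | ∈-map⁻ (π ⊗_) q
      ... | w , w∈ , refl | t , _ , aw≡πt =
        Sum.[ π̄-power-∤ (suc k) , (λ π∣w → P∤n (subst (P ℕ.∣_) (sound Y w∈) (norm-∣ π∣w))) ]
          (split a w (t , trans aw≡πt (⊗-comm π t)))
      unique′ : Unique (List.map (a ⊗_) ys ++ List.map (π ⊗_) zs)
      unique′ = Unique.++⁺ (⊗-map-unique (^ᵍ-≢𝟎 (suc k) conj≢𝟎) (unique Y))
                           (⊗-map-unique nonZero (unique Z)) disjoint
      to : ∀ {z} → z ∈ xs → z ∈ List.map (a ⊗_) ys ++ List.map (π ⊗_) zs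
      to {z} z∈ = go (π∣⊎conj-power π-prime (suc k) n z (sound X z∈))
        where
        go : π ∣ᵍ z ⊎ (∃[ w ] norm w ≡ n × z ≡ a ⊗ w) → z ∈ List.map (a ⊗_) ys ++ List.map (π ⊗_) zs
        go (inj₁ (q , refl)) = ∈-++⁺ʳ (List.map (a ⊗_) ys) (subst (_∈ List.map (π ⊗_) zs) (⊗-comm π q)
          (∈-map⁺ (π ⊗_) (complete Z (norm-quotient-π π-prime q (trans (sound X z∈) (sym P*m≡))))))
        go (inj₂ (w , nw , refl)) = ∈-++⁺ˡ (∈-map⁺ (a ⊗_) (complete Y nw))
      from : ∀ {z} → z ∈ List.map (a ⊗_) ys ++ List.map (π ⊗_) zs → z ∈ xs
      from z∈ with ∈-++⁻ (List.map (a ⊗_) ys) z∈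
      ... | inj₁ p with ∈-map⁻ (a ⊗_) p
      ...   | w , w∈ , refl = complete X (trans (norm-⊗ a w)
              (cong₂ ℕ._*_ (trans (norm-^ᵍ (conj π) (suc k)) (cong (ℕ._^ suc k) (norm-conj π))) (sound Y w∈)))
      from z∈ | inj₂ q with ∈-map⁻ (π ⊗_) q
      ...   | t , t∈ , refl = complete X (trans (norm-⊗ π t) (trans (cong (P ℕ.*_) (sound Z t∈)) P*m≡))

  -- Nonvanishing of the sums by induction on the norm

  remove-factor : ∀ p m → 1 ℕ.< p → 0 ℕ.< m → ∃[ k ] ∃[ n ] m ≡ p ℕ.^ k ℕ.* n × ¬ p ℕ.∣ n
  remove-factor p m 1<p = <-rec (λ m → 0 ℕ.< m → ∃[ k ] ∃[ n ] m ≡ p ℕ.^ k ℕ.* n × ¬ p ℕ.∣ n) step m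
    where
    step : ∀ m → (∀ {l} → l ℕ.< m → 0 ℕ.< l → ∃[ k ] ∃[ n ] l ≡ p ℕ.^ k ℕ.* n × ¬ p ℕ.∣ n) →
           0 ℕ.< m → ∃[ k ] ∃[ n ] m ≡ p ℕ.^ k ℕ.* n × ¬ p ℕ.∣ n
    step m rec 0<m with p ℕ.∣? m
    ... | no p∤m = 0 , m , sym (ℕ.*-identityˡ m) , p∤m
    ... | yes (ℕ.divides zero refl) = contradiction 0<m λ ()
    ... | yes (ℕ.divides l@(suc _) refl) =
      let (k , n , eq , p∤n) = rec (ℕ.m<m*n l p 1<p) (ℕ.s≤s ℕ.z≤n)
      in suc k , n , trans (ℕ.*-comm l p) (trans (cong (p ℕ.*_) eq) (sym (ℕ.*-assoc p (p ℕ.^ k) n))) , p∤n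

  m<n*m : ∀ m n → .{{ℕ.NonZero m}} → 1 ℕ.< n → m ℕ.< n ℕ.* m
  m<n*m m n 1<n = subst (m ℕ.<_) (ℕ.*-comm m n) (ℕ.m<m*n m n 1<n)

  -- The reason for the exponent 4: the units 1, i, -1, -i all have fourth power 1, so the sum over
  -- norm 1 counts them, whereas their squares cancel.
  norm≡1⇒⁴≡𝟏 : ∀ z → norm z ≡ 1 → z ⁴ ≡ 𝟏
  norm≡1⇒⁴≡𝟏 (gauss (+ 0) (+ 1)) _                = refl
  norm≡1⇒⁴≡𝟏 (gauss (+ 0) -[1+ 0 ]) _             = refl
  norm≡1⇒⁴≡𝟏 (gauss (+ 1) (+ 0)) _                = refl
  norm≡1⇒⁴≡𝟏 (gauss -[1+ 0 ] (+ 0)) _             = refl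
  norm≡1⇒⁴≡𝟏 (gauss (+ 0) (+ 0)) ()
  norm≡1⇒⁴≡𝟏 (gauss (+ 0) (+ suc (suc n))) ()
  norm≡1⇒⁴≡𝟏 (gauss (+ 0) -[1+ suc n ]) ()
  norm≡1⇒⁴≡𝟏 (gauss (+ 1) (+ suc n)) ()
  norm≡1⇒⁴≡𝟏 (gauss (+ 1) -[1+ n ]) ()
  norm≡1⇒⁴≡𝟏 (gauss -[1+ 0 ] (+ suc n)) ()
  norm≡1⇒⁴≡𝟏 (gauss -[1+ 0 ] -[1+ n ]) ()
  norm≡1⇒⁴≡𝟏 (gauss (+ suc (suc n)) b) ()
  norm≡1⇒⁴≡𝟏 (gauss -[1+ suc n ] b) ()

  Σ⁴-units : ∀ xs → (∀ {z} → z ∈ xs → norm z ≡ 1) → Σ⁴ xs ≡ ι (List.length xs)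
  Σ⁴-units []       _ = refl
  Σ⁴-units (x ∷ xs) u = cong₂ _⊕_ (norm≡1⇒⁴≡𝟏 x (u (here refl))) (Σ⁴-units xs (λ z∈ → u (there z∈)))

  shell-sum≢𝟎 : ∀ m {xs} → IsShell m xs → 0 ℕ.< m → ∀ z → norm z ≡ m → Σ⁴ xs ≢ 𝟎
  shell-sum≢𝟎 = <-rec (λ m → ∀ {xs} → IsShell m xs → 0 ℕ.< m → ∀ z → norm z ≡ m → Σ⁴ xs ≢ 𝟎) step
    where
    step : ∀ m → (∀ {k} → k ℕ.< m → ∀ {xs} → IsShell k xs → 0 ℕ.< k → ∀ z → norm z ≡ k → Σ⁴ xs ≢ 𝟎) →
           ∀ {xs} → IsShell m xs → 0 ℕ.< m → ∀ z → norm z ≡ m → Σ⁴ xs ≢ 𝟎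
    step 1 rec {[]} X _ z nz _ with () ← complete X {z} nz
    step 1 rec {x ∷ xs} X _ z nz eq with () ← ι-injective (trans (sym (Σ⁴-units (x ∷ xs) (sound X))) eq)
    step m@(suc (suc _)) rec {xs} X 0<m z nz eq =
      prime-divisor z (subst (1 ℕ.<_) (sym nz) (ℕ.s≤s (ℕ.s≤s ℕ.z≤n))) with-prime
      where
      with-prime : ∃[ π ] Prime π × π ∣ᵍ z → ⊥
      -- Whether `π` divides `π̄` is not decided: `self-case` refutes it, and `split-case` turns
      -- that refutation into a contradiction.
      with-prime (π , π-prime , π∣z@(q , refl)) = split-case self-case
        where
        open Prime π-prime
        P : ℕ
        P = norm π
        positive-factor : ∀ a {b} → m ≡ a ℕ.* b → 0 ℕ.< b
        positive-factor a {zero}  m≡ = contradiction (trans m≡ (ℕ.*-zeroʳ a)) λ ()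
        positive-factor a {suc _} m≡ = ℕ.s≤s ℕ.z≤n
        self-case : π ∣ᵍ conj π → ⊥
        self-case π∣π̄ = ⊗-≢𝟎 (⁴-≢𝟎 nonZero)
          (rec (subst (norm q ℕ.<_) (sym m≡) (m<n*m (norm q) P {{ℕ.>-nonZero (positive-factor P m≡)}} 1<norm)) Y (positive-factor P m≡) q refl)
          (trans (sym (shell-sum-selfconjugate π-prime π∣π̄ (subst (λ k → IsShell k xs) m≡ X) Y)) eq)
          where
          m≡ : m ≡ P ℕ.* norm q
          m≡ = trans (sym nz) (trans (norm-⊗ q π) (ℕ.*-comm (norm q) P))
          Y : IsShell (norm q) (shell-list (norm q))
          Y = shell-list-isShell (norm q)
        split-case : ¬ ¬ (π ∣ᵍ conj π)
        split-case π∤π̄ = by-exponent (remove-factor P m 1<norm 0<m)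
          where
          by-exponent : (∃[ k ] ∃[ n ] m ≡ P ℕ.^ k ℕ.* n × ¬ P ℕ.∣ n) → ⊥
          -- Exponent 0 is impossible, since `π ∣ z` gives `P ∣ m`; a positive exponent makes `n`
          -- smaller than `m`.
          by-exponent (zero  , n , m≡ , P∤n) =
            P∤n (subst (P ℕ.∣_) (trans nz (trans m≡ (ℕ.*-identityˡ n))) (norm-∣ π∣z))
          by-exponent (suc k , n , m≡ , P∤n) = ⊗-≢𝟎 (coefficient≢𝟎 π-prime π∤π̄ (suc k))
            (rec n<m Y 0<n (proj₁ w) (proj₂ w))
            (trans (sym (shell-sum-split π-prime π∤π̄ P∤n Y (suc k) (subst (λ j → IsShell j xs) m≡ X))) eq)
            where
            Y : IsShell n (shell-list n)
            Y = shell-list-isShell n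
            0<n : 0 ℕ.< n
            0<n = positive-factor (P ℕ.^ suc k) m≡
            w : ∃[ w ] norm w ≡ n
            w = peel π-prime (suc k) n z (trans nz m≡)
            n<m : n ℕ.< m
            n<m = subst (n ℕ.<_) (sym m≡) (m<n*m n (P ℕ.^ suc k) {{ℕ.>-nonZero 0<n}}
              (ℕ.<-≤-trans 1<norm (ℕ.m≤m*n P (P ℕ.^ k) {{ℕ.m^n≢0 P k {{norm-nonZero}}}})))

  shell-sum-real : ∀ {m xs} → IsShell m xs → conj (Σ⁴ xs) ≡ Σ⁴ xs
  shell-sum-real {m} {xs} X = trans (sym (Σ⁴-map-conj xs)) (Σ⁴-↭ (unique-↭
    (Unique.map⁺ (λ {x} {y} eq → trans (sym (conj-involutive x)) (trans (cong conj eq) (conj-involutive y))) (unique X))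
    (unique X) to from))
    where
    to : ∀ {z} → z ∈ List.map conj xs → z ∈ xs
    to z∈ with ∈-map⁻ conj z∈
    ... | w , w∈ , refl = complete X (trans (norm-conj w) (sound X w∈))
    from : ∀ {z} → z ∈ xs → z ∈ List.map conj xs
    from {z} z∈ = subst (_∈ List.map conj xs) (conj-involutive z)
      (∈-map⁺ conj (complete X (trans (norm-conj z) (sound X z∈))))

  re-shell-sum≢0 : ∀ {m xs} → IsShell m xs → 0 ℕ.< m → ∀ z → norm z ≡ m → re (Σ⁴ xs) ≢ ℤ.0ℤ
  re-shell-sum≢0 {m} {xs} X 0<m z nz re≡0 = shell-sum≢𝟎 m X 0<m z nz (real∧re≡0 (Σ⁴ xs) (shell-sum-real X) re≡0)
    where
    real∧re≡0 : ∀ s → conj s ≡ s → re s ≡ ℤ.0ℤ → s ≡ 𝟎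
    real∧re≡0 (gauss _ (+ 0))       _ refl = refl
    real∧re≡0 (gauss _ (+ suc _))   () _
    real∧re≡0 (gauss _ -[1+ _ ])    () _

open Gaussian

-- Embedding of the integers

⌜_⌝ : ℤ → ℚ
⌜ k ⌝ = k ℚ./ 1

toℚᵘ-⌜⌝ : ∀ k → toℚᵘ ⌜ k ⌝ ℚᵘ.≃ ℚᵘ.mkℚᵘ k 0
toℚᵘ-⌜⌝ k = ℚ.toℚᵘ-fromℚᵘ (ℚᵘ.mkℚᵘ k 0)

⌜⌝-+ : ∀ a b → ⌜ a ℤ.+ b ⌝ ≡ ⌜ a ⌝ ℚ.+ ⌜ b ⌝
⌜⌝-+ a b = ℚ.toℚᵘ-injective (begin
  toℚᵘ ⌜ a ℤ.+ b ⌝                       ≈⟨ toℚᵘ-⌜⌝ (a ℤ.+ b) ⟩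
  ℚᵘ.mkℚᵘ (a ℤ.+ b) 0                    ≈⟨ ℚᵘ.*≡* (solve 2 (λ a b → (a :+ b) :* con ℤ.1ℤ := (a :* con ℤ.1ℤ :+ b :* con ℤ.1ℤ) :* con ℤ.1ℤ) refl a b) ⟩
  ℚᵘ.mkℚᵘ a 0 ℚᵘ.+ ℚᵘ.mkℚᵘ b 0           ≈⟨ ℚᵘ.+-cong (toℚᵘ-⌜⌝ a) (toℚᵘ-⌜⌝ b) ⟨
  toℚᵘ ⌜ a ⌝ ℚᵘ.+ toℚᵘ ⌜ b ⌝             ≈⟨ ℚ.toℚᵘ-homo-+ ⌜ a ⌝ ⌜ b ⌝ ⟨
  toℚᵘ (⌜ a ⌝ ℚ.+ ⌜ b ⌝)                 ∎)
  where
  open ℚᵘ.≃-Reasoning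
  open ℤSolver.+-*-Solver using (solve; _:=_; _:+_; _:*_; con)

⌜⌝-* : ∀ a b → ⌜ a ℤ.* b ⌝ ≡ ⌜ a ⌝ ℚ.* ⌜ b ⌝
⌜⌝-* a b = ℚ.toℚᵘ-injective (begin
  toℚᵘ ⌜ a ℤ.* b ⌝                       ≈⟨ toℚᵘ-⌜⌝ (a ℤ.* b) ⟩
  ℚᵘ.mkℚᵘ a 0 ℚᵘ.* ℚᵘ.mkℚᵘ b 0           ≈⟨ ℚᵘ.*-cong (toℚᵘ-⌜⌝ a) (toℚᵘ-⌜⌝ b) ⟨
  toℚᵘ ⌜ a ⌝ ℚᵘ.* toℚᵘ ⌜ b ⌝             ≈⟨ ℚ.toℚᵘ-homo-* ⌜ a ⌝ ⌜ b ⌝ ⟨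
  toℚᵘ (⌜ a ⌝ ℚ.* ⌜ b ⌝)                 ∎)
  where
  open ℚᵘ.≃-Reasoning

⌜⌝-neg : ∀ a → ⌜ ℤ.- a ⌝ ≡ ℚ.- ⌜ a ⌝
⌜⌝-neg a = ℚ.toℚᵘ-injective (begin
  toℚᵘ ⌜ ℤ.- a ⌝        ≈⟨ toℚᵘ-⌜⌝ (ℤ.- a) ⟩
  ℚᵘ.- ℚᵘ.mkℚᵘ a 0      ≈⟨ ℚᵘ.-‿cong (toℚᵘ-⌜⌝ a) ⟨
  ℚᵘ.- toℚᵘ ⌜ a ⌝       ≈⟨ ℚ.toℚᵘ-homo‿- ⌜ a ⌝ ⟨
  toℚᵘ (ℚ.- ⌜ a ⌝)      ∎)
  where
  open ℚᵘ.≃-Reasoning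

⌜⌝-injective : ∀ {a b} → ⌜ a ⌝ ≡ ⌜ b ⌝ → a ≡ b
⌜⌝-injective {a} {b} eq with ℚ./-injective-≃ (ℚᵘ.mkℚᵘ a 0) (ℚᵘ.mkℚᵘ b 0) eq
... | ℚᵘ.*≡* e = trans (sym (ℤ.*-identityʳ a)) (trans e (ℤ.*-identityʳ b))

⌜⌝-mono-< : ∀ {a b} → a ℤ.< b → ⌜ a ⌝ ℚ.< ⌜ b ⌝
⌜⌝-mono-< {a} {b} a<b = ℚ.toℚᵘ-cancel-< (ℚᵘ.<-respˡ-≃ (ℚᵘ.≃-sym (toℚᵘ-⌜⌝ a)) (ℚᵘ.<-respʳ-≃ (ℚᵘ.≃-sym (toℚᵘ-⌜⌝ b))
  (ℚᵘ.*<* (subst₂ ℤ._<_ (sym (ℤ.*-identityʳ a)) (sym (ℤ.*-identityʳ b)) a<b))))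

⌜⌝-mono-≤ : ∀ {a b} → a ℤ.≤ b → ⌜ a ⌝ ℚ.≤ ⌜ b ⌝
⌜⌝-mono-≤ {a} {b} a≤b = ℚ.toℚᵘ-cancel-≤ (ℚᵘ.≤-respˡ-≃ (ℚᵘ.≃-sym (toℚᵘ-⌜⌝ a)) (ℚᵘ.≤-respʳ-≃ (ℚᵘ.≃-sym (toℚᵘ-⌜⌝ b))
  (ℚᵘ.*≤* (subst₂ ℤ._≤_ (sym (ℤ.*-identityʳ a)) (sym (ℤ.*-identityʳ b)) a≤b))))

↥≡*↧ : ∀ p → ⌜ ℚ.↥ p ⌝ ≡ p ℚ.* ⌜ ℚ.↧ p ⌝
↥≡*↧ p@record{} = ℚ.toℚᵘ-injective (begin
  toℚᵘ ⌜ ℚ.↥ p ⌝                         ≈⟨ toℚᵘ-⌜⌝ (ℚ.↥ p) ⟩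
  ℚᵘ.mkℚᵘ (ℚ.↥ p) 0                      ≈⟨ ℚᵘ.*≡* (solve 2 (λ a b → a :* (b :* con ℤ.1ℤ) := a :* b :* con ℤ.1ℤ) refl (ℚ.↥ p) (ℚ.↧ p)) ⟩
  toℚᵘ p ℚᵘ.* ℚᵘ.mkℚᵘ (ℚ.↧ p) 0          ≈⟨ ℚᵘ.*-cong (ℚᵘ.≃-refl {toℚᵘ p}) (toℚᵘ-⌜⌝ (ℚ.↧ p)) ⟨
  toℚᵘ p ℚᵘ.* toℚᵘ ⌜ ℚ.↧ p ⌝             ≈⟨ ℚ.toℚᵘ-homo-* p ⌜ ℚ.↧ p ⌝ ⟨
  toℚᵘ (p ℚ.* ⌜ ℚ.↧ p ⌝)                 ∎)
  where
  open ℚᵘ.≃-Reasoning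
  open ℤSolver.+-*-Solver using (solve; _:=_; _:+_; _:*_; con)

open ℚSolver.+-*-Solver using (solve; _:=_; _:+_; _:*_; _:-_; :-_; con)

-- If `g = a / d` with `a ≥ 1`, then `n = (k + 1) d` gives `g n = (k + 1) a > k`. The bound
-- `suc k ≤ n` later guarantees enough vertices for a polygon.
archimedean : ∀ k g → 0ℚ ℚ.< g → ∃[ n ] suc k ℕ.≤ n × ⌜ + k ⌝ ℚ.< g ℚ.* ⌜ + n ⌝
archimedean k (mkℚ (+ 0) _ _)    0<g with () ← ℚ.positive 0<g
archimedean k (mkℚ -[1+ _ ] _ _) 0<g with () ← ℚ.positive 0<g
archimedean k g@(mkℚ (+ suc a) d-1 _) 0<g = n , ℕ.m≤m*n (suc k) (suc d-1) , subst (⌜ + k ⌝ ℚ.<_) (begin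
    ⌜ + (suc k ℕ.* suc a) ⌝                ≡⟨ cong ⌜_⌝ (ℤ.pos-* (suc k) (suc a)) ⟩
    ⌜ + suc k ℤ.* + suc a ⌝                ≡⟨ ⌜⌝-* (+ suc k) (+ suc a) ⟩
    ⌜ + suc k ⌝ ℚ.* ⌜ + suc a ⌝            ≡⟨ cong (⌜ + suc k ⌝ ℚ.*_) (↥≡*↧ g) ⟩
    ⌜ + suc k ⌝ ℚ.* (g ℚ.* ⌜ + suc d-1 ⌝)  ≡⟨ solve 3 (λ a b c → a :* (b :* c) := b :* (a :* c)) refl ⌜ + suc k ⌝ g ⌜ + suc d-1 ⌝ ⟩
    g ℚ.* (⌜ + suc k ⌝ ℚ.* ⌜ + suc d-1 ⌝)  ≡⟨ cong (g ℚ.*_) (⌜⌝-* (+ suc k) (+ suc d-1)) ⟨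
    g ℚ.* ⌜ + suc k ℤ.* + suc d-1 ⌝        ≡⟨ cong (λ e → g ℚ.* ⌜ e ⌝) (ℤ.pos-* (suc k) (suc d-1)) ⟨
    g ℚ.* ⌜ + n ⌝                          ∎)
    (⌜⌝-mono-< (ℤ.+<+ (ℕ.m≤m*n (suc k) (suc a))))
  where
  open ≡-Reasoning
  n : ℕ
  n = suc k ℕ.* suc d-1

-- Constant real numbers

infix 4 _≐_

-- All terms equal `q`, not merely the limit: the operations act termwise, so this passes through
-- sums and products and reduces statements about polygons to ℚ.
record _≐_ (x : ℝ) (q : ℚ) : Set where
  constructor const
  field
    value : ∀ n → seq x n ≡ q

fromℚ-≐ : ∀ q → fromℚ q ≐ q
fromℚ-≐ q = const λ _ → refl

opaque
  unfolding _+_ _*_ -_ ∣_∣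

  +-≐ : ∀ {x y p q} → x ≐ p → y ≐ q → x + y ≐ p ℚ.+ q
  +-≐ (const f) (const g) = const λ n → cong₂ ℚ._+_ (f n) (g n)

  *-≐ : ∀ {x y p q} → x ≐ p → y ≐ q → x * y ≐ p ℚ.* q
  *-≐ (const f) (const g) = const λ n → cong₂ ℚ._*_ (f n) (g n)

  neg-≐ : ∀ {x p} → x ≐ p → - x ≐ ℚ.- p
  neg-≐ (const f) = const λ n → cong ℚ.-_ (f n)

-‿≐ : ∀ {x y p q} → x ≐ p → y ≐ q → x - y ≐ p ℚ.- q
-‿≐ f g = +-≐ f (neg-≐ g)

sum-≐ : ∀ {A : Set} {f : A → ℝ} {g : A → ℚ} → (∀ a → f a ≐ g a) →
        ∀ as → sum (List.map f as) ≐ List.foldr ℚ._+_ 0ℚ (List.map g as)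
sum-≐ f≐g []       = fromℚ-≐ 0ℚ
sum-≐ f≐g (a ∷ as) = +-≐ (f≐g a) (sum-≐ f≐g as)

pointwise⇒≃ : ∀ {x y} → (∀ n → seq x n ≡ seq y n) → x ≃ y
pointwise⇒≃ {x} {y} eq = mk≃ λ ε 0<ε → 0 , λ n _ → subst (ℚ._< ε)
  (sym (cong ℚ.∣_∣ (trans (cong (ℚ._- seq y n) (eq n)) (ℚ.+-inverseʳ (seq y n))))) 0<ε

≐⇒≃ : ∀ {x y p q} → x ≐ p → y ≐ q → p ≡ q → x ≃ y
≐⇒≃ (const f) (const g) p≡q = pointwise⇒≃ λ n → trans (f n) (trans p≡q (sym (g n)))

p<q⇒0<q-p : ∀ {p q} → p ℚ.< q → 0ℚ ℚ.< q ℚ.- p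
p<q⇒0<q-p {p} {q} p<q = subst (ℚ._< q ℚ.- p) (ℚ.+-inverseʳ p) (ℚ.+-monoˡ-< (ℚ.- p) p<q)

0<q-p⇒p<q : ∀ {p q} → 0ℚ ℚ.< q ℚ.- p → p ℚ.< q
0<q-p⇒p<q {p} {q} 0<q-p = subst₂ ℚ._<_ (ℚ.+-identityˡ p) (solve 2 (λ p q → q :- p :+ p := q) refl p q)
  (ℚ.+-monoˡ-< p 0<q-p)

p<p+q : ∀ p {q} → 0ℚ ℚ.< q → p ℚ.< p ℚ.+ q
p<p+q p {q} 0<q = subst (ℚ._< p ℚ.+ q) (ℚ.+-identityʳ p) (ℚ.+-monoʳ-< p 0<q)

midpoint< : ∀ {p q} → p ℚ.< q → p ℚ.+ ½ ℚ.* (q ℚ.- p) ℚ.< q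
midpoint< {p} {q} p<q = subst (p ℚ.+ ½ ℚ.* (q ℚ.- p) ℚ.<_)
  (solve 2 (λ p q → p :+ con ½ :* (q :- p) :+ con ½ :* (q :- p) := q) refl p q)
  (p<p+q (p ℚ.+ ½ ℚ.* (q ℚ.- p)) (half-pos (p<q⇒0<q-p p<q)))

≐⇒< : ∀ {x y p q} → x ≐ p → y ≐ q → p ℚ.< q → x < y
-- `apart` is strict, so the gap is half of `q - p` and not all of it.
≐⇒< {p = p} {q} (const f) (const g) p<q = mk< (½ ℚ.* (q ℚ.- p)) (half-pos (p<q⇒0<q-p p<q)) 0
  λ n _ → subst₂ (λ a b → a ℚ.+ ½ ℚ.* (q ℚ.- p) ℚ.< b) (sym (f n)) (sym (g n)) (midpoint< p<q)

≐⇒≤ : ∀ {x y p q} → x ≐ p → y ≐ q → p ℚ.≤ q → x ≤ y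
≐⇒≤ {p = p} {q} (const f) (const g) p≤q (mk< gap 0<gap N apart) = ℚ.<-irrefl refl (ℚ.<-≤-trans q<p p≤q)
  where
  q<p : q ℚ.< p
  q<p = subst₂ ℚ._<_ (g N) (f N) (ℚ.<-trans (p<p+q _ 0<gap) (apart N ℕ.≤-refl))

-- Identities for points of the plane

2ℚ 4ℚ : ℚ
2ℚ = ⌜ + 2 ⌝
4ℚ = ⌜ + 4 ⌝

ℚ² : Set
ℚ² = ℚ × ℚ

-- For unit vectors these are the sine and the cosine of the angle from the first to the second; the
-- identities below are the double-angle and addition formulas in this form.
detℚ dotℚ : ℚ² → ℚ² → ℚ
detℚ (x , y) (x′ , y′) = x ℚ.* y′ ℚ.- y ℚ.* x′
dotℚ (x , y) (x′ , y′) = x ℚ.* x′ ℚ.+ y ℚ.* y′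

-- `_⊡_` is complex multiplication; with a unit on the left it is a rotation.
_-ℚ²_ _⊡_ : ℚ² → ℚ² → ℚ²
(x , y) -ℚ² (x′ , y′) = x ℚ.- x′ , y ℚ.- y′
(x , y) ⊡ (x′ , y′) = x ℚ.* x′ ℚ.- y ℚ.* y′ , x ℚ.* y′ ℚ.+ y ℚ.* x′

_·ℚ²_ : ℚ → ℚ² → ℚ²
c ·ℚ² (x , y) = c ℚ.* x , c ℚ.* y

Unit : ℚ² → Set
Unit v = dotℚ v v ≡ 1ℚ

dot-⊡ : ∀ u v w → dotℚ (u ⊡ v) (u ⊡ w) ≡ dotℚ u u ℚ.* dotℚ v w
dot-⊡ (s , t) (a , b) (c , d) = solve 6 (λ s t a b c d →
  (s :* a :- t :* b) :* (s :* c :- t :* d) :+ (s :* b :+ t :* a) :* (s :* d :+ t :* c)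
  := (s :* s :+ t :* t) :* (a :* c :+ b :* d)) refl s t a b c d

det-⊡ : ∀ u v w → detℚ (u ⊡ v) (u ⊡ w) ≡ dotℚ u u ℚ.* detℚ v w
det-⊡ (s , t) (a , b) (c , d) = solve 6 (λ s t a b c d →
  (s :* a :- t :* b) :* (s :* d :+ t :* c) :- (s :* b :+ t :* a) :* (s :* c :- t :* d)
  := (s :* s :+ t :* t) :* (a :* d :- b :* c)) refl s t a b c d

det-square : ∀ v w → detℚ (v ⊡ v) (w ⊡ w) ≡ 2ℚ ℚ.* (detℚ v w ℚ.* dotℚ v w)
det-square (a , b) (c , d) = solve 4 (λ a b c d →
  (a :* a :- b :* b) :* (c :* d :+ d :* c) :- (a :* b :+ b :* a) :* (c :* c :- d :* d)
  := con 2ℚ :* ((a :* d :- b :* c) :* (a :* c :+ b :* d))) refl a b c d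

dot-square : ∀ v w → dotℚ (v ⊡ v) (w ⊡ w) ≡ dotℚ v w ℚ.* dotℚ v w ℚ.- detℚ v w ℚ.* detℚ v w
dot-square (a , b) (c , d) = solve 4 (λ a b c d →
  (a :* a :- b :* b) :* (c :* c :- d :* d) :+ (a :* b :+ b :* a) :* (c :* d :+ d :* c)
  := (a :* c :+ b :* d) :* (a :* c :+ b :* d) :- (a :* d :- b :* c) :* (a :* d :- b :* c)) refl a b c d

det²+dot² : ∀ v w → detℚ v w ℚ.* detℚ v w ℚ.+ dotℚ v w ℚ.* dotℚ v w ≡ dotℚ v v ℚ.* dotℚ w w
det²+dot² (a , b) (c , d) = solve 4 (λ a b c d →
  (a :* d :- b :* c) :* (a :* d :- b :* c) :+ (a :* c :+ b :* d) :* (a :* c :+ b :* d)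
  := (a :* a :+ b :* b) :* (c :* c :+ d :* d)) refl a b c d

-- The addition formula for the sine; the factor `dotℚ v v` makes it hold for vectors of any length.
det-addition : ∀ u v w → dotℚ v v ℚ.* detℚ u w ≡ detℚ u v ℚ.* dotℚ v w ℚ.+ dotℚ u v ℚ.* detℚ v w
det-addition (a , b) (c , d) (e , f) = solve 6 (λ a b c d e f →
  (c :* c :+ d :* d) :* (a :* f :- b :* e)
  := (a :* d :- b :* c) :* (c :* e :+ d :* f) :+ (a :* c :+ b :* d) :* (c :* f :- d :* e)) refl a b c d e f

dot-addition : ∀ u v w → dotℚ v v ℚ.* dotℚ u w ≡ dotℚ u v ℚ.* dotℚ v w ℚ.- detℚ u v ℚ.* detℚ v w
dot-addition (a , b) (c , d) (e , f) = solve 6 (λ a b c d e f →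
  (c :* c :+ d :* d) :* (a :* e :+ b :* f)
  := (a :* c :+ b :* d) :* (c :* e :+ d :* f) :- (a :* d :- b :* c) :* (c :* f :- d :* e)) refl a b c d e f

det-triangle : ∀ u v w → detℚ (v -ℚ² u) (w -ℚ² u) ≡ detℚ v w ℚ.+ detℚ u v ℚ.- detℚ u w
det-triangle (a , b) (c , d) (e , f) = solve 6 (λ a b c d e f →
  (c :- a) :* (f :- b) :- (d :- b) :* (e :- a)
  := (c :* f :- d :* e) :+ (a :* d :- b :* c) :- (a :* f :- b :* e)) refl a b c d e f

dot-difference : ∀ v w → dotℚ (w -ℚ² v) (w -ℚ² v) ≡ dotℚ v v ℚ.+ dotℚ w w ℚ.- 2ℚ ℚ.* dotℚ v w
dot-difference (a , b) (c , d) = solve 4 (λ a b c d →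
  (c :- a) :* (c :- a) :+ (d :- b) :* (d :- b)
  := (a :* a :+ b :* b) :+ (c :* c :+ d :* d) :- con 2ℚ :* (a :* c :+ b :* d)) refl a b c d

det-· : ∀ c d v w → detℚ (c ·ℚ² v) (d ·ℚ² w) ≡ c ℚ.* d ℚ.* detℚ v w
det-· c d (x , y) (x′ , y′) = solve 6 (λ c d x y x′ y′ →
  (c :* x) :* (d :* y′) :- (c :* y) :* (d :* x′) := c :* d :* (x :* y′ :- y :* x′)) refl c d x y x′ y′

dot-· : ∀ c d v w → dotℚ (c ·ℚ² v) (d ·ℚ² w) ≡ c ℚ.* d ℚ.* dotℚ v w
dot-· c d (x , y) (x′ , y′) = solve 6 (λ c d x y x′ y′ →
  (c :* x) :* (d :* x′) :+ (c :* y) :* (d :* y′) := c :* d :* (x :* x′ :+ y :* y′)) refl c d x y x′ y′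

module _ {u v : ℚ²} (u-unit : Unit u) (v-unit : Unit v) where

  ⊡-unit : Unit (u ⊡ v)
  ⊡-unit = trans (dot-⊡ u v v) (cong₂ ℚ._*_ u-unit v-unit)

  sin²+cos² : detℚ u v ℚ.* detℚ u v ℚ.+ dotℚ u v ℚ.* dotℚ u v ≡ 1ℚ
  sin²+cos² = trans (det²+dot² u v) (cong₂ ℚ._*_ u-unit v-unit)

-- A chord of central angle 2θ has length 2 sin θ. Between the squares of `v` and `w` the central
-- angle is twice the one between `v` and `w`, so the length is rational.
chord² : ∀ {r v w} → Unit r → Unit v → Unit w →
  let e = (r ⊡ (w ⊡ w)) -ℚ² (r ⊡ (v ⊡ v)) in (2ℚ ℚ.* detℚ v w) ℚ.* (2ℚ ℚ.* detℚ v w) ≡ dotℚ e e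
chord² {r} {v} {w} r! v! w! = sym (begin
  dotℚ (W -ℚ² V) (W -ℚ² V)                         ≡⟨ dot-difference V W ⟩
  dotℚ V V ℚ.+ dotℚ W W ℚ.- 2ℚ ℚ.* dotℚ V W        ≡⟨ cong₂ (λ a b → a ℚ.- 2ℚ ℚ.* b)
                                                       (trans (cong₂ ℚ._+_ (unit {v} v!) (unit {w} w!)) (sym (cong₂ ℚ._+_ (sin²+cos² {v} {w} v! w!) (sin²+cos² {v} {w} v! w!))))
                                                       (trans (dot-⊡ r (v ⊡ v) (w ⊡ w)) (cong₂ ℚ._*_ r! (dot-square v w))) ⟩
  (A ℚ.* A ℚ.+ B ℚ.* B) ℚ.+ (A ℚ.* A ℚ.+ B ℚ.* B) ℚ.- 2ℚ ℚ.* (1ℚ ℚ.* (B ℚ.* B ℚ.- A ℚ.* A))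
                                                   ≡⟨ solve 2 (λ A B → (A :* A :+ B :* B) :+ (A :* A :+ B :* B) :- con 2ℚ :* (con 1ℚ :* (B :* B :- A :* A))
                                                                  := (con 2ℚ :* A) :* (con 2ℚ :* A)) refl A B ⟩
  (2ℚ ℚ.* A) ℚ.* (2ℚ ℚ.* A)                        ∎)
  where
  open ≡-Reasoning
  V W : ℚ²
  V = r ⊡ (v ⊡ v)
  W = r ⊡ (w ⊡ w)
  A B : ℚ
  A = detℚ v w
  B = dotℚ v w
  unit : ∀ {z} → Unit z → Unit (r ⊡ (z ⊡ z))
  unit {z} z! = ⊡-unit {r} {z ⊡ z} r! (⊡-unit {z} {z} z! z!)

det-rotated-squares : ∀ {r} v w → Unit r → detℚ (r ⊡ (v ⊡ v)) (r ⊡ (w ⊡ w)) ≡ 2ℚ ℚ.* (detℚ v w ℚ.* dotℚ v w)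
det-rotated-squares {r} v w r! = trans (det-⊡ r (v ⊡ v) (w ⊡ w))
  (trans (cong₂ ℚ._*_ r! (det-square v w)) (ℚ.*-identityˡ _))

-- The vertices are squares, so the determinants on the right are the sines of the angles of the triangle.
inscribed-area : ∀ {r u v w} → Unit r → Unit u → Unit v → Unit w →
  detℚ ((r ⊡ (v ⊡ v)) -ℚ² (r ⊡ (u ⊡ u))) ((r ⊡ (w ⊡ w)) -ℚ² (r ⊡ (u ⊡ u)))
  ≡ 4ℚ ℚ.* (detℚ u v ℚ.* detℚ v w ℚ.* detℚ u w)
inscribed-area {r} {u} {v} {w} r! u! v! w! = begin
  detℚ (V -ℚ² U) (W -ℚ² U)                                          ≡⟨ det-triangle U V W ⟩
  detℚ V W ℚ.+ detℚ U V ℚ.- detℚ U W                                ≡⟨ cong₂ ℚ._-_ (cong₂ ℚ._+_ (det-rotated-squares {r} v w r!) (det-rotated-squares {r} u v r!)) (det-rotated-squares {r} u w r!) ⟩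
  2ℚ ℚ.* (C ℚ.* E) ℚ.+ 2ℚ ℚ.* (A ℚ.* B) ℚ.- 2ℚ ℚ.* (detℚ u w ℚ.* dotℚ u w)
    ≡⟨ cong₂ (λ x y → 2ℚ ℚ.* (C ℚ.* E) ℚ.+ 2ℚ ℚ.* (A ℚ.* B) ℚ.- 2ℚ ℚ.* (x ℚ.* y)) det-uw dot-uw ⟩
  2ℚ ℚ.* (C ℚ.* E) ℚ.+ 2ℚ ℚ.* (A ℚ.* B) ℚ.- 2ℚ ℚ.* ((A ℚ.* E ℚ.+ B ℚ.* C) ℚ.* (B ℚ.* E ℚ.- A ℚ.* C))
    -- Inserting sin² + cos² = 1 in the first two terms makes all terms homogeneous of degree 4, and
    -- the claim becomes a polynomial identity.
    ≡⟨ cong₂ (λ x y → x ℚ.+ y ℚ.- 2ℚ ℚ.* ((A ℚ.* E ℚ.+ B ℚ.* C) ℚ.* (B ℚ.* E ℚ.- A ℚ.* C))) (times-1 (C ℚ.* E) (sin²+cos² {u} {v} u! v!)) (times-1 (A ℚ.* B) (sin²+cos² {v} {w} v! w!)) ⟩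
  2ℚ ℚ.* (C ℚ.* E ℚ.* (A ℚ.* A ℚ.+ B ℚ.* B)) ℚ.+ 2ℚ ℚ.* (A ℚ.* B ℚ.* (C ℚ.* C ℚ.+ E ℚ.* E)) ℚ.- 2ℚ ℚ.* ((A ℚ.* E ℚ.+ B ℚ.* C) ℚ.* (B ℚ.* E ℚ.- A ℚ.* C))
    ≡⟨ solve 4 (λ A B C E → con 2ℚ :* (C :* E :* (A :* A :+ B :* B)) :+ con 2ℚ :* (A :* B :* (C :* C :+ E :* E)) :- con 2ℚ :* ((A :* E :+ B :* C) :* (B :* E :- A :* C))
                          := con 4ℚ :* (A :* C :* (A :* E :+ B :* C))) refl A B C E ⟩
  4ℚ ℚ.* (A ℚ.* C ℚ.* (A ℚ.* E ℚ.+ B ℚ.* C))                        ≡⟨ cong (λ x → 4ℚ ℚ.* (A ℚ.* C ℚ.* x)) det-uw ⟨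
  4ℚ ℚ.* (A ℚ.* C ℚ.* detℚ u w)                                     ∎
  where
  open ≡-Reasoning
  U V W : ℚ²
  U = r ⊡ (u ⊡ u)
  V = r ⊡ (v ⊡ v)
  W = r ⊡ (w ⊡ w)
  A B C E : ℚ
  A = detℚ u v
  B = dotℚ u v
  C = detℚ v w
  E = dotℚ v w
  det-uw : detℚ u w ≡ A ℚ.* E ℚ.+ B ℚ.* C
  det-uw = trans (sym (trans (cong (ℚ._* detℚ u w) v!) (ℚ.*-identityˡ _))) (det-addition u v w)
  dot-uw : dotℚ u w ≡ B ℚ.* E ℚ.- A ℚ.* C
  dot-uw = trans (sym (trans (cong (ℚ._* dotℚ u w) v!) (ℚ.*-identityˡ _))) (dot-addition u v w)
  times-1 : ∀ x {y} → y ≡ 1ℚ → 2ℚ ℚ.* x ≡ 2ℚ ℚ.* (x ℚ.* y)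
  times-1 x y≡1 = cong (2ℚ ℚ.*_) (sym (trans (cong (x ℚ.*_) y≡1) (ℚ.*-identityʳ x)))

-- Polygons with rational vertices

*-nonneg : ∀ {p q} → 0ℚ ℚ.≤ p → 0ℚ ℚ.≤ q → 0ℚ ℚ.≤ p ℚ.* q
*-nonneg {p} {q} 0≤p 0≤q = ℚ.nonNegative⁻¹ (p ℚ.* q) {{ℚ.nonNeg*nonNeg⇒nonNeg p {{ℚ.nonNegative 0≤p}} q {{ℚ.nonNegative 0≤q}}}}

0≤p*p : ∀ p → 0ℚ ℚ.≤ p ℚ.* p
0≤p*p p with ℚ.≤-total 0ℚ p
... | inj₁ 0≤p = *-nonneg 0≤p 0≤p
... | inj₂ p≤0 = subst (0ℚ ℚ.≤_) (solve 1 (λ p → :- p :* :- p := p :* p) refl p)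
                   (*-nonneg (ℚ.neg-antimono-≤ p≤0) (ℚ.neg-antimono-≤ p≤0))

+-nonneg : ∀ {p q} → 0ℚ ℚ.≤ p → 0ℚ ℚ.≤ q → 0ℚ ℚ.≤ p ℚ.+ q
+-nonneg = ℚ.+-mono-≤

+-pos-nonneg : ∀ {p q} → 0ℚ ℚ.< p → 0ℚ ℚ.≤ q → 0ℚ ℚ.< p ℚ.+ q
+-pos-nonneg = ℚ.+-mono-<-≤

squared-norm : ℚ² → ℚ
squared-norm b = dotℚ b b

-- For nonzero `b` this is `b / b̄`, the rational parametrization of the circle; it doubles the
-- angle of `b`.
on-circle : ℚ² → ℚ²
on-circle b = recipℚ (squared-norm b) ·ℚ² (b ⊡ b)

module _ {b : ℚ²} (0<∣b∣² : 0ℚ ℚ.< squared-norm b) where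

  on-circle-unit : Unit (on-circle b)
  on-circle-unit = begin
    dotℚ (c ·ℚ² (b ⊡ b)) (c ·ℚ² (b ⊡ b))     ≡⟨ dot-· c c (b ⊡ b) (b ⊡ b) ⟩
    c ℚ.* c ℚ.* dotℚ (b ⊡ b) (b ⊡ b)         ≡⟨ cong (c ℚ.* c ℚ.*_) (dot-⊡ b b b) ⟩
    c ℚ.* c ℚ.* (D ℚ.* D)                    ≡⟨ solve 2 (λ c D → c :* c :* (D :* D) := (D :* c) :* (D :* c)) refl c D ⟩
    (D ℚ.* c) ℚ.* (D ℚ.* c)                  ≡⟨ cong₂ ℚ._*_ (recipℚ-inverse D 0<∣b∣²) (recipℚ-inverse D 0<∣b∣²) ⟩
    1ℚ                                       ∎
    where
    open ≡-Reasoning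
    D c : ℚ
    D = squared-norm b
    c = recipℚ D

recipℚ-pos : ∀ {p} → 0ℚ ℚ.< p → 0ℚ ℚ.< recipℚ p
recipℚ-pos {p} 0<p = ℚ.*-cancelˡ-<-nonNeg p {{ℚ.nonNegative (ℚ.<⇒≤ 0<p)}}
  (subst₂ ℚ._<_ (sym (ℚ.*-zeroʳ p)) (sym (recipℚ-inverse p 0<p)) (ℚ.positive⁻¹ 1ℚ))

det-on-circle : ∀ a b → detℚ (on-circle a) (on-circle b) ≡
  recipℚ (squared-norm a) ℚ.* recipℚ (squared-norm b) ℚ.* (2ℚ ℚ.* (detℚ a b ℚ.* dotℚ a b))
det-on-circle a b = trans (det-· (recipℚ (squared-norm a)) (recipℚ (squared-norm b)) (a ⊡ a) (b ⊡ b))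
  (cong (recipℚ (squared-norm a) ℚ.* recipℚ (squared-norm b) ℚ.*_) (det-square a b))

dot-on-circle : ∀ a b → dotℚ (on-circle a) (on-circle b) ≡
  recipℚ (squared-norm a) ℚ.* recipℚ (squared-norm b) ℚ.* (dotℚ a b ℚ.* dotℚ a b ℚ.- detℚ a b ℚ.* detℚ a b)
dot-on-circle a b = trans (dot-· (recipℚ (squared-norm a)) (recipℚ (squared-norm b)) (a ⊡ a) (b ⊡ b))
  (cong (recipℚ (squared-norm a) ℚ.* recipℚ (squared-norm b) ℚ.*_) (dot-square a b))

-- For nonzero `x` the two points are -1 and 1: the half-angle path ends opposite its start, and
-- squaring closes it.
antipodal : ∀ x → on-circle (0ℚ , x) ⊡ on-circle (0ℚ , x) ≡ on-circle (x , 0ℚ) ⊡ on-circle (x , 0ℚ)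
antipodal x = cong₂ _,_
  (trans (cong (λ c → (c ℚ.* (0ℚ ℚ.* 0ℚ ℚ.- x ℚ.* x)) ℚ.* (c ℚ.* (0ℚ ℚ.* 0ℚ ℚ.- x ℚ.* x))
                    ℚ.- (c ℚ.* (0ℚ ℚ.* x ℚ.+ x ℚ.* 0ℚ)) ℚ.* (c ℚ.* (0ℚ ℚ.* x ℚ.+ x ℚ.* 0ℚ))) c≡d)
    (solve 2 (λ c x → (c :* (con 0ℚ :* con 0ℚ :- x :* x)) :* (c :* (con 0ℚ :* con 0ℚ :- x :* x))
                    :- (c :* (con 0ℚ :* x :+ x :* con 0ℚ)) :* (c :* (con 0ℚ :* x :+ x :* con 0ℚ))
                    := (c :* (x :* x :- con 0ℚ :* con 0ℚ)) :* (c :* (x :* x :- con 0ℚ :* con 0ℚ))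
                    :- (c :* (x :* con 0ℚ :+ con 0ℚ :* x)) :* (c :* (x :* con 0ℚ :+ con 0ℚ :* x))) refl d x))
  (trans (cong (λ c → (c ℚ.* (0ℚ ℚ.* 0ℚ ℚ.- x ℚ.* x)) ℚ.* (c ℚ.* (0ℚ ℚ.* x ℚ.+ x ℚ.* 0ℚ))
                    ℚ.+ (c ℚ.* (0ℚ ℚ.* x ℚ.+ x ℚ.* 0ℚ)) ℚ.* (c ℚ.* (0ℚ ℚ.* 0ℚ ℚ.- x ℚ.* x))) c≡d)
    (solve 2 (λ c x → (c :* (con 0ℚ :* con 0ℚ :- x :* x)) :* (c :* (con 0ℚ :* x :+ x :* con 0ℚ))
                    :+ (c :* (con 0ℚ :* x :+ x :* con 0ℚ)) :* (c :* (con 0ℚ :* con 0ℚ :- x :* x))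
                    := (c :* (x :* x :- con 0ℚ :* con 0ℚ)) :* (c :* (x :* con 0ℚ :+ con 0ℚ :* x))
                    :+ (c :* (x :* con 0ℚ :+ con 0ℚ :* x)) :* (c :* (x :* x :- con 0ℚ :* con 0ℚ))) refl d x))
  where
  d : ℚ
  d = recipℚ (x ℚ.* x ℚ.+ 0ℚ ℚ.* 0ℚ)
  c≡d : recipℚ (0ℚ ℚ.* 0ℚ ℚ.+ x ℚ.* x) ≡ d
  c≡d = cong recipℚ (ℚ.+-comm (0ℚ ℚ.* 0ℚ) (x ℚ.* x))

3ℚ 8ℚ ¼ : ℚ
3ℚ = ⌜ + 3 ⌝
8ℚ = ⌜ + 8 ⌝
¼ = + 1 ℚ./ 4

-- The vertices of the polygon are the squares of w i = (p + q √-1)² / (p² + q²) with (p , q) = (n - i , i): they go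
-- once round the circle as i runs from 0 to n, and passing through the half-angle points w i makes the lengths of
-- the sides rational.
module Vertices (n : ℕ) (3≤n : 3 ℕ.≤ n) where

  ν : ℚ
  ν = ⌜ + n ⌝

  b w : ℕ → ℚ²
  b i = ν ℚ.- ⌜ + i ⌝ , ⌜ + i ⌝
  w i = on-circle (b i)

  0≤ν-3 : 0ℚ ℚ.≤ ν ℚ.- 3ℚ
  0≤ν-3 = subst (ℚ._≤ ν ℚ.- 3ℚ) (ℚ.+-inverseʳ 3ℚ) (ℚ.+-monoˡ-≤ (ℚ.- 3ℚ) (⌜⌝-mono-≤ (ℤ.+≤+ 3≤n)))

  0<ν : 0ℚ ℚ.< ν
  0<ν = ⌜⌝-mono-< {ℤ.0ℤ} {+ n} (ℤ.+<+ (ℕ.≤-trans (ℕ.s≤s ℕ.z≤n) 3≤n))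

  -- This is `(p - q)²`. As `p + q = ν`, one has `p² + q² = (ν² + (p - q)²) / 2`, which bounds the
  -- squared norm of `b i` below by `ν² / 2`.
  excess : ℕ → ℚ
  excess i = (ν ℚ.- ⌜ + i ⌝ ℚ.- ⌜ + i ⌝) ℚ.* (ν ℚ.- ⌜ + i ⌝ ℚ.- ⌜ + i ⌝)

  squared-norm-b : ∀ i → squared-norm (b i) ≡ ½ ℚ.* (ν ℚ.* ν ℚ.+ excess i)
  squared-norm-b i = solve 2 (λ ν a → (ν :- a) :* (ν :- a) :+ a :* a := con ½ :* (ν :* ν :+ (ν :- a :- a) :* (ν :- a :- a))) refl ν ⌜ + i ⌝

  0<∣b∣² : ∀ i → 0ℚ ℚ.< squared-norm (b i)
  0<∣b∣² i = subst (0ℚ ℚ.<_) (sym (squared-norm-b i)) (half-pos (+-pos-nonneg (*-pos 0<ν 0<ν) (0≤p*p (ν ℚ.- ⌜ + i ⌝ ℚ.- ⌜ + i ⌝))))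

  w-unit : ∀ i → Unit (w i)
  w-unit i = on-circle-unit {b i} (0<∣b∣² i)

  c : ℕ → ℚ
  c i = recipℚ (squared-norm (b i))

  0<c : ∀ i → 0ℚ ℚ.< c i
  0<c i = recipℚ-pos (0<∣b∣² i)

  w-closed : w n ⊡ w n ≡ w 0 ⊡ w 0
  w-closed = trans (cong (λ z → on-circle z ⊡ on-circle z) (cong (_, ν) (ℚ.+-inverseʳ ν)))
    (trans (antipodal ν) (cong (λ z → on-circle z ⊡ on-circle z) (cong (_, 0ℚ) (sym (ℚ.+-identityʳ ν)))))

  det-b : ∀ i j → detℚ (b i) (b j) ≡ ν ℚ.* (⌜ + j ⌝ ℚ.- ⌜ + i ⌝)
  det-b i j = solve 3 (λ ν a b → (ν :- a) :* b :- a :* (ν :- b) := ν :* (b :- a)) refl ν ⌜ + i ⌝ ⌜ + j ⌝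

  0<det-b : ∀ {i j} → i ℕ.< j → 0ℚ ℚ.< detℚ (b i) (b j)
  0<det-b {i} {j} i<j = subst (0ℚ ℚ.<_) (sym (det-b i j)) (*-pos 0<ν (p<q⇒0<q-p (⌜⌝-mono-< (ℤ.+<+ i<j))))

  0<det-w : ∀ {i j} → 0ℚ ℚ.< detℚ (b i) (b j) → 0ℚ ℚ.< dotℚ (b i) (b j) → 0ℚ ℚ.< detℚ (w i) (w j)
  0<det-w {i} {j} 0<det 0<dot = subst (0ℚ ℚ.<_) (sym (det-on-circle (b i) (b j)))
    (*-pos (*-pos (0<c i) (0<c j)) (*-pos (ℚ.positive⁻¹ 2ℚ) (*-pos 0<det 0<dot)))

  -- With `j < n` both first coordinates are positive, so `b i` and `b j` are less than a right
  -- angle apart, and `w i` and `w j` less than a half turn.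
  det-w-positive : ∀ {i j} → i ℕ.< j → j ℕ.< n → 0ℚ ℚ.< detℚ (w i) (w j)
  det-w-positive {i} {j} i<j j<n = 0<det-w {i} {j} (0<det-b i<j)
    (+-pos-nonneg (*-pos (p<q⇒0<q-p (⌜⌝-mono-< (ℤ.+<+ (ℕ.<-trans i<j j<n)))) (p<q⇒0<q-p (⌜⌝-mono-< (ℤ.+<+ j<n))))
                  (*-nonneg (0≤⌜⌝ i) (0≤⌜⌝ j)))
    where
    0≤⌜⌝ : ∀ k → 0ℚ ℚ.≤ ⌜ + k ⌝
    0≤⌜⌝ k = ⌜⌝-mono-≤ {ℤ.0ℤ} {+ k} (ℤ.+≤+ ℕ.z≤n)

  ⌜suc⌝ : ∀ i → ⌜ + suc i ⌝ ≡ ⌜ + i ⌝ ℚ.+ 1ℚ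
  ⌜suc⌝ i = trans (cong ⌜_⌝ (ℤ.+-comm ℤ.1ℤ (+ i))) (⌜⌝-+ (+ i) ℤ.1ℤ)

  det-b-suc : ∀ i → detℚ (b i) (b (suc i)) ≡ ν
  det-b-suc i = trans (det-b i (suc i)) (trans (cong (λ e → ν ℚ.* (e ℚ.- ⌜ + i ⌝)) (⌜suc⌝ i))
    (solve 2 (λ ν a → ν :* (a :+ con 1ℚ :- a) := ν) refl ν ⌜ + i ⌝))

  -- Polarization: consecutive points differ by (-1, 1), of squared norm 2.
  dot-b-suc : ∀ i → dotℚ (b i) (b (suc i)) ≡ ½ ℚ.* (squared-norm (b i) ℚ.+ squared-norm (b (suc i)) ℚ.- 2ℚ)
  dot-b-suc i = subst (λ e → dotℚ (b i) (ν ℚ.- e , e) ≡ ½ ℚ.* (squared-norm (b i) ℚ.+ squared-norm (ν ℚ.- e , e) ℚ.- 2ℚ)) (sym (⌜suc⌝ i))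
    (solve 2 (λ ν a → (ν :- a) :* (ν :- (a :+ con 1ℚ)) :+ a :* (a :+ con 1ℚ)
      := con ½ :* ((ν :- a) :* (ν :- a) :+ a :* a :+ ((ν :- (a :+ con 1ℚ)) :* (ν :- (a :+ con 1ℚ)) :+ (a :+ con 1ℚ) :* (a :+ con 1ℚ)) :- con 2ℚ)) refl ν ⌜ + i ⌝)

  -- The source of `3 ≤ n`. The determinant of consecutive points is `ν`, so this says that their
  -- angle is below 45°. Angles double twice on the way to the vertices, and each arc is shorter
  -- than a half circle.
  ν<dot-b-suc : ∀ i → ν ℚ.< dotℚ (b i) (b (suc i))
  ν<dot-b-suc i = 0<q-p⇒p<q (subst (0ℚ ℚ.<_) (sym difference) (*-pos (ℚ.positive⁻¹ ¼)
    (+-pos-nonneg (ℚ.positive⁻¹ 2ℚ) (+-nonneg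
      (+-nonneg (0≤p*p (ν ℚ.- ⌜ + i ⌝ ℚ.- ⌜ + i ⌝)) (0≤p*p (ν ℚ.- ⌜ + suc i ⌝ ℚ.- ⌜ + suc i ⌝)))
      (*-nonneg (ℚ.<⇒≤ (*-pos (ℚ.positive⁻¹ 2ℚ) (+-pos-nonneg (ℚ.positive⁻¹ 1ℚ) (ℚ.<⇒≤ 0<ν)))) 0≤ν-3)))))
    where
    open ≡-Reasoning
    difference : dotℚ (b i) (b (suc i)) ℚ.- ν ≡
      ¼ ℚ.* (2ℚ ℚ.+ (excess i ℚ.+ excess (suc i) ℚ.+ 2ℚ ℚ.* (1ℚ ℚ.+ ν) ℚ.* (ν ℚ.- 3ℚ)))
    difference = begin
      dotℚ (b i) (b (suc i)) ℚ.- ν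
        ≡⟨ cong (ℚ._- ν) (dot-b-suc i) ⟩
      ½ ℚ.* (squared-norm (b i) ℚ.+ squared-norm (b (suc i)) ℚ.- 2ℚ) ℚ.- ν
        ≡⟨ cong₂ (λ x y → ½ ℚ.* (x ℚ.+ y ℚ.- 2ℚ) ℚ.- ν) (squared-norm-b i) (squared-norm-b (suc i)) ⟩
      ½ ℚ.* (½ ℚ.* (ν ℚ.* ν ℚ.+ excess i) ℚ.+ ½ ℚ.* (ν ℚ.* ν ℚ.+ excess (suc i)) ℚ.- 2ℚ) ℚ.- ν
        ≡⟨ solve 3 (λ ν x y → con ½ :* (con ½ :* (ν :* ν :+ x) :+ con ½ :* (ν :* ν :+ y) :- con 2ℚ) :- ν
             := con ¼ :* (con 2ℚ :+ (x :+ y :+ con 2ℚ :* (con 1ℚ :+ ν) :* (ν :- con 3ℚ)))) refl ν (excess i) (excess (suc i)) ⟩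
      ¼ ℚ.* (2ℚ ℚ.+ (excess i ℚ.+ excess (suc i) ℚ.+ 2ℚ ℚ.* (1ℚ ℚ.+ ν) ℚ.* (ν ℚ.- 3ℚ))) ∎

  det-w-suc-positive : ∀ i → 0ℚ ℚ.< detℚ (w i) (w (suc i))
  det-w-suc-positive i = 0<det-w {i} {suc i} (0<det-b {i} (ℕ.n<1+n i)) (ℚ.<-trans 0<ν (ν<dot-b-suc i))

  dot-w-suc-positive : ∀ i → 0ℚ ℚ.< dotℚ (w i) (w (suc i))
  dot-w-suc-positive i = subst (0ℚ ℚ.<_) (sym (trans (dot-on-circle (b i) (b (suc i))) (cong (c i ℚ.* c (suc i) ℚ.*_) factored)))
    (*-pos (*-pos (0<c i) (0<c (suc i))) (*-pos (p<q⇒0<q-p (ν<dot-b-suc i)) (+-pos-nonneg (ℚ.<-trans 0<ν (ν<dot-b-suc i)) (ℚ.<⇒≤ 0<ν))))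
    where
    o : ℚ
    o = dotℚ (b i) (b (suc i))
    factored : o ℚ.* o ℚ.- detℚ (b i) (b (suc i)) ℚ.* detℚ (b i) (b (suc i)) ≡ (o ℚ.- ν) ℚ.* (o ℚ.+ ν)
    factored = trans (cong (λ d → o ℚ.* o ℚ.- d ℚ.* d) (det-b-suc i))
      (solve 2 (λ o ν → o :* o :- ν :* ν := (o :- ν) :* (o :+ ν)) refl o ν)

  sideℚ : ℕ → ℚ
  sideℚ i = 2ℚ ℚ.* detℚ (w i) (w (suc i))

  -- The mesh is O(1 / n). From `D C = D′ C′ = 1` and the value of the inner product,
  -- `ν * sideℚ i = 2 ν² (C + C′) - 4 ν² C C′`; since `ν² C` and `ν² C′` are at most 2, this is at
  -- most 8. `rest` is the exact slack.
  ν*sideℚ≤8 : ∀ i → ν ℚ.* sideℚ i ℚ.≤ 8ℚ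
  ν*sideℚ≤8 i = subst₂ ℚ._≤_ (ℚ.+-identityʳ (ν ℚ.* sideℚ i)) 8≡ (ℚ.+-monoʳ-≤ (ν ℚ.* sideℚ i) 0≤rest)
    where
    open ≡-Reasoning
    D D′ C C′ rest : ℚ
    D = squared-norm (b i)
    D′ = squared-norm (b (suc i))
    C = c i
    C′ = c (suc i)
    rest = 2ℚ ℚ.* (C ℚ.* excess i) ℚ.+ 2ℚ ℚ.* (C′ ℚ.* excess (suc i)) ℚ.+ 4ℚ ℚ.* (ν ℚ.* ν ℚ.* (C ℚ.* C′))
    0≤rest : 0ℚ ℚ.≤ rest
    0≤rest = +-nonneg (+-nonneg
      (*-nonneg (ℚ.<⇒≤ (ℚ.positive⁻¹ 2ℚ)) (*-nonneg (ℚ.<⇒≤ (0<c i)) (0≤p*p (ν ℚ.- ⌜ + i ⌝ ℚ.- ⌜ + i ⌝))))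
      (*-nonneg (ℚ.<⇒≤ (ℚ.positive⁻¹ 2ℚ)) (*-nonneg (ℚ.<⇒≤ (0<c (suc i))) (0≤p*p (ν ℚ.- ⌜ + suc i ⌝ ℚ.- ⌜ + suc i ⌝)))))
      (ℚ.<⇒≤ (*-pos (ℚ.positive⁻¹ 4ℚ) (*-pos (*-pos 0<ν 0<ν) (*-pos (0<c i) (0<c (suc i))))))
    excess-D : ∀ j → excess j ≡ 2ℚ ℚ.* squared-norm (b j) ℚ.- ν ℚ.* ν
    excess-D j = trans (solve 2 (λ ν x → x := con 2ℚ :* (con ½ :* (ν :* ν :+ x)) :- ν :* ν) refl ν (excess j))
      (cong (λ d → 2ℚ ℚ.* d ℚ.- ν ℚ.* ν) (sym (squared-norm-b j)))
    8≡ : ν ℚ.* sideℚ i ℚ.+ rest ≡ 8ℚ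
    8≡ = begin
      ν ℚ.* (2ℚ ℚ.* detℚ (w i) (w (suc i))) ℚ.+ rest
        ≡⟨ cong₂ (λ x y → ν ℚ.* (2ℚ ℚ.* x) ℚ.+ y)
             (trans (det-on-circle (b i) (b (suc i))) (cong₂ (λ d o → C ℚ.* C′ ℚ.* (2ℚ ℚ.* (d ℚ.* o))) (det-b-suc i) (dot-b-suc i)))
             (cong₂ (λ x y → 2ℚ ℚ.* (C ℚ.* x) ℚ.+ 2ℚ ℚ.* (C′ ℚ.* y) ℚ.+ 4ℚ ℚ.* (ν ℚ.* ν ℚ.* (C ℚ.* C′))) (excess-D i) (excess-D (suc i))) ⟩
      ν ℚ.* (2ℚ ℚ.* (C ℚ.* C′ ℚ.* (2ℚ ℚ.* (ν ℚ.* (½ ℚ.* (D ℚ.+ D′ ℚ.- 2ℚ)))))) ℚ.+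
        (2ℚ ℚ.* (C ℚ.* (2ℚ ℚ.* D ℚ.- ν ℚ.* ν)) ℚ.+ 2ℚ ℚ.* (C′ ℚ.* (2ℚ ℚ.* D′ ℚ.- ν ℚ.* ν)) ℚ.+ 4ℚ ℚ.* (ν ℚ.* ν ℚ.* (C ℚ.* C′)))
        ≡⟨ solve 5 (λ ν C C′ D D′ →
             ν :* (con 2ℚ :* (C :* C′ :* (con 2ℚ :* (ν :* (con ½ :* (D :+ D′ :- con 2ℚ)))))) :+
               (con 2ℚ :* (C :* (con 2ℚ :* D :- ν :* ν)) :+ con 2ℚ :* (C′ :* (con 2ℚ :* D′ :- ν :* ν)) :+ con 4ℚ :* (ν :* ν :* (C :* C′)))
             := con 2ℚ :* (ν :* ν :* C′) :* (D :* C :- con 1ℚ) :+ con 2ℚ :* (ν :* ν :* C) :* (D′ :* C′ :- con 1ℚ) :+ con 4ℚ :* (D :* C :+ D′ :* C′))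
             refl ν C C′ D D′ ⟩
      2ℚ ℚ.* (ν ℚ.* ν ℚ.* C′) ℚ.* (D ℚ.* C ℚ.- 1ℚ) ℚ.+ 2ℚ ℚ.* (ν ℚ.* ν ℚ.* C) ℚ.* (D′ ℚ.* C′ ℚ.- 1ℚ) ℚ.+ 4ℚ ℚ.* (D ℚ.* C ℚ.+ D′ ℚ.* C′)
        ≡⟨ cong₂ (λ x y → 2ℚ ℚ.* (ν ℚ.* ν ℚ.* C′) ℚ.* (x ℚ.- 1ℚ) ℚ.+ 2ℚ ℚ.* (ν ℚ.* ν ℚ.* C) ℚ.* (y ℚ.- 1ℚ) ℚ.+ 4ℚ ℚ.* (x ℚ.+ y))
             (recipℚ-inverse D (0<∣b∣² i)) (recipℚ-inverse D′ (0<∣b∣² (suc i))) ⟩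
      2ℚ ℚ.* (ν ℚ.* ν ℚ.* C′) ℚ.* 0ℚ ℚ.+ 2ℚ ℚ.* (ν ℚ.* ν ℚ.* C) ℚ.* 0ℚ ℚ.+ 8ℚ
        ≡⟨ solve 3 (λ ν C C′ → con 2ℚ :* (ν :* ν :* C′) :* con 0ℚ :+ con 2ℚ :* (ν :* ν :* C) :* con 0ℚ :+ con 8ℚ := con 8ℚ) refl ν C C′ ⟩
      8ℚ ∎

  sideℚ< : ∀ {g} → 8ℚ ℚ.< g ℚ.* ν → ∀ i → sideℚ i ℚ.< g
  sideℚ< {g} 8<gν i = ℚ.*-cancelˡ-<-nonNeg ν {{ℚ.nonNegative (ℚ.<⇒≤ 0<ν)}}
    (ℚ.≤-<-trans (ν*sideℚ≤8 i) (subst (8ℚ ℚ.<_) (ℚ.*-comm g ν) 8<gν))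

-- The rotated polygons as partitions of the real circle

infix 4 _≐²_

_≐²_ : ℝ² → ℚ² → Set
(x , y) ≐² (p , q) = x ≐ p × y ≐ q

toℝ² : ℚ² → ℝ²
toℝ² (p , q) = fromℚ p , fromℚ q

toℝ²-≐² : ∀ v → toℝ² v ≐² v
toℝ²-≐² (p , q) = fromℚ-≐ p , fromℚ-≐ q

-²-≐² : ∀ {p q v w} → p ≐² v → q ≐² w → p -² q ≐² v -ℚ² w
-²-≐² (f , g) (h , k) = -‿≐ f h , -‿≐ g k

det-≐ : ∀ {p q v w} → p ≐² v → q ≐² w → det p q ≐ detℚ v w
det-≐ (f , g) (h , k) = -‿≐ (*-≐ f k) (*-≐ g h)

dot-≐ : ∀ {p q v w} → p ≐² v → q ≐² w → ⟨ p , q ⟩ ≐ dotℚ v w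
dot-≐ (f , g) (h , k) = +-≐ (*-≐ f h) (*-≐ g k)

module _ (n : ℕ) (3≤n : 3 ℕ.≤ n) {r : ℚ²} (r-unit : Unit r) where

  open Vertices n 3≤n

  vertexℚ : ℕ → ℚ²
  vertexℚ i = r ⊡ (w i ⊡ w i)

  -- `sideℚ` does not involve `r`, so the polygons for different rotations have the same sides and
  -- their Riemann sums can be combined term by term.
  polygon : Polygon
  polygon = record
    { size             = n
    ; size-positive    = ℕ.≤-trans (ℕ.s≤s ℕ.z≤n) 3≤n
    ; vertex           = λ i → toℝ² (vertexℚ i)
    ; closed           = ≐⇒≃ (fromℚ-≐ _) (fromℚ-≐ _) (cong (λ z → proj₁ (r ⊡ z)) w-closed)
                       , ≐⇒≃ (fromℚ-≐ _) (fromℚ-≐ _) (cong (λ z → proj₂ (r ⊡ z)) w-closed)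
    ; on-circle        = λ i _ → ≐⇒≃ (dot-≐ (V i) (V i)) (fromℚ-≐ 1ℚ)
                           (⊡-unit {r} {w i ⊡ w i} r-unit (⊡-unit {w i} {w i} (w-unit i) (w-unit i)))
    ; counterclockwise = λ i j k i<j j<k k<n → ≐⇒< (fromℚ-≐ 0ℚ) (det-≐ (-²-≐² (V j) (V i)) (-²-≐² (V k) (V i)))
                           (subst (0ℚ ℚ.<_) (sym (inscribed-area {r} {w i} {w j} {w k} r-unit (w-unit i) (w-unit j) (w-unit k)))
                             (*-pos (ℚ.positive⁻¹ 4ℚ) (*-pos (*-pos (det-w-positive i<j (ℕ.<-trans j<k k<n)) (det-w-positive j<k k<n))
                                                             (det-w-positive (ℕ.<-trans i<j j<k) k<n))))
    ; minor-arcs       = λ i _ → ≐⇒< (fromℚ-≐ 0ℚ) (det-≐ (V i) (V (suc i)))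
                           (subst (0ℚ ℚ.<_) (sym (det-rotated-squares {r} (w i) (w (suc i)) r-unit))
                             (*-pos (ℚ.positive⁻¹ 2ℚ) (*-pos (det-w-suc-positive i) (dot-w-suc-positive i))))
    ; side             = λ i → fromℚ (sideℚ i)
    ; side-nonneg      = λ i _ → ≐⇒≤ (fromℚ-≐ 0ℚ) (fromℚ-≐ (sideℚ i))
                           (ℚ.<⇒≤ (*-pos (ℚ.positive⁻¹ 2ℚ) (det-w-suc-positive i)))
    ; side-length      = λ i _ → ≐⇒≃ (*-≐ (fromℚ-≐ (sideℚ i)) (fromℚ-≐ (sideℚ i))) (dot-≐ (-²-≐² (V (suc i)) (V i)) (-²-≐² (V (suc i)) (V i)))
                           (chord² {r} {w i} {w (suc i)} r-unit (w-unit i) (w-unit (suc i)))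
    }
    where
    V : ∀ i → toℝ² (vertexℚ i) ≐² vertexℚ i
    V i = toℝ²-≐² (vertexℚ i)

-- The harmonic polynomial Re (x + i y)⁴

re⁴ : Polynomial
re⁴ = (1ℝ , 4 , 0) ∷ (fromℤ -[1+ 5 ] , 2 , 2) ∷ (1ℝ , 0 , 4) ∷ []

re⁴ℚ : ℚ² → ℚ
re⁴ℚ v = proj₁ ((v ⊡ v) ⊡ (v ⊡ v))

≐-resp : ∀ {x p q} → x ≐ p → p ≡ q → x ≐ q
≐-resp f refl = f

eval-re⁴-≐ : ∀ {p v} → p ≐² v → eval re⁴ p ≐ re⁴ℚ v
eval-re⁴-≐ {v = x , y} (f , g) = ≐-resp
  (+-≐ (*-≐ one (*-≐ (*-≐ f (*-≐ f (*-≐ f (*-≐ f one)))) one))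
    (+-≐ (*-≐ (fromℚ-≐ ⌜ -[1+ 5 ] ⌝) (*-≐ (*-≐ f (*-≐ f one)) (*-≐ g (*-≐ g one))))
      (+-≐ (*-≐ one (*-≐ one (*-≐ g (*-≐ g (*-≐ g (*-≐ g one)))))) (fromℚ-≐ 0ℚ))))
  (solve 2 (λ x y →
    con 1ℚ :* ((x :* (x :* (x :* (x :* con 1ℚ)))) :* con 1ℚ) :+
      (con ⌜ -[1+ 5 ] ⌝ :* ((x :* (x :* con 1ℚ)) :* (y :* (y :* con 1ℚ))) :+
        (con 1ℚ :* (con 1ℚ :* (y :* (y :* (y :* (y :* con 1ℚ))))) :+ con 0ℚ))
    := (x :* x :- y :* y) :* (x :* x :- y :* y) :- (x :* y :+ y :* x) :* (x :* y :+ y :* x)) refl x y)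
  where
  one : 1ℝ ≐ 1ℚ
  one = fromℚ-≐ 1ℚ

mirror : ℚ² → ℚ²
mirror (s , t) = s , ℚ.- t

re⁴-rotations : ∀ u v → re⁴ℚ (u ⊡ v) ℚ.+ re⁴ℚ (mirror u ⊡ v) ≡ 2ℚ ℚ.* re⁴ℚ u ℚ.* re⁴ℚ v
re⁴-rotations (s , t) (a , b) = solve 4 (λ s t a b →
    (let x = s :* a :- t :* b ; y = s :* b :+ t :* a in
      (x :* x :- y :* y) :* (x :* x :- y :* y) :- (x :* y :+ y :* x) :* (x :* y :+ y :* x)) :+
    (let x = s :* a :- (:- t) :* b ; y = s :* b :+ (:- t) :* a in
      (x :* x :- y :* y) :* (x :* x :- y :* y) :- (x :* y :+ y :* x) :* (x :* y :+ y :* x))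
    := con 2ℚ :* ((s :* s :- t :* t) :* (s :* s :- t :* t) :- (s :* t :+ t :* s) :* (s :* t :+ t :* s))
              :* ((a :* a :- b :* b) :* (a :* a :- b :* b) :- (a :* b :+ b :* a) :* (a :* b :+ b :* a))) refl s t a b

rotation : ℚ²
rotation = + 3 ℚ./ 5 , + 4 ℚ./ 5

module _ (n : ℕ) (3≤n : 3 ℕ.≤ n) where

  open Vertices n 3≤n

  re⁴-sum : ℚ² → ℚ
  re⁴-sum r = List.foldr ℚ._+_ 0ℚ (List.map (λ i → re⁴ℚ (r ⊡ (w i ⊡ w i)) ℚ.* sideℚ i) (upTo n))

  riemannSum-≐ : ∀ {r} (r-unit : Unit r) → riemannSum (eval re⁴) (polygon n 3≤n {r} r-unit) ≐ re⁴-sum r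
  riemannSum-≐ {r} _ = sum-≐ (λ i → *-≐ (eval-re⁴-≐ (toℝ²-≐² (r ⊡ (w i ⊡ w i)))) (fromℚ-≐ (sideℚ i))) (upTo n)

  -- `re⁴-rotations` at each vertex, weighted by the common side. The unrotated polygon is the one
  -- rotated by (1, 0), so the three sums have the same form.
  re⁴-sum-rotations : ∀ r → re⁴-sum r ℚ.+ re⁴-sum (mirror r) ≡ 2ℚ ℚ.* re⁴ℚ r ℚ.* re⁴-sum (1ℚ , 0ℚ)
  re⁴-sum-rotations r = go (upTo n)
    where
    open ≡-Reasoning
    term : ℚ² → ℕ → ℚ
    term r i = re⁴ℚ (r ⊡ (w i ⊡ w i)) ℚ.* sideℚ i
    S : ℚ² → List ℕ → ℚ
    S r is = List.foldr ℚ._+_ 0ℚ (List.map (term r) is)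
    1⊡ : ∀ v → (1ℚ , 0ℚ) ⊡ v ≡ v
    1⊡ (x , y) = cong₂ _,_ (solve 2 (λ x y → con 1ℚ :* x :- con 0ℚ :* y := x) refl x y)
                           (solve 2 (λ x y → con 1ℚ :* y :+ con 0ℚ :* x := y) refl x y)
    term-rotations : ∀ i → term r i ℚ.+ term (mirror r) i ≡ 2ℚ ℚ.* re⁴ℚ r ℚ.* term (1ℚ , 0ℚ) i
    term-rotations i = begin
      term r i ℚ.+ term (mirror r) i
        ≡⟨ ℚ.*-distribʳ-+ (sideℚ i) (re⁴ℚ (r ⊡ v)) (re⁴ℚ (mirror r ⊡ v)) ⟨
      (re⁴ℚ (r ⊡ v) ℚ.+ re⁴ℚ (mirror r ⊡ v)) ℚ.* sideℚ i
        ≡⟨ cong (ℚ._* sideℚ i) (trans (re⁴-rotations r v) (cong (λ z → 2ℚ ℚ.* re⁴ℚ r ℚ.* re⁴ℚ z) (sym (1⊡ v)))) ⟩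
      2ℚ ℚ.* re⁴ℚ r ℚ.* re⁴ℚ ((1ℚ , 0ℚ) ⊡ v) ℚ.* sideℚ i
        ≡⟨ ℚ.*-assoc (2ℚ ℚ.* re⁴ℚ r) (re⁴ℚ ((1ℚ , 0ℚ) ⊡ v)) (sideℚ i) ⟩
      2ℚ ℚ.* re⁴ℚ r ℚ.* term (1ℚ , 0ℚ) i ∎
      where
      v : ℚ²
      v = w i ⊡ w i
    go : ∀ is → S r is ℚ.+ S (mirror r) is ≡ 2ℚ ℚ.* re⁴ℚ r ℚ.* S (1ℚ , 0ℚ) is
    go []       = sym (ℚ.*-zeroʳ (2ℚ ℚ.* re⁴ℚ r))
    go (i ∷ is) = begin
      (term r i ℚ.+ S r is) ℚ.+ (term (mirror r) i ℚ.+ S (mirror r) is)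
        ≡⟨ solve 4 (λ a b c d → (a :+ b) :+ (c :+ d) := (a :+ c) :+ (b :+ d)) refl (term r i) (S r is) (term (mirror r) i) (S (mirror r) is) ⟩
      (term r i ℚ.+ term (mirror r) i) ℚ.+ (S r is ℚ.+ S (mirror r) is)
        ≡⟨ cong₂ ℚ._+_ (term-rotations i) (go is) ⟩
      2ℚ ℚ.* re⁴ℚ r ℚ.* term (1ℚ , 0ℚ) i ℚ.+ 2ℚ ℚ.* re⁴ℚ r ℚ.* S (1ℚ , 0ℚ) is
        ≡⟨ ℚ.*-distribˡ-+ (2ℚ ℚ.* re⁴ℚ r) (term (1ℚ , 0ℚ) i) (S (1ℚ , 0ℚ) is) ⟨
      2ℚ ℚ.* re⁴ℚ r ℚ.* (term (1ℚ , 0ℚ) i ℚ.+ S (1ℚ , 0ℚ) is) ∎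

opaque
  unfolding _+_ -_ ∣_∣

  within : ∀ {x y p e} → x ≐ p → ∣ x - y ∣ < fromℚ e → ∃[ N ] (∀ n → N ℕ.≤ n → ℚ.∣ p ℚ.- seq y n ∣ ℚ.< e)
  within {x} {y} {p} {e} (const f) (mk< gap 0<gap N apart) = N , λ n N≤n →
    subst (λ q → ℚ.∣ q ℚ.- seq y n ∣ ℚ.< e) (f n) (ℚ.<-trans (p<p+q _ 0<gap) (apart n N≤n))

κ : ℚ
κ = re⁴ℚ rotation

-- If I is close to S, S₁ and S₂, then 2 I ≈ S₁ + S₂ ≈ 2 κ I, where κ = -527/625.
rotation-estimate : ∀ {S S₁ S₂ I e} → S₁ ℚ.+ S₂ ≡ 2ℚ ℚ.* κ ℚ.* S →
  ℚ.∣ S ℚ.- I ∣ ℚ.< e → ℚ.∣ S₁ ℚ.- I ∣ ℚ.< e → ℚ.∣ S₂ ℚ.- I ∣ ℚ.< e → ℚ.∣ I ∣ ℚ.< 2ℚ ℚ.* e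
rotation-estimate {S} {S₁} {S₂} {I} {e} eq h h₁ h₂ = ℚ.*-cancelˡ-<-nonNeg 2ℚ
  (ℚ.≤-<-trans 2∣I∣≤ (subst (ℚ.∣ x ∣ ℚ.+ ℚ.∣ y ∣ ℚ.+ 2ℚ ℚ.* ℚ.∣ z ∣ ℚ.<_)
    (solve 1 (λ e → e :+ e :+ con 2ℚ :* e := con 2ℚ :* (con 2ℚ :* e)) refl e)
    (ℚ.+-mono-< (ℚ.+-mono-< h₁ h₂) (ℚ.*-monoʳ-<-pos 2ℚ h))))
  where
  x y z : ℚ
  x = S₁ ℚ.- I
  y = S₂ ℚ.- I
  z = S ℚ.- I
  open ℚ.≤-Reasoning
  combination : (2ℚ ℚ.- 2ℚ ℚ.* κ) ℚ.* I ≡ (x ℚ.+ y ℚ.- 2ℚ ℚ.* κ ℚ.* z) ℚ.* ℚ.- 1ℚ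
  combination = trans
    (solve 3 (λ S I k → (con 2ℚ :- k) :* I := (k :* S :- (I :+ I) :- k :* (S :- I)) :* :- con 1ℚ) refl S I (2ℚ ℚ.* κ))
    (trans (cong (λ t → (t ℚ.- (I ℚ.+ I) ℚ.- 2ℚ ℚ.* κ ℚ.* z) ℚ.* ℚ.- 1ℚ) (sym eq))
      (solve 4 (λ a b I t → (a :+ b :- (I :+ I) :- t) :* :- con 1ℚ := (a :- I :+ (b :- I) :- t) :* :- con 1ℚ) refl S₁ S₂ I (2ℚ ℚ.* κ ℚ.* z)))
  2∣I∣≤ : 2ℚ ℚ.* ℚ.∣ I ∣ ℚ.≤ ℚ.∣ x ∣ ℚ.+ ℚ.∣ y ∣ ℚ.+ 2ℚ ℚ.* ℚ.∣ z ∣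
  2∣I∣≤ = begin
    2ℚ ℚ.* ℚ.∣ I ∣                                  ≤⟨ ℚ.*-monoʳ-≤-nonNeg ℚ.∣ I ∣ {{ℚ.∣-∣-nonNeg I}} 2≤2-2κ ⟩
    (2ℚ ℚ.- 2ℚ ℚ.* κ) ℚ.* ℚ.∣ I ∣                   ≡⟨ ℚ.∣p*q∣≡∣p∣*∣q∣ (2ℚ ℚ.- 2ℚ ℚ.* κ) I ⟨
    ℚ.∣ (2ℚ ℚ.- 2ℚ ℚ.* κ) ℚ.* I ∣                   ≡⟨ cong ℚ.∣_∣ combination ⟩
    ℚ.∣ (x ℚ.+ y ℚ.- 2ℚ ℚ.* κ ℚ.* z) ℚ.* ℚ.- 1ℚ ∣   ≡⟨ ℚ.∣p*q∣≡∣p∣*∣q∣ (x ℚ.+ y ℚ.- 2ℚ ℚ.* κ ℚ.* z) (ℚ.- 1ℚ) ⟩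
    ℚ.∣ x ℚ.+ y ℚ.- 2ℚ ℚ.* κ ℚ.* z ∣ ℚ.* 1ℚ         ≡⟨ ℚ.*-identityʳ _ ⟩
    ℚ.∣ x ℚ.+ y ℚ.- 2ℚ ℚ.* κ ℚ.* z ∣                ≤⟨ ℚ.∣p-q∣≤∣p∣+∣q∣ (x ℚ.+ y) (2ℚ ℚ.* κ ℚ.* z) ⟩
    ℚ.∣ x ℚ.+ y ∣ ℚ.+ ℚ.∣ 2ℚ ℚ.* κ ℚ.* z ∣          ≤⟨ ℚ.+-mono-≤ (ℚ.∣p+q∣≤∣p∣+∣q∣ x y) ∣2κz∣≤ ⟩
    ℚ.∣ x ∣ ℚ.+ ℚ.∣ y ∣ ℚ.+ 2ℚ ℚ.* ℚ.∣ z ∣          ∎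
    where
    -- This holds because κ is negative: for `rotation` the coefficient of I is at least 2, so
    -- dividing by it loses nothing.
    2≤2-2κ : 2ℚ ℚ.≤ 2ℚ ℚ.- 2ℚ ℚ.* κ
    2≤2-2κ = toWitness {a? = 2ℚ ℚ.≤? 2ℚ ℚ.- 2ℚ ℚ.* κ} _
    ∣2κ∣≤2 : ℚ.∣ 2ℚ ℚ.* κ ∣ ℚ.≤ 2ℚ
    ∣2κ∣≤2 = toWitness {a? = ℚ.∣ 2ℚ ℚ.* κ ∣ ℚ.≤? 2ℚ} _
    ∣2κz∣≤ : ℚ.∣ 2ℚ ℚ.* κ ℚ.* z ∣ ℚ.≤ 2ℚ ℚ.* ℚ.∣ z ∣
    ∣2κz∣≤ = subst (ℚ._≤ 2ℚ ℚ.* ℚ.∣ z ∣) (sym (ℚ.∣p*q∣≡∣p∣*∣q∣ (2ℚ ℚ.* κ) z))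
      (ℚ.*-monoʳ-≤-nonNeg ℚ.∣ z ∣ {{ℚ.∣-∣-nonNeg z}} ∣2κ∣≤2)

small-sides : ∀ {δ} → 0ℝ < δ → ∃[ n ] Σ[ 3≤n ∈ 3 ℕ.≤ n ] (∀ i → fromℚ (Vertices.sideℚ n 3≤n i) < δ)
small-sides {δ} (mk< gap 0<gap N apart) =
  -- 8 is the constant of the mesh bound. Half of `gap` bounds the sides; the other half is the gap
  -- left below δ.
  let (n , 9≤n , 8<) = archimedean 8 (½ ℚ.* gap) (half-pos 0<gap)
      3≤n            = ℕ.≤-trans (ℕ.s≤s (ℕ.s≤s (ℕ.s≤s ℕ.z≤n))) 9≤n
  in n , 3≤n , λ i → mk< (½ ℚ.* gap) (half-pos 0<gap) N λ k N≤k → ℚ.<-trans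
       (subst (Vertices.sideℚ n 3≤n i ℚ.+ ½ ℚ.* gap ℚ.<_) (half+half gap)
         (ℚ.+-monoˡ-< (½ ℚ.* gap) (Vertices.sideℚ< n 3≤n {½ ℚ.* gap} 8< i)))
       (subst (ℚ._< seq δ k) (ℚ.+-identityˡ gap) (apart k N≤k))

-- One δ serves all three polygons, their sides being the same. The tolerance is ε / 2 because
-- `rotation-estimate` doubles it.
integral-re⁴≃0 : ∀ {I} → HasCircleIntegral (eval re⁴) I → I ≃ 0ℝ
integral-re⁴≃0 {I} integral = mk≃ λ ε 0<ε →
  let e                 = ½ ℚ.* ε
      (δ , 0<δ , h)     = integral (fromℚ e) (≐⇒< (fromℚ-≐ 0ℚ) (fromℚ-≐ e) (half-pos 0<ε))
      (n , 3≤n , small) = small-sides 0<δ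
      bound             = λ {r} (r! : Unit r) → within {y = I} (riemannSum-≐ n 3≤n {r} r!) (h (polygon n 3≤n {r} r!) (λ i _ → small i))
      (N₀ , h₀)         = bound {1ℚ , 0ℚ} refl
      (N₁ , h₁)         = bound {rotation} refl
      (N₂ , h₂)         = bound {mirror rotation} refl
  in N₀ ℕ.⊔ (N₁ ℕ.⊔ N₂) , λ k N≤k → subst₂ ℚ._<_
       (cong ℚ.∣_∣ (sym (ℚ.+-identityʳ (seq I k))))
       (solve 1 (λ ε → con 2ℚ :* (con ½ :* ε) := ε) refl ε)
       (rotation-estimate {re⁴-sum n 3≤n (1ℚ , 0ℚ)} {re⁴-sum n 3≤n rotation} {re⁴-sum n 3≤n (mirror rotation)}
         (re⁴-sum-rotations n 3≤n rotation)
         (h₀ k (⊔ˡ N₀ (N₁ ℕ.⊔ N₂) N≤k))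
         (h₁ k (⊔ˡ N₁ N₂ (⊔ʳ N₀ (N₁ ℕ.⊔ N₂) N≤k)))
         (h₂ k (⊔ʳ N₁ N₂ (⊔ʳ N₀ (N₁ ℕ.⊔ N₂) N≤k))))

-- Arithmetic of real numbers up to _≃_

opaque
  unfolding _+_ _*_ -_ recip

  +-cong : ∀ {x x′ y y′} → x ≃ x′ → y ≃ y′ → x + y ≃ x′ + y′
  +-cong {x} {x′} {y} {y′} x≃x′ y≃y′ = mk≃ λ ε 0<ε →
    let (N₁ , h₁) = close x≃x′ (½ ℚ.* ε) (half-pos 0<ε)
        (N₂ , h₂) = close y≃y′ (½ ℚ.* ε) (half-pos 0<ε)
    in N₁ ℕ.⊔ N₂ , λ n N≤n → subst₂ ℚ._<_ refl (half+half ε)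
         (ℚ.≤-<-trans
           (subst (λ e → ℚ.∣ e ∣ ℚ.≤ ℚ.∣ seq x n ℚ.- seq x′ n ∣ ℚ.+ ℚ.∣ seq y n ℚ.- seq y′ n ∣)
             (solve 4 (λ a b c d → (a :- b) :+ (c :- d) := (a :+ c) :- (b :+ d)) refl (seq x n) (seq x′ n) (seq y n) (seq y′ n))
             (ℚ.∣p+q∣≤∣p∣+∣q∣ (seq x n ℚ.- seq x′ n) (seq y n ℚ.- seq y′ n)))
           (ℚ.+-mono-< (h₁ n (⊔ˡ N₁ N₂ N≤n)) (h₂ n (⊔ʳ N₁ N₂ N≤n))))

  *-cong : ∀ {x x′ y y′} → x ≃ x′ → y ≃ y′ → x * y ≃ x′ * y′
  *-cong {x} {x′} {y} {y′} x≃x′ y≃y′ = mk≃ λ ε 0<ε →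
    let (A , 0<A , N₁ , a) = eventually-bounded x
        (B , 0<B , N₂ , b) = eventually-bounded y′
        (δ₁ , 0<δ₁ , e₁)   = divide A 0<A (½ ℚ.* (½ ℚ.* ε)) (half-pos (half-pos 0<ε))
        (δ₂ , 0<δ₂ , e₂)   = divide B 0<B (½ ℚ.* (½ ℚ.* ε)) (half-pos (half-pos 0<ε))
        (N₃ , h₃)          = close y≃y′ δ₁ 0<δ₁
        (N₄ , h₄)          = close x≃x′ δ₂ 0<δ₂
        N₁₂ = N₁ ℕ.⊔ N₂
        N₃₄ = N₃ ℕ.⊔ N₄
    in N₁₂ ℕ.⊔ N₃₄ , λ n N≤n →
       *-estimate {ε} {A} {B} {δ₁} {δ₂} (seq x n) (seq x′ n) (seq y n) (seq y′ n) 0<ε e₁ e₂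
         (a n (⊔ˡ N₁ N₂ (⊔ˡ N₁₂ N₃₄ N≤n)))
         (h₃ n (⊔ˡ N₃ N₄ (⊔ʳ N₁₂ N₃₄ N≤n)))
         (b n (⊔ʳ N₁ N₂ (⊔ˡ N₁₂ N₃₄ N≤n)))
         (h₄ n (⊔ʳ N₃ N₄ (⊔ʳ N₁₂ N₃₄ N≤n)))

  *-comm : ∀ x y → x * y ≃ y * x
  *-comm x y = pointwise⇒≃ λ n → ℚ.*-comm (seq x n) (seq y n)

  *-assoc : ∀ x y z → x * y * z ≃ x * (y * z)
  *-assoc x y z = pointwise⇒≃ λ n → ℚ.*-assoc (seq x n) (seq y n) (seq z n)

  *-identityˡ : ∀ x → 1ℝ * x ≃ x
  *-identityˡ x = pointwise⇒≃ λ n → ℚ.*-identityˡ (seq x n)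

  *-zeroʳ : ∀ x → x * 0ℝ ≃ 0ℝ
  *-zeroʳ x = pointwise⇒≃ λ n → ℚ.*-zeroʳ (seq x n)

  *-distribˡ-+ : ∀ x y z → x * y + x * z ≃ x * (y + z)
  *-distribˡ-+ x y z = pointwise⇒≃ λ n → sym (ℚ.*-distribˡ-+ (seq x n) (seq y n) (seq z n))

  recip-inverse : ∀ x (0<x : 0ℝ < x) → recip x 0<x * x ≃ 1ℝ
  recip-inverse x 0<x@(mk< gap 0<gap N apart) = mk≃ λ ε 0<ε → N , λ n N≤n →
    subst (λ q → ℚ.∣ q ℚ.- 1ℚ ∣ ℚ.< ε)
      (sym (trans (ℚ.*-comm (recipℚ (seq x n)) (seq x n))
        (recipℚ-inverse (seq x n) (ℚ.<-trans (subst (0ℚ ℚ.<_) (sym (ℚ.+-identityˡ gap)) 0<gap) (apart n N≤n))))) 0<ε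

  eval-re⁴-· : ∀ ρ x y → eval re⁴ (ρ * x , ρ * y) ≃ ρ * (ρ * (ρ * ρ)) * eval re⁴ (x , y)
  eval-re⁴-· ρ x y = pointwise⇒≃ λ n →
    solve 4 (λ r x y s →
      con 1ℚ :* ((r :* x :* (r :* x :* (r :* x :* (r :* x :* con 1ℚ)))) :* con 1ℚ) :+
        (s :* ((r :* x :* (r :* x :* con 1ℚ)) :* (r :* y :* (r :* y :* con 1ℚ))) :+
          (con 1ℚ :* (con 1ℚ :* (r :* y :* (r :* y :* (r :* y :* (r :* y :* con 1ℚ))))) :+ con 0ℚ))
      := r :* (r :* (r :* r)) :*
        (con 1ℚ :* ((x :* (x :* (x :* (x :* con 1ℚ)))) :* con 1ℚ) :+
          (s :* ((x :* (x :* con 1ℚ)) :* (y :* (y :* con 1ℚ))) :+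
            (con 1ℚ :* (con 1ℚ :* (y :* (y :* (y :* (y :* con 1ℚ))))) :+ con 0ℚ))))
      refl (seq ρ n) (seq x n) (seq y n) ⌜ -[1+ 5 ] ⌝

^-cong : ∀ {x y} k → x ≃ y → x ^ k ≃ y ^ k
^-cong zero    x≃y = ≃-refl
^-cong (suc k) x≃y = *-cong x≃y (^-cong k x≃y)

eval-cong : ∀ f {p q} → p ≈² q → eval f p ≃ eval f q
eval-cong []                _ = ≃-refl
eval-cong ((c , a , b) ∷ f) p≈q@(x≃ , y≃) = +-cong (*-cong ≃-refl (*-cong (^-cong a x≃) (^-cong b y≃))) (eval-cong f p≈q)

-- Distinct rationals stay at the fixed distance `∣ p - q ∣`, which is taken as the ε that closeness
-- would have to beat.
≐-injective : ∀ {x y p q} → x ≐ p → y ≐ q → x ≃ y → p ≡ q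
≐-injective {x} {y} {p} {q} (const f) (const g) x≃y with p ℚ.≟ q
... | yes p≡q = p≡q
... | no p≢q = contradiction (subst₂ (λ a b → ℚ.∣ a ℚ.- b ∣ ℚ.< ε) (f N) (g N) (proj₂ bound N ℕ.≤-refl)) (ℚ.<-irrefl refl)
  where
  ε : ℚ
  ε = ℚ.∣ p ℚ.- q ∣
  p-q≢0 : p ℚ.- q ≢ 0ℚ
  p-q≢0 eq = p≢q (trans (solve 2 (λ p q → p := (p :- q) :+ q) refl p q) (trans (cong (ℚ._+ q) eq) (ℚ.+-identityˡ q)))
  0<ε : 0ℚ ℚ.< ε
  0<ε = ℚ.positive⁻¹ ε {{ℚ.nonNeg∧nonZero⇒pos ε {{ℚ.∣-∣-nonNeg (p ℚ.- q)}} {{ℚ.≢-nonZero λ eq → p-q≢0 (ℚ.∣p∣≡0⇒p≡0 (p ℚ.- q) eq)}}}}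
  bound : ∃[ N ] (∀ n → N ℕ.≤ n → ℚ.∣ seq x n ℚ.- seq y n ∣ ℚ.< ε)
  bound = close x≃y ε 0<ε
  N : ℕ
  N = proj₁ bound

fromℤ-injective : ∀ {a b} → fromℤ a ≃ fromℤ b → a ≡ b
fromℤ-injective {a} {b} eq = ⌜⌝-injective (≐-injective (fromℚ-≐ ⌜ a ⌝) (fromℚ-≐ ⌜ b ⌝) eq)

-- From design points to Gaussian integers

point : ℤ[i] → ℝ²
point z = fromℤ (re z) , fromℤ (im z)

⌜⌝² : ℤ[i] → ℚ²
⌜⌝² z = ⌜ re z ⌝ , ⌜ im z ⌝

⌜⌝²-⊗ : ∀ x y → ⌜⌝² (x ⊗ y) ≡ ⌜⌝² x ⊡ ⌜⌝² y
⌜⌝²-⊗ (gauss a b) (gauss c d) = cong₂ _,_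
  (trans (⌜⌝-+ (a ℤ.* c) (ℤ.- (b ℤ.* d))) (cong₂ ℚ._+_ (⌜⌝-* a c) (trans (⌜⌝-neg (b ℤ.* d)) (cong ℚ.-_ (⌜⌝-* b d)))))
  (trans (⌜⌝-+ (a ℤ.* d) (b ℤ.* c)) (cong₂ ℚ._+_ (⌜⌝-* a d) (⌜⌝-* b c)))

re⁴ℚ-⌜⌝² : ∀ z → re⁴ℚ (⌜⌝² z) ≡ ⌜ re (z ⁴) ⌝
re⁴ℚ-⌜⌝² z = sym (trans (cong proj₁ (⌜⌝²-⊗ (z ⊗ z) (z ⊗ z))) (cong (λ v → proj₁ (v ⊡ v)) (⌜⌝²-⊗ z z)))

eval-re⁴-point : ∀ z → eval re⁴ (point z) ≃ fromℤ (re (z ⁴))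
eval-re⁴-point z = ≐⇒≃ (eval-re⁴-≐ {v = ⌜⌝² z} (fromℚ-≐ _ , fromℚ-≐ _)) (fromℚ-≐ _) (re⁴ℚ-⌜⌝² z)

norm-point : ∀ z → ⟨ point z , point z ⟩ ≃ fromℕ (norm z)
norm-point (gauss a b) = ≐⇒≃ (dot-≐ {v = ⌜ a ⌝ , ⌜ b ⌝} {⌜ a ⌝ , ⌜ b ⌝} (fromℚ-≐ _ , fromℚ-≐ _) (fromℚ-≐ _ , fromℚ-≐ _)) (fromℚ-≐ _)
  (sym (trans (cong ⌜_⌝ (+norm a b)) (trans (⌜⌝-+ (a ℤ.* a) (b ℤ.* b)) (cong₂ ℚ._+_ (⌜⌝-* a a) (⌜⌝-* b b)))))

point-injective : ∀ {x y} → point x ≈² point y → x ≡ y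
point-injective {gauss a b} {gauss c d} (p , q) = cong₂ gauss (fromℤ-injective p) (fromℤ-injective q)

re-⊕ : ∀ x y → re (x ⊕ y) ≡ re x ℤ.+ re y
re-⊕ (gauss _ _) (gauss _ _) = refl

≈²-sym : ∀ {p q} → p ≈² q → q ≈² p
≈²-sym = Setoid.sym ℝ²-setoid

≈²-trans : ∀ {p q s} → p ≈² q → q ≈² s → p ≈² s
≈²-trans = Setoid.trans ℝ²-setoid

lattice-point : ∀ m q → shell ℤ² m q → ∃[ z ] q ≈² point z × norm z ≡ m
lattice-point m _ ((a , b , q₁≃ , q₂≃) , nq) = gauss a b , (q₁≃ , q₂≃) ,
  ℤ.+-injective (fromℤ-injective {+ norm (gauss a b)} {+ m} (≃-trans (≃-sym (norm-point (gauss a b)))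
    (≃-trans (≃-sym (+-cong (*-cong q₁≃ q₁≃) (*-cong q₂≃ q₂≃))) nq)))

point∈shell : ∀ {m} z → norm z ≡ m → shell ℤ² m (point z)
point∈shell (gauss a b) refl = (a , b , ≃-refl , ≃-refl) , norm-point (gauss a b)

fromℚ-cancel : ∀ {q} x → 0ℚ ℚ.< q → fromℚ q * x ≃ 0ℝ → x ≃ 0ℝ
fromℚ-cancel {q} x 0<q eq = ≃-trans (≃-sym (*-identityˡ x))
  (≃-trans (*-cong (≐⇒≃ (fromℚ-≐ 1ℚ) (*-≐ (fromℚ-≐ (recipℚ q)) (fromℚ-≐ q)) (sym (trans (ℚ.*-comm (recipℚ q) q) (recipℚ-inverse q 0<q)))) ≃-refl)
  (≃-trans (*-assoc (fromℚ (recipℚ q)) (fromℚ q) x)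
  (≃-trans (*-cong ≃-refl eq) (*-zeroʳ (fromℚ (recipℚ q))))))

mean≃0⇒sum≃0 : ∀ (f : ℝ² → ℝ) ps → mean (List⁺.map f ps) ≃ 0ℝ → sum (List.map f (toList ps)) ≃ 0ℝ
mean≃0⇒sum≃0 f (p ∷⁺ ps) = fromℚ-cancel _ (ℚ.positive⁻¹ _ {{ℚ.normalize-pos 1 (suc (List.length (List.map f ps)))}})

-- The shell scaled to the unit circle

module Scaling (r : ℝ) (0<r : 0ℝ < r) where

  ρ ρ⁴ : ℝ
  ρ = recip r 0<r
  ρ⁴ = ρ * (ρ * (ρ * ρ))

  unscale : ∀ x → x ≃ r * (ρ * x)
  unscale x = ≃-trans (≃-sym (*-identityˡ x))
    (≃-trans (*-cong (≃-sym (≃-trans (*-comm r ρ) (recip-inverse r 0<r))) ≃-refl) (*-assoc r ρ x))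

  ρ-cancel : ∀ x y → ρ * x ≃ ρ * y → x ≃ y
  ρ-cancel x y eq = ≃-trans (unscale x) (≃-trans (*-cong ≃-refl eq) (≃-sym (unscale y)))

  ρ*≃0 : ∀ x → ρ * x ≃ 0ℝ → x ≃ 0ℝ
  ρ*≃0 x eq = ρ-cancel x 0ℝ (≃-trans eq (≃-sym (*-zeroʳ ρ)))

  ρ⁴*≃0 : ∀ x → ρ⁴ * x ≃ 0ℝ → x ≃ 0ℝ
  ρ⁴*≃0 x eq = ρ*≃0 x (ρ*≃0 (ρ * x) (ρ*≃0 (ρ * (ρ * x)) (ρ*≃0 (ρ * (ρ * (ρ * x))) (≃-trans (≃-sym
    (≃-trans (*-assoc ρ (ρ * (ρ * ρ)) x)
      (*-cong ≃-refl (≃-trans (*-assoc ρ (ρ * ρ) x) (*-cong ≃-refl (*-assoc ρ ρ x)))))) eq))))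

  ·-point-injective : ∀ {x y} → (ρ · point x) ≈² (ρ · point y) → x ≡ y
  ·-point-injective (p , q) = point-injective (ρ-cancel _ _ p , ρ-cancel _ _ q)

  -- Design points are known only up to `_≈²_`, and their coordinates may be irrational; `z` carries
  -- the exact integer data.
  Represents : ℕ → ℝ² → ℤ[i] → Set
  Represents m p z = p ≈² (ρ · point z) × norm z ≡ m

  representative : ∀ m p → (ρ ·ˢ shell ℤ² m) p → ∃ (Represents m p)
  representative m p (q , q∈ , p≈) = let (z , (q₁≃ , q₂≃) , nz) = lattice-point m q q∈
    in z , ≈²-trans p≈ (*-cong ≃-refl q₁≃ , *-cong ≃-refl q₂≃) , nz

  representatives : ∀ m ps → (∀ p → p ∈² ps → (ρ ·ˢ shell ℤ² m) p) → ∃ (Pointwise (Represents m) ps)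
  representatives m []       _ = [] , []
  representatives m (p ∷ ps) h =
    let (z , R)   = representative m p (h p (here (Setoid.refl ℝ²-setoid)))
        (zs , Rs) = representatives m ps (λ q q∈ → h q (there q∈))
    in z ∷ zs , R ∷ Rs

  -- Equal representatives would make two design points equivalent, so distinctness passes to `zs`.
  -- Conversely `ρ` cancels, so a Gaussian integer is recovered from its scaled point, and the
  -- enumeration of the design reaches every element of norm `m`.
  representatives-isShell : ∀ {m ps zs} → Pointwise (Represents m) ps zs → Unique² ps →
    (∀ p → (ρ ·ˢ shell ℤ² m) p → p ∈² ps) → IsShell m zs
  representatives-isShell {m} Rs ps! covers = record
    { unique   = unique′ Rs ps!
    ; sound    = sound′ Rs
    ; complete = λ {z} nz → complete′ Rs (covers (ρ · point z) (point z , point∈shell z nz , Setoid.refl ℝ²-setoid))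
    }
    where
    distinct : ∀ {p z ps zs} → Represents m p z → Pointwise (Represents m) ps zs → All (λ q → ¬ p ≈² q) ps → All (z ≢_) zs
    distinct _ [] [] = []
    distinct R@(p≈ , _) ((q≈ , _) ∷ Rs) (p≉q ∷ ps≉) = (λ { refl → p≉q (≈²-trans p≈ (≈²-sym q≈)) }) ∷ distinct R Rs ps≉
    unique′ : ∀ {ps zs} → Pointwise (Represents m) ps zs → Unique² ps → Unique zs
    unique′ []       []           = []
    unique′ (R ∷ Rs) (p≉ps ∷ ps!) = distinct R Rs p≉ps ∷ unique′ Rs ps!
    sound′ : ∀ {ps zs z} → Pointwise (Represents m) ps zs → z ∈ zs → norm z ≡ m
    sound′ ((_ , nz) ∷ _)  (here refl) = nz
    sound′ (_ ∷ Rs)        (there z∈)  = sound′ Rs z∈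
    complete′ : ∀ {ps zs z} → Pointwise (Represents m) ps zs → (ρ · point z) ∈² ps → z ∈ zs
    complete′ ((p≈ , _) ∷ _) (here eq)  = here (·-point-injective (≈²-trans eq p≈))
    complete′ (_ ∷ Rs)       (there p∈) = there (complete′ Rs p∈)

  -- By homogeneity the scaling comes out as `ρ⁴`, which cancels, so vanishing of the real sum can
  -- be tested on an integer.
  sum-re⁴ : ∀ {m ps zs} → Pointwise (Represents m) ps zs → sum (List.map (eval re⁴) ps) ≃ ρ⁴ * fromℤ (re (Σ⁴ zs))
  sum-re⁴ [] = ≃-sym (*-zeroʳ ρ⁴)
  sum-re⁴ {zs = z ∷ zs} ((p≈ , _) ∷ Rs) = ≃-trans
    (+-cong (≃-trans (eval-cong re⁴ p≈) (≃-trans (eval-re⁴-· ρ (fromℤ (re z)) (fromℤ (im z))) (*-cong ≃-refl (eval-re⁴-point z)))) (sum-re⁴ Rs))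
    (≃-trans (*-distribˡ-+ ρ⁴ (fromℤ (re (z ⁴))) (fromℤ (re (Σ⁴ zs))))
      (*-cong ≃-refl (≐⇒≃ (+-≐ (fromℚ-≐ _) (fromℚ-≐ _)) (fromℚ-≐ _)
        (sym (trans (cong ⌜_⌝ (re-⊕ (z ⁴) (Σ⁴ zs))) (⌜⌝-+ (re (z ⁴)) (re (Σ⁴ zs))))))))

theorem1p1 : (m : ℕ) → 1 ℕ.≤ m → ∃ (shell ℤ² m) →
    (r : ℝ) (0<r : 0ℝ < r) → r * r ≃ fromℕ m →
    ¬ IsSphericalDesignOfRadius r 0<r 4 (shell ℤ² m)
theorem1p1 m 1≤m (p₀ , p₀∈) r 0<r _ design =
  re-shell-sum≢0 (representatives-isShell (proj₂ Z) distinct (λ p → Equivalence.to (enumerates p))) 1≤m (proj₁ z₀) (proj₂ (proj₂ z₀))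
    (fromℤ-injective (ρ⁴*≃0 _ (≃-trans (≃-sym (sum-re⁴ (proj₂ Z))) (mean≃0⇒sum≃0 (eval re⁴) points mean≃0))))
  where
  open Scaling r 0<r
  open IsSphericalDesign design hiding (on-circle)
  Z : ∃ (Pointwise (Represents m) (toList points))
  Z = representatives m (toList points) (λ p → Equivalence.from (enumerates p))
  z₀ : ∃[ z ] p₀ ≈² point z × norm z ≡ m
  z₀ = lattice-point m p₀ p₀∈
  mean≃0 : mean (List⁺.map (eval re⁴) points) ≃ 0ℝ
  mean≃0 =
    -- The three monomials of `re⁴` all have degree exactly 4, the strength of the design.
    let (I , integral , eq) = averages re⁴ (ℕ.≤-refl ∷ ℕ.≤-refl ∷ ℕ.≤-refl ∷ [])
    in ≃-trans eq (≃-trans (*-cong ≃-refl (integral-re⁴≃0 integral)) (*-zeroʳ _))
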